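{- Let $G$ be an irreflexive graph and $G^{\#}$, $T^*$ as in the context. Then $H_1(\mathbf{G}^{\#})$ has a basis ($\mathrm{NT}$-basis of $G^{\#}$) consisting only of (classes of) gadget-cycles of $G^{\#}$ and the cycles of an $\mathrm{NT}$-basis of $T^*$.
   Context: For a reflexive graph $X$, $H_1(\mathbf{X})$ is the first integral homology of its clique complex (simplices: ordered tuples of pairwise equal-or-adjacent vertices; alternating-sum boundary); cycles (closed walks) are identified with the 1-cycle of consecutive edges; an $\mathrm{NT}$-basis of $X$ is a set of cycles whose classes form a basis of $H_1(\mathbf{X})$. $H$ is a connected triangle-free reflexive graph with non-trivial $H_1(\mathbf{H})$, and $Z=(0,\dots,g-1,0)$, $g\ge4$, a fixed shortest homologically non-trivial cycle of $H$. Sum gadget $S_s$: with $B$ the reflexive cycle $0,\dots,sg-1$, $\beta(js+i)=j$, $\alpha_k(ig+j)=j$ if $i=k$ else $0$, fix $\ell\ge2$ such that for each $i\in[s]$ there is a homomorphism $P_\ell\times B\to Z$ equal to $\alpha_i$ on $0\times B$, $\beta$ on $\ell\times B$, $0$ on $P_\ell\times\{0\}$. From $P_\ell\times B$ (categorical product, $P_\ell$ reflexive path $0..\ell$): identify $(\ell,js+i)$ over $i\in[s]$ for each $j\in[g]$ giving a copy $Z$; identify $(0,ig)$ over $i\in[s]$ giving copies $A_i'$ ($(0,ig+j)$ labelled $j$); for each $i$ attach a new $P_1\times Z$ with one slice identified with $A_i'$, the other called $A_i$. Gadget-cycles of $S_s$: images of slices $j\times B$ and the $A_i$; end gadget-cycles: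 $Z$ and the $A_i$. $T(S_s)$: subgraph induced by the images of $(j,0)$, $0\le j\le\ell$, and vertex $0$ of each $A_i$. Construction of $G^{\#}$: (1) for each $v\in V(G)$ disjoint copies $A_0^v,A_1^v,A_2^v$ of $Z$ and a copy $Z^*$; (2) for each $v$ a copy $S^v$ of $S_3$ with its $Z$ identified with $Z^*$ and its $A_i$ with $A^v_i$; (3) for each $v$ and $i<j$ in $[3]$ a copy of $S_2$ with its $A_0$ identified with $A^v_i$ and its $A_1$ with $A^v_j$, label $k$ of $A_1$ going to label $-k\bmod g$; (4) for each edge $uv$ of $G$ and $i\in[3]$ a copy of $S_2$ with $A_0$ identified with $A^u_i$ and $A_1$ with $A^v_i$. Gadget-cycles of $G^{\#}$: gadget-cycles of any of the gadgets used. $T^*$: union of all $T(S)$ over the gadgets used. -}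

module Defs where

open import Data.Nat using (ℕ; zero; suc; _+_; _*_; _<_; _≤_)
open import Data.Integer as ℤ using (ℤ; 0ℤ; 1ℤ)
open import Data.Fin using (Fin; toℕ; splitAt) renaming (zero to fzero; suc to fsuc)
open import Data.Bool using (Bool; true; false)
open import Data.List using (List; []; _∷_; map; concatMap; allFin; _++_; take)
open import Data.List.Relation.Unary.All using (All)
open import Data.List.Relation.Unary.Linked using (Linked)
open import Data.Product using (Σ; ∃; ∃₂; _×_; _,_; proj₁)
open import Data.Sum using (_⊎_; inj₁; inj₂; [_,_])
open import Data.Empty using (⊥)
open import Relation.Binary.PropositionalEquality using (_≡_)
open import Relation.Binary.Construct.Closure.Equivalence using (EqClosure)

-- Free abelian group on a type X, taken modulo a relation R on the
-- generators (R is used to identify generators; it is reflexive in all uses).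
-- Formal sums are lists of (coefficient , generator).

data FreeEq {X : Set} (R : X → X → Set) : List (ℤ × X) → List (ℤ × X) → Set where
  fe-refl  : ∀ {l} → FreeEq R l l
  fe-sym   : ∀ {l l′} → FreeEq R l l′ → FreeEq R l′ l
  fe-trans : ∀ {l l′ l″} → FreeEq R l l′ → FreeEq R l′ l″ → FreeEq R l l″
  fe-cons  : ∀ {m x y l l′} → R x y → FreeEq R l l′ → FreeEq R ((m , x) ∷ l) ((m , y) ∷ l′)
  fe-swap  : ∀ {m n x y l} → FreeEq R ((m , x) ∷ (n , y) ∷ l) ((n , y) ∷ (m , x) ∷ l)
  fe-merge : ∀ {m n x l} → FreeEq R ((m , x) ∷ (n , x) ∷ l) ((m ℤ.+ n , x) ∷ l)
  fe-zero  : ∀ {x l} → FreeEq R ((0ℤ , x) ∷ l) l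

scale : {X : Set} → ℤ → List (ℤ × X) → List (ℤ × X)
scale m = map (λ { (c , x) → (m ℤ.* c , x) })

neg : {X : Set} → List (ℤ × X) → List (ℤ × X)
neg = scale (ℤ.- 1ℤ)

lastOr : {A : Set} → A → List A → A
lastOr a []       = a
lastOr a (x ∷ xs) = lastOr x xs

closeList : {A : Set} → List A → List A
closeList xs = xs ++ take 1 xs

-- Graphs (possibly presented with an equivalence on vertices, used for
-- graphs obtained by identifying vertices).

record Graph : Set₁ where
  field
    V   : Set
    _≈_ : V → V → Set
    _~_ : V → V → Set

-- First homology of the clique complex (ordered simplices), up to degree 2.

module Hom (X : Graph) where
  open Graph X

  _≃_ : V → V → Set
  a ≃ b = a ≈ b ⊎ a ~ b

  Chain₀ Chain₁ Chain₂ : Set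
  Chain₀ = List (ℤ × V)
  Chain₁ = List (ℤ × (V × V))
  Chain₂ = List (ℤ × (V × V × V))

  WF₁ : Chain₁ → Set
  WF₁ = All (λ { (_ , a , b) → a ≃ b })

  WF₂ : Chain₂ → Set
  WF₂ = All (λ { (_ , a , b , c) → (a ≃ b) × (a ≃ c) × (b ≃ c) })

  ∂₁ : Chain₁ → Chain₀
  ∂₁ []                  = []
  ∂₁ ((c , a , b) ∷ r)   = (c , b) ∷ (ℤ.- c , a) ∷ ∂₁ r

  ∂₂ : Chain₂ → Chain₁
  ∂₂ []                    = []
  ∂₂ ((c , a , b , d) ∷ r) = (c , b , d) ∷ (ℤ.- c , a , d) ∷ (c , a , b) ∷ ∂₂ r

  _≋₀_ : Chain₀ → Chain₀ → Set
  _≋₀_ = FreeEq _≈_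

  _≋₁_ : Chain₁ → Chain₁ → Set
  _≋₁_ = FreeEq (λ { (a , b) (a′ , b′) → (a ≈ a′) × (b ≈ b′) })

  IsCycle : Chain₁ → Set
  IsCycle z = WF₁ z × (∂₁ z ≋₀ [])

  IsBoundary : Chain₁ → Set
  IsBoundary z = ∃ λ (t : Chain₂) → WF₂ t × (∂₂ t ≋₁ z)

  walkChain : List V → Chain₁
  walkChain (x ∷ y ∷ r) = (1ℤ , x , y) ∷ walkChain (y ∷ r)
  walkChain _           = []

  WalkFromTo : V → V → List V → Set
  WalkFromTo a b xs = ∃ λ ys → (xs ≡ a ∷ ys) × Linked _≃_ (a ∷ ys) × (lastOr a ys ≈ b)

  ClosedWalk : List V → Set
  ClosedWalk xs = ∃ λ a → WalkFromTo a a xs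

  lincomb : (k : ℕ) → (Fin k → ℤ) → (Fin k → List V) → Chain₁
  lincomb k m w = concatMap (λ i → scale (m i) (walkChain (w i))) (allFin k)

  IsNTBasis : (k : ℕ) → (Fin k → List V) → Set
  IsNTBasis k w =
    (∀ i → ClosedWalk (w i)) ×
    (∀ z → IsCycle z → ∃ λ (m : Fin k → ℤ) → IsBoundary (z ++ neg (lincomb k m w))) ×
    (∀ (m : Fin k → ℤ) → IsBoundary (lincomb k m w) → ∀ i → m i ≡ 0ℤ)

FinGraph : (m : ℕ) → (Fin m → Fin m → Set) → Graph
FinGraph m adj = record { V = Fin m ; _≈_ = _≡_ ; _~_ = adj }

pathAdjℕ : ℕ → ℕ → Set
pathAdjℕ a b = a ≡ b ⊎ b ≡ suc a ⊎ a ≡ suc b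

cycAdjℕ : ℕ → ℕ → ℕ → Set
cycAdjℕ m a b = a ≡ b ⊎ b ≡ suc a ⊎ a ≡ suc b
              ⊎ (suc a ≡ m × b ≡ 0) ⊎ (suc b ≡ m × a ≡ 0)

pathAdj : {ℓ : ℕ} → Fin (suc ℓ) → Fin (suc ℓ) → Set
pathAdj p q = pathAdjℕ (toℕ p) (toℕ q)

cycAdj : {m : ℕ} → Fin m → Fin m → Set
cycAdj {m} a b = cycAdjℕ m (toℕ a) (toℕ b)

αRel : (g : ℕ) → ℕ → ℕ → ℕ → Set
αRel g i b v = ∀ i′ j → j < g → b ≡ i′ * g + j →
               (i′ ≡ i → v ≡ j) × ((i′ ≡ i → ⊥) → v ≡ 0)

βRel : (s : ℕ) → ℕ → ℕ → Set
βRel s b v = ∀ j i → i < s → b ≡ j * s + i → v ≡ j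

LCond : (g s ℓ : ℕ) → Set
LCond g s ℓ = (2 ≤ ℓ) × ((i : Fin s) →
  ∃ λ (f : Fin (suc ℓ) → Fin (s * g) → Fin g) →
      (∀ p p′ b b′ → pathAdj p p′ → cycAdj b b′ → cycAdj (f p b) (f p′ b′)) ×
      (∀ p b → toℕ p ≡ 0 → αRel g (toℕ i) (toℕ b) (toℕ (f p b))) ×
      (∀ p b → toℕ p ≡ ℓ → βRel s (toℕ b) (toℕ (f p b))) ×
      (∀ p b → toℕ b ≡ 0 → toℕ (f p b) ≡ 0))

-- Raw sum gadget S_s: P_ℓ × B together with s copies of P_1 × Z.

data SRaw (g s ℓ : ℕ) : Set where
  prod : Fin (suc ℓ) → Fin (s * g) → SRaw g s ℓ
  cyl  : Fin s → Fin 2 → Fin g → SRaw g s ℓ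

module _ {g s ℓ : ℕ} where

  SEdge : SRaw g s ℓ → SRaw g s ℓ → Set
  SEdge (prod p b)  (prod p′ b′)  = pathAdj p p′ × cycAdj b b′
  SEdge (cyl i _ j) (cyl i′ _ j′) = (i ≡ i′) × cycAdj j j′
  SEdge _ _ = ⊥

  SIdent : SRaw g s ℓ → SRaw g s ℓ → Set
  SIdent (prod p b) (prod p′ b′) =
      (toℕ p ≡ ℓ × toℕ p′ ≡ ℓ × ∃ λ j → ∃₂ λ i i′ →
         i < s × i′ < s × toℕ b ≡ j * s + i × toℕ b′ ≡ j * s + i′)
    ⊎ (toℕ p ≡ 0 × toℕ p′ ≡ 0 × ∃₂ λ i i′ → toℕ b ≡ i * g × toℕ b′ ≡ i′ * g)
  SIdent (cyl i t j) (prod p b) = toℕ t ≡ 0 × toℕ p ≡ 0 × toℕ b ≡ toℕ i * g + toℕ j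
  SIdent _ _ = ⊥

  ZEnd : SRaw g s ℓ → Fin g → Set
  ZEnd (prod p b) j = toℕ p ≡ ℓ × ∃ λ i → i < s × toℕ b ≡ toℕ j * s + i
  ZEnd _ _ = ⊥

  AEnd : SRaw g s ℓ → ℕ → Fin g → Set
  AEnd (cyl i′ t j′) i j = toℕ i′ ≡ i × toℕ t ≡ 1 × j′ ≡ j
  AEnd _ _ _ = ⊥

  -- raw vertices whose images span T(S_s)
  TRaw : SRaw g s ℓ → Set
  TRaw (prod p b)  = toℕ b ≡ 0
  TRaw (cyl i t j) = toℕ t ≡ 1 × toℕ j ≡ 0

data GCKind (s ℓ : ℕ) : Set where
  slice : Fin (suc ℓ) → GCKind s ℓ
  acyc  : Fin s → GCKind s ℓ

gcRaw : {g s ℓ : ℕ} → GCKind s ℓ → List (SRaw g s ℓ)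
gcRaw {g} {s} (slice p) = closeList (map (prod p) (allFin (s * g)))
gcRaw {g}     (acyc i)  = closeList (map (cyl i (fsuc fzero)) (allFin g))

record IGraph : Set where
  field
    n       : ℕ
    adj     : Fin n → Fin n → Bool
    adj-sym : ∀ u v → adj u v ≡ adj v u
    adj-irr : ∀ v → adj v v ≡ false

record EdgeIx (G : IGraph) : Set where
  field
    eu ev : Fin (IGraph.n G)
    e-lt  : toℕ eu < toℕ ev
    e-adj : IGraph.adj G eu ev ≡ true

data P3 : Set where
  p01 p02 p12 : P3

fstP sndP : P3 → ℕ
fstP p01 = 0
fstP p02 = 0
fstP p12 = 1
sndP p01 = 1
sndP p02 = 2
sndP p12 = 2

NegMod : (g : ℕ) → ℕ → ℕ → Set
NegMod g k k′ = (k ≡ 0 × k′ ≡ 0) ⊎ (k + k′ ≡ g)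

module Sharp (G : IGraph) (g ℓ₂ ℓ₃ : ℕ) where
  open IGraph G
  open EdgeIx

  data V# : Set where
    outA : Fin n → Fin 3 → Fin g → V#
    outZ : Fin g → V#
    gS   : Fin n → SRaw g 3 ℓ₃ → V#
    gP   : Fin n → P3 → SRaw g 2 ℓ₂ → V#
    gE   : EdgeIx G → Fin 3 → SRaw g 2 ℓ₂ → V#

  E# : V# → V# → Set
  E# (gS v r)   (gS v′ r′)    = v ≡ v′ × SEdge r r′
  E# (gP v p r) (gP v′ p′ r′) = v ≡ v′ × p ≡ p′ × SEdge r r′
  E# (gE e i r) (gE e′ i′ r′) = e ≡ e′ × i ≡ i′ × SEdge r r′
  E# _ _ = ⊥

  I# : V# → V# → Set
  I# (gS v r)   (gS v′ r′)    = v ≡ v′ × SIdent r r′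
  I# (gP v p r) (gP v′ p′ r′) = v ≡ v′ × p ≡ p′ × SIdent r r′
  I# (gE e i r) (gE e′ i′ r′) = e ≡ e′ × i ≡ i′ × SIdent r r′
  I# (gS v r)   (outZ j)      = ZEnd r j
  I# (gS v r)   (outA v′ i j) = v ≡ v′ × AEnd r (toℕ i) j
  I# (gP v p r) (outA v′ i k) = v ≡ v′ ×
       ((toℕ i ≡ fstP p × AEnd r 0 k)
      ⊎ (toℕ i ≡ sndP p × ∃ λ k₀ → AEnd r 1 k₀ × NegMod g (toℕ k₀) (toℕ k)))
  I# (gE e i r) (outA w i′ k) = i ≡ i′ ×
       ((w ≡ eu e × AEnd r 0 k) ⊎ (w ≡ ev e × AEnd r 1 k))
  I# _ _ = ⊥

  _≈#_ : V# → V# → Set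
  _≈#_ = EqClosure I#

  _~#_ : V# → V# → Set
  a ~# b = a ≈# b ⊎ ∃₂ λ x y → (E# x y ⊎ E# y x) × x ≈# a × y ≈# b

  G# : Graph
  G# = record { V = V# ; _≈_ = _≈#_ ; _~_ = _~#_ }

  data GadgetId : Set where
    idS : Fin n → GadgetId
    idP : Fin n → P3 → GadgetId
    idE : EdgeIx G → Fin 3 → GadgetId

  sOf ℓOf : GadgetId → ℕ
  sOf (idS _)   = 3
  sOf (idP _ _) = 2
  sOf (idE _ _) = 2
  ℓOf (idS _)   = ℓ₃
  ℓOf (idP _ _) = ℓ₂
  ℓOf (idE _ _) = ℓ₂

  embed : (k : GadgetId) → SRaw g (sOf k) (ℓOf k) → V#
  embed (idS v)   = gS v
  embed (idP v p) = gP v p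
  embed (idE e i) = gE e i

  GadgetCycle : Set
  GadgetCycle = Σ GadgetId (λ k → GCKind (sOf k) (ℓOf k))

  gcWalk : GadgetCycle → List V#
  gcWalk (k , c) = map (embed k) (gcRaw c)

  -- T^*: induced on the union of the vertex sets of the T(S)
  -- (equal to the union of the subgraphs T(S))
  InT : V# → Set
  InT a = ∃ λ (k : GadgetId) → ∃ λ (r : SRaw g (sOf k) (ℓOf k)) → TRaw r × embed k r ≈# a

  T* : Graph
  T* = record { V = Σ V# InT
              ; _≈_ = λ a b → proj₁ a ≈# proj₁ b
              ; _~_ = λ a b → proj₁ a ~# proj₁ b }

  TV : Set
  TV = Σ V# InT

  combine : ∀ {kG kT} → (Fin kG → GadgetCycle) → (Fin kT → List TV) → Fin (kG + kT) → List V#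
  combine {kG} gc tb i = [ (λ j → gcWalk (gc j)) , (λ j → map proj₁ (tb j)) ] (splitAt kG i)

module _ (m : ℕ) (adjH : Fin m → Fin m → Set) where
  private H = FinGraph m adjH

  IsConnTriFreeReflNontriv : Set
  IsConnTriFreeReflNontriv =
    (∀ a → adjH a a) × (∀ a b → adjH a b → adjH b a) ×
    (∀ a b → ∃ λ xs → Hom.WalkFromTo H a b xs) ×
    (∀ a b c → (a ≡ b → ⊥) → (b ≡ c → ⊥) → (a ≡ c → ⊥) →
               adjH a b → adjH b c → adjH a c → ⊥) ×
    (∃ λ z → Hom.IsCycle H z × (Hom.IsBoundary H z → ⊥))

  ZWalk : (g : ℕ) → (Fin g → Fin m) → List (Fin m)
  ZWalk g zf = closeList (map zf (allFin g))

  IsShortestNT : (g : ℕ) → (Fin g → Fin m) → Set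
  IsShortestNT g zf =
    (∀ x y → zf x ≡ zf y → x ≡ y) ×
    Hom.ClosedWalk H (ZWalk g zf) ×
    (Hom.IsBoundary H (Hom.walkChain H (ZWalk g zf)) → ⊥) ×
    (∀ w → Hom.ClosedWalk H w → Data.List.length w < suc g →
           Hom.IsBoundary H (Hom.walkChain H w))

{-# OPTIONS --safe #-}

-- H₁ is computed by Mayer–Vietoris: writing a(v,i) for the class of A^v_i and z for that of Z*, the gadgets contribute
-- the relations a(v,0) + a(v,1) + a(v,2) = z and nothing else, and gluing them along the end cycles contributes the
-- cycle space of T*, which has one fundamental loop for each copy of S₂. So z (if G has a vertex), a(v,0), a(v,1) and
-- these loops form a basis.
--
-- Spanning: it suffices that every cocycle e with values in an abelian group which vanishes on the basis is exact,
-- because this may be applied to the tautological cocycle with values in chains modulo boundaries and the span of the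
-- basis. Moving along slices reduces exactness of e to the vertices with label 0, i.e. to T*, where a spanning tree
-- rooted in Z* gives a potential.
--
-- Independence: integer cocycles dual to the basis. For loops, count the crossings of the leg of an S₂ that is not in
-- the tree. For cycles, prescribe weights x(v,i) with Σᵢ x(v,i) = ζ and count weighted crossings of the edge between
-- the labels g-1 and 0 on every A^v_i, and ζ times on Z*; inside a gadget the two countings differ by a coboundary.
module Submission where

open import Defs
open import Level using (0ℓ)
open import Algebra.Bundles using (AbelianGroup)
import Algebra.Properties.AbelianGroup as AbelianGroupProperties
open import Algebra.Properties.CommutativeSemigroup using (interchange; x∙yz≈y∙xz)
open import Axiom.UniquenessOfIdentityProofs using (module Decidable⇒UIP)
open import Data.Bool using (Bool; true; false)
import Data.Bool.Properties as Boolₚ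
open import Data.Empty using (⊥-elim)
open import Data.Fin using (Fin; toℕ; fromℕ; fromℕ<; splitAt; join; inject₁) renaming (zero to fzero; suc to fsuc)
open import Data.Fin.Induction using (<-weakInduction)
import Data.Fin.Properties as Finₚ
open import Data.Integer as ℤ using (ℤ; 0ℤ; 1ℤ; -1ℤ)
import Data.Integer.Properties as ℤₚ
open import Data.Integer.Solver using (module +-*-Solver)
open import Data.List using (List; []; _∷_; _++_; applyUpTo; applyDownFrom; map; allFin; tabulate; concat)
import Data.List.Properties as Listₚ
open import Data.List.Relation.Unary.All using (All; []; _∷_)
import Data.List.Relation.Unary.All.Properties as Allₚ
open import Data.List.Relation.Unary.Linked using (Linked; []; [-]; _∷_)
import Data.List.Relation.Unary.Linked.Properties as Linkedₚ
open import Data.Nat as ℕ using (ℕ; zero; suc; _∸_; _≤_; _<_; _⊓_; s≤s; z≤n; z<s; NonZero; _+_; _*_; _%_; _/_)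
open import Data.Nat.Divisibility using (n∣m*n)
open import Data.Nat.DivMod using (_mod_; m%n<n; m<n⇒m%n≡m; m<n⇒m/n≡0; n%n≡0; m%n%n≡m%n; %-distribˡ-+; m*n%n≡0;
  m%n*o≡m*o%[n*o]; m≡m%n+[m/n]*n; +-distrib-/-∣ˡ; m*n/n≡m; [m+kn]%n≡m%n; m<n*o⇒m/o<n)
import Data.Nat.Properties as ℕₚ
open import Data.Product using (Σ; ∃; _×_; _,_; proj₁; proj₂)
open import Data.Product.Function.NonDependent.Propositional using (_×-↔_)
import Data.Product.Properties as Productₚ
open import Data.Sum as Sum using (_⊎_; inj₁; inj₂)
open import Data.Sum.Function.Propositional using (_⊎-↔_)
import Data.Sum.Properties as Sumₚ
open import Function.Bundles using (_↔_; mk↔ₛ′; Inverse)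
open import Function.Construct.Composition using (_↔-∘_)
open import Function.Construct.Identity using (↔-id)
open import Relation.Binary.Construct.Closure.Equivalence using (EqClosure)
import Relation.Binary.Construct.Closure.Equivalence as EqClosureₚ
open import Relation.Binary.Construct.Closure.ReflexiveTransitive using (_◅_; _◅◅_) renaming (ε to nil)
open import Relation.Binary.Construct.Closure.Symmetric using (fwd; bwd)
open import Relation.Binary.Definitions using (DecidableEquality; tri<; tri≈; tri>)
open import Relation.Binary.PropositionalEquality as ≡ using (_≡_; _≢_; cong; cong₂)
import Relation.Binary.Reasoning.Setoid as SetoidReasoning
open import Relation.Nullary using (Dec; yes; no; ¬_; Irrelevant)
open import Relation.Nullary.Decidable using (_×-dec_)
open +-*-Solver using (solve; _:+_; _:*_; :-_; _:-_; _:=_; con)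

-- Chains and cocycles

-- Adjacency in the glued graph is only given up to the equivalence generated by the
-- identifications, and nothing says at the outset that a clique lies in a single gadget. A direct
-- Mayer-Vietoris argument would have to prove this. The proof never classifies the cliques of `G#`.
-- Exactness uses only triangles that the products inside a gadget exhibit. Dual cocycles are pulled
-- back along homomorphisms to small reflexive graphs whose triangles can be listed; such a
-- homomorphism has to be checked on generating identifications and raw edges only. The constants
-- come from these targets. A cycle must wrap around a cycle without filled triangles, the shortest
-- having four vertices, hence `4 ≤ g`. Between the end of a gadget where the crossings of the `A_i`
-- are counted and the end where those of `Z` are counted, at least one slice is needed on which
-- both countings make sense, hence `2 ≤ ℓ`. Arbitrary coefficient groups replace any calculation
-- with chains on the spanning side: the potential of a cocycle is written down vertex by vertex.

module FreeAbelian {X : Set} {R : X → X → Set} (R-refl : ∀ {x} → R x x) where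

  private
    _≋_ : List (ℤ × X) → List (ℤ × X) → Set
    _≋_ = FreeEq R

  ≡⇒≋ : ∀ {l l′} → l ≡ l′ → l ≋ l′
  ≡⇒≋ ≡.refl = fe-refl

  ++-congˡ : ∀ k {l l′} → l ≋ l′ → (k ++ l) ≋ (k ++ l′)
  ++-congˡ []      p = p
  ++-congˡ (_ ∷ k) p = fe-cons R-refl (++-congˡ k p)

  ++-congʳ : ∀ k {l l′} → l ≋ l′ → (l ++ k) ≋ (l′ ++ k)
  ++-congʳ k fe-refl        = fe-refl
  ++-congʳ k (fe-sym p)     = fe-sym (++-congʳ k p)
  ++-congʳ k (fe-trans p q) = fe-trans (++-congʳ k p) (++-congʳ k q)
  ++-congʳ k (fe-cons r p)  = fe-cons r (++-congʳ k p)
  ++-congʳ k fe-swap        = fe-swap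
  ++-congʳ k fe-merge       = fe-merge
  ++-congʳ k fe-zero        = fe-zero

  shift : ∀ x l k → (x ∷ l ++ k) ≋ (l ++ x ∷ k)
  shift x []      k = fe-refl
  shift x (y ∷ l) k = fe-trans fe-swap (fe-cons R-refl (shift x l k))

  ++-comm : ∀ l k → (l ++ k) ≋ (k ++ l)
  ++-comm []      k = ≡⇒≋ (≡.sym (Listₚ.++-identityʳ k))
  ++-comm (x ∷ l) k = fe-trans (fe-cons R-refl (++-comm l k)) (shift x k l)

  merge′ : ∀ {m n p x l} → m ℤ.+ n ≡ p → ((m , x) ∷ (n , x) ∷ l) ≋ ((p , x) ∷ l)
  merge′ ≡.refl = fe-merge

  zero′ : ∀ {m x l} → m ≡ 0ℤ → ((m , x) ∷ l) ≋ l
  zero′ ≡.refl = fe-zero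

  scale-cong : ∀ m {l l′} → l ≋ l′ → scale m l ≋ scale m l′
  scale-cong m fe-refl        = fe-refl
  scale-cong m (fe-sym p)     = fe-sym (scale-cong m p)
  scale-cong m (fe-trans p q) = fe-trans (scale-cong m p) (scale-cong m q)
  scale-cong m (fe-cons r p)  = fe-cons r (scale-cong m p)
  scale-cong m fe-swap        = fe-swap
  scale-cong m fe-merge       = merge′ (≡.sym (ℤₚ.*-distribˡ-+ m _ _))
  scale-cong m fe-zero        = zero′ (ℤₚ.*-zeroʳ m)

  scale-+ : ∀ m n l → scale (m ℤ.+ n) l ≋ (scale m l ++ scale n l)
  scale-+ m n []            = fe-refl
  scale-+ m n ((c , x) ∷ l) =
    fe-trans (fe-sym (merge′ (≡.sym (ℤₚ.*-distribʳ-+ c m n))))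
      (fe-cons R-refl (fe-trans (fe-cons R-refl (scale-+ m n l)) (shift _ (scale m l) _)))

  scale-0 : ∀ l → scale 0ℤ l ≋ []
  scale-0 []            = fe-refl
  scale-0 ((c , x) ∷ l) = fe-trans (zero′ (ℤₚ.*-zeroˡ c)) (scale-0 l)

  scale-1 : ∀ (l : List (ℤ × X)) → scale 1ℤ l ≡ l
  scale-1 []            = ≡.refl
  scale-1 ((c , x) ∷ l) = cong₂ _∷_ (cong (_, x) (ℤₚ.*-identityˡ c)) (scale-1 l)

  scale-scale : ∀ m n (l : List (ℤ × X)) → scale m (scale n l) ≡ scale (m ℤ.* n) l
  scale-scale m n []            = ≡.refl
  scale-scale m n ((c , x) ∷ l) =
    cong₂ _∷_ (cong (_, x) (≡.sym (ℤₚ.*-assoc m n c))) (scale-scale m n l)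

  scale-++ : ∀ m (l k : List (ℤ × X)) → scale m (l ++ k) ≡ scale m l ++ scale m k
  scale-++ m = Listₚ.map-++ _

  ++-inverseʳ : ∀ l → (l ++ neg l) ≋ []
  ++-inverseʳ l =
    fe-trans (++-congʳ (neg l) (≡⇒≋ (≡.sym (scale-1 l))))
      (fe-trans (fe-sym (scale-+ 1ℤ -1ℤ l)) (scale-0 l))

  ++-cong : ∀ {l l′ k k′} → l ≋ l′ → k ≋ k′ → (l ++ k) ≋ (l′ ++ k′)
  ++-cong {l′ = l′} {k = k} p q = fe-trans (++-congʳ k p) (++-congˡ l′ q)

  -- Packaged as a group so that a quotient of it can serve as a group of coefficients.
  abelianGroup : AbelianGroup 0ℓ 0ℓ
  abelianGroup = record
    { Carrier = List (ℤ × X)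
    ; _≈_ = _≋_
    ; _∙_ = _++_
    ; ε = []
    ; _⁻¹ = neg
    ; isAbelianGroup = record
      { isGroup = record
        { isMonoid = record
          { isSemigroup = record
            { isMagma = record
              { isEquivalence = record { refl = fe-refl ; sym = fe-sym ; trans = fe-trans }
              ; ∙-cong = ++-cong }
            ; assoc = λ l k j → ≡⇒≋ (Listₚ.++-assoc l k j) }
          ; identity = (λ _ → fe-refl) , (λ l → ≡⇒≋ (Listₚ.++-identityʳ l)) }
        ; inverse = (λ l → fe-trans (++-comm (neg l) l) (++-inverseʳ l)) , ++-inverseʳ
        ; ⁻¹-cong = scale-cong -1ℤ }
      ; comm = ++-comm } }

-- Subgroups and quotients of abelian groups

record Subgroup (G : AbelianGroup 0ℓ 0ℓ) : Set₁ where
  open AbelianGroup G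
  field
    N      : Carrier → Set
    N-resp : ∀ {x y} → x ≈ y → N x → N y
    N-ε    : N ε
    N-∙    : ∀ {x y} → N x → N y → N (x ∙ y)
    N-⁻¹   : ∀ {x} → N x → N (x ⁻¹)

module _ {G : AbelianGroup 0ℓ 0ℓ} (H : Subgroup G) where
  open AbelianGroup G
  open AbelianGroupProperties G
  open Subgroup H

  private
    _∼_ : Carrier → Carrier → Set
    x ∼ y = N (x ∙ y ⁻¹)

  ≈⇒∼ : ∀ {x y} → x ≈ y → x ∼ y
  ≈⇒∼ p = N-resp (sym (x≈y⇒x∙y⁻¹≈ε p)) N-ε

  private
    ∼-sym : ∀ {x y} → x ∼ y → y ∼ x
    ∼-sym {x} {y} p = N-resp (⁻¹-anti-homo‿- x y) (N-⁻¹ p)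

    ∼-trans : ∀ {x y z} → x ∼ y → y ∼ z → x ∼ z
    ∼-trans {x} {y} {z} p q = N-resp
      (trans (assoc x (y ⁻¹) _) (∙-congˡ (\\-leftDividesʳ y (z ⁻¹)))) (N-∙ p q)

    ∼-∙ : ∀ {x y u v} → x ∼ y → u ∼ v → (x ∙ u) ∼ (y ∙ v)
    ∼-∙ {x} {y} {u} {v} p q = N-resp
      (trans (interchange commutativeSemigroup x (y ⁻¹) u (v ⁻¹)) (∙-congˡ (⁻¹-∙-comm y v))) (N-∙ p q)

    ∼-⁻¹ : ∀ {x y} → x ∼ y → (x ⁻¹) ∼ (y ⁻¹)
    ∼-⁻¹ {x} {y} p = N-resp (sym (⁻¹-∙-comm x (y ⁻¹))) (N-⁻¹ p)

  quotient : AbelianGroup 0ℓ 0ℓ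
  quotient = record
    { Carrier = Carrier
    ; _≈_ = _∼_
    ; _∙_ = _∙_
    ; ε = ε
    ; _⁻¹ = _⁻¹
    ; isAbelianGroup = record
      { isGroup = record
        { isMonoid = record
          { isSemigroup = record
            { isMagma = record
              { isEquivalence = record { refl = ≈⇒∼ refl ; sym = ∼-sym ; trans = ∼-trans }
              ; ∙-cong = ∼-∙ }
            ; assoc = λ x y z → ≈⇒∼ (assoc x y z) }
          ; identity = (λ x → ≈⇒∼ (identityˡ x)) , (λ x → ≈⇒∼ (identityʳ x)) }
        ; inverse = (λ x → ≈⇒∼ (inverseˡ x)) , (λ x → ≈⇒∼ (inverseʳ x))
        ; ⁻¹-cong = ∼-⁻¹ }
      ; comm = λ x y → ≈⇒∼ (comm x y) } }

-- A 1-cocycle of the clique complex. It has a value on every pair of vertices but is constrained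
-- only on simplices; degenerate simplices are included, and they force the value on equal vertices
-- to be trivial and opposite edges to be inverse.
record Cocycle (X : Graph) (A : AbelianGroup 0ℓ 0ℓ) : Set where
  open Graph X
  open Hom X using (_≃_)
  open AbelianGroup A using (Carrier; _∙_) renaming (_≈_ to _≈ᴬ_)
  field
    ⟨_,_⟩ : V → V → Carrier
    resp  : ∀ {a a′ b b′} → a ≈ a′ → b ≈ b′ → ⟨ a , b ⟩ ≈ᴬ ⟨ a′ , b′ ⟩
    cocyc : ∀ {a b c} → a ≃ b → a ≃ c → b ≃ c → ⟨ a , b ⟩ ∙ ⟨ b , c ⟩ ≈ᴬ ⟨ a , c ⟩

module _ {V : Set} (A : AbelianGroup 0ℓ 0ℓ) where
  open AbelianGroup A
  along : (V → V → Carrier) → List V → Carrier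
  along e (x ∷ y ∷ r) = e x y ∙ along e (y ∷ r)
  along e _           = ε

Exact : ∀ {X A} → Cocycle X A → Set
Exact {X} {A} e = ∃ λ (c : V → Carrier) →
    (∀ {a b} → a ≈ b → c a ≈ᴬ c b) × (∀ {a b} → a ≃ b → ⟨ a , b ⟩ ∙ c a ≈ᴬ c b)
  where
  open Graph X
  open Hom X using (_≃_)
  open AbelianGroup A using (Carrier; _∙_) renaming (_≈_ to _≈ᴬ_)
  open Cocycle e

ℤᴳ : AbelianGroup 0ℓ 0ℓ
ℤᴳ = ℤₚ.+-0-abelianGroup

-- A criterion for bases of the first homology

module Criterion (X : Graph) (≈-refl : ∀ {a} → Graph._≈_ X a a) where
  open Graph X
  open Hom X

  private
    RE : V × V → V × V → Set
    RE = λ { (a , b) (a′ , b′) → (a ≈ a′) × (b ≈ b′) }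
    module F₁ = FreeAbelian {X = V × V} {R = RE} (≈-refl , ≈-refl)
    commutativeSemigroup = AbelianGroup.commutativeSemigroup F₁.abelianGroup

  ∂₂-scale : ∀ m t → ∂₂ (scale m t) ≡ scale m (∂₂ t)
  ∂₂-scale m []                    = ≡.refl
  ∂₂-scale m ((c , a , b , d) ∷ t) =
    cong₂ (λ n r → (m ℤ.* c , b , d) ∷ (n , a , d) ∷ (m ℤ.* c , a , b) ∷ r)
      (ℤₚ.neg-distribʳ-* m c) (∂₂-scale m t)

  ∂₂-++ : ∀ s t → ∂₂ (s ++ t) ≡ ∂₂ s ++ ∂₂ t
  ∂₂-++ []      t = ≡.refl
  ∂₂-++ (_ ∷ s) t = cong (λ r → _ ∷ _ ∷ _ ∷ r) (∂₂-++ s t)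

  WF₂-scale : ∀ m {t} → WF₂ t → WF₂ (scale m t)
  WF₂-scale m []      = []
  WF₂-scale m (p ∷ q) = p ∷ WF₂-scale m q

  IsBoundary-resp : ∀ {z z′} → z ≋₁ z′ → IsBoundary z → IsBoundary z′
  IsBoundary-resp p (t , wf , q) = t , wf , fe-trans q p

  IsBoundary-[] : IsBoundary []
  IsBoundary-[] = [] , [] , fe-refl

  IsBoundary-++ : ∀ {z z′} → IsBoundary z → IsBoundary z′ → IsBoundary (z ++ z′)
  IsBoundary-++ (s , ws , p) (t , wt , q) =
    s ++ t , Allₚ.++⁺ ws wt , fe-trans (F₁.≡⇒≋ (∂₂-++ s t)) (F₁.++-cong p q)

  IsBoundary-scale : ∀ m {z} → IsBoundary z → IsBoundary (scale m z)
  IsBoundary-scale m (t , wf , q) =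
    scale m t , WF₂-scale m wf , fe-trans (F₁.≡⇒≋ (∂₂-scale m t)) (F₁.scale-cong m q)

  -- Unfolds to a sum of the same form at `k` when applied to `suc k`, which `concatMap` over
  -- `allFin` does not; this is what the inductions need.
  sumOf : ∀ k → (Fin k → Chain₁) → Chain₁
  sumOf k f = concat (tabulate f)

  lincomb-sumOf : ∀ k m w → lincomb k m w ≡ sumOf k (λ i → scale (m i) (walkChain (w i)))
  lincomb-sumOf k m w = cong concat (Listₚ.map-tabulate {n = k} (λ i → i) _)

  sumOf-cong : ∀ k {f h : Fin k → Chain₁} → (∀ i → f i ≋₁ h i) → sumOf k f ≋₁ sumOf k h
  sumOf-cong zero            p = fe-refl
  sumOf-cong (suc k) {f} {h} p = F₁.++-cong {l = f fzero} {l′ = h fzero} (p fzero)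
    (sumOf-cong k {λ i → f (fsuc i)} {λ i → h (fsuc i)} (λ i → p (fsuc i)))

  sumOf-[] : ∀ k → sumOf k (λ _ → []) ≡ []
  sumOf-[] zero    = ≡.refl
  sumOf-[] (suc k) = sumOf-[] k

  sumOf-++ : ∀ k (f h : Fin k → Chain₁) → sumOf k (λ i → f i ++ h i) ≋₁ (sumOf k f ++ sumOf k h)
  sumOf-++ zero    f h = fe-refl
  sumOf-++ (suc k) f h = fe-trans
    (F₁.++-congˡ (f fzero ++ h fzero) (sumOf-++ k (λ i → f (fsuc i)) (λ i → h (fsuc i))))
    (interchange commutativeSemigroup (f fzero) (h fzero)
      (sumOf k (λ i → f (fsuc i))) (sumOf k (λ i → h (fsuc i))))

  sumOf-scale : ∀ k n (f : Fin k → Chain₁) → sumOf k (λ i → scale n (f i)) ≡ scale n (sumOf k f)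
  sumOf-scale zero    n f = ≡.refl
  sumOf-scale (suc k) n f = ≡.trans (cong (scale n (f fzero) ++_) (sumOf-scale k n (λ i → f (fsuc i))))
    (≡.sym (F₁.scale-++ n (f fzero) (sumOf k (λ i → f (fsuc i)))))

  δ : ∀ {k} → Fin k → Fin k → ℤ
  δ fzero    fzero    = 1ℤ
  δ fzero    (fsuc _) = 0ℤ
  δ (fsuc _) fzero    = 0ℤ
  δ (fsuc i) (fsuc j) = δ i j

  sumOf-δ : ∀ k (f : Fin k → Chain₁) i → sumOf k (λ j → scale (δ i j) (f j)) ≋₁ f i
  sumOf-δ (suc k) f fzero = fe-trans
    (F₁.++-cong {l = scale 1ℤ (f fzero)} {l′ = f fzero} (F₁.≡⇒≋ (F₁.scale-1 (f fzero)))
      (fe-trans (sumOf-cong k (λ i → F₁.scale-0 (f (fsuc i)))) (F₁.≡⇒≋ (sumOf-[] k))))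
    (F₁.≡⇒≋ (Listₚ.++-identityʳ (f fzero)))
  sumOf-δ (suc k) f (fsuc i) =
    F₁.++-cong {l = scale 0ℤ (f fzero)} {l′ = []} (F₁.scale-0 (f fzero)) (sumOf-δ k (λ j → f (fsuc j)) i)

  module Linear {k : ℕ} (w : Fin k → List V) where

    private
      walk : Fin k → Chain₁
      walk i = walkChain (w i)

    L : (Fin k → ℤ) → Chain₁
    L m = sumOf k (λ i → scale (m i) (walk i))

    L-0 : L (λ _ → 0ℤ) ≋₁ []
    L-0 = fe-trans (sumOf-cong k (λ i → F₁.scale-0 (walk i))) (F₁.≡⇒≋ (sumOf-[] k))

    L-+ : ∀ m n → L (λ i → m i ℤ.+ n i) ≋₁ (L m ++ L n)
    L-+ m n = fe-trans (sumOf-cong k (λ i → F₁.scale-+ (m i) (n i) (walk i)))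
      (sumOf-++ k (λ i → scale (m i) (walk i)) (λ i → scale (n i) (walk i)))

    L-* : ∀ n m → L (λ i → n ℤ.* m i) ≋₁ scale n (L m)
    L-* n m = fe-trans
      (sumOf-cong k (λ i → F₁.≡⇒≋ (≡.sym (F₁.scale-scale n (m i) (walk i)))))
      (F₁.≡⇒≋ (sumOf-scale k n (λ i → scale (m i) (walk i))))

    -- The span of the `w i` modulo boundaries, as a subgroup of all chains and not only of the
    -- cycles: the quotient must have a class for each single edge.
    N : Chain₁ → Set
    N z = ∃ λ m → IsBoundary (z ++ neg (L m))

    N-resp : ∀ {z z′} → z ≋₁ z′ → N z → N z′
    N-resp p (m , q) = m , IsBoundary-resp (F₁.++-congʳ _ p) q

    N-boundary : ∀ {z} → IsBoundary z → N z
    N-boundary {z} q = (λ _ → 0ℤ) , IsBoundary-resp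
      (fe-trans (F₁.≡⇒≋ (≡.sym (Listₚ.++-identityʳ z))) (F₁.++-congˡ (z) (fe-sym (F₁.scale-cong -1ℤ (L-0))))) q

    N-++ : ∀ {z z′} → N z → N z′ → N (z ++ z′)
    N-++ {z} {z′} (m , p) (n , q) = (λ i → m i ℤ.+ n i) , IsBoundary-resp eq (IsBoundary-++ p q)
      where
      eq : ((z ++ neg (L m)) ++ (z′ ++ neg (L n))) ≋₁ ((z ++ z′) ++ neg (L (λ i → m i ℤ.+ n i)))
      eq = fe-trans (interchange commutativeSemigroup z _ z′ _) (F₁.++-congˡ (z ++ z′)
        (fe-trans (F₁.≡⇒≋ (≡.sym (F₁.scale-++ -1ℤ (L m) (L n)))) (F₁.scale-cong -1ℤ (fe-sym (L-+ m n)))))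

    N-scale : ∀ n {z} → N z → N (scale n z)
    N-scale n {z} (m , p) = (λ i → n ℤ.* m i) , IsBoundary-resp
      (fe-trans (F₁.≡⇒≋ eq) (F₁.++-congˡ (scale n z) (F₁.scale-cong -1ℤ (fe-sym (L-* n m)))))
      (IsBoundary-scale n {z ++ neg (L m)} p)
      where
      open ≡.≡-Reasoning
      eq : scale n (z ++ neg (L m)) ≡ scale n z ++ neg (scale n (L m))
      eq = begin
        scale n (z ++ neg (L m))             ≡⟨ F₁.scale-++ n z (neg (L m)) ⟩
        scale n z ++ scale n (neg (L m))     ≡⟨ cong (scale n z ++_) (F₁.scale-scale n -1ℤ (L m)) ⟩
        scale n z ++ scale (n ℤ.* -1ℤ) (L m) ≡⟨ cong (λ r → scale n z ++ scale r (L m)) (ℤₚ.*-comm n -1ℤ) ⟩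
        scale n z ++ scale (-1ℤ ℤ.* n) (L m) ≡⟨ cong (scale n z ++_) (F₁.scale-scale -1ℤ n (L m)) ⟨
        scale n z ++ neg (scale n (L m))     ∎

    N-walk : ∀ i → N (walkChain (w i))
    N-walk i = δ i , IsBoundary-resp
      (fe-sym (fe-trans (F₁.++-congˡ (walkChain (w i)) (F₁.scale-cong -1ℤ (sumOf-δ k walk i))) (F₁.++-inverseʳ (walk i))))
      IsBoundary-[]

    span : Subgroup F₁.abelianGroup
    span = record { N = N ; N-resp = N-resp ; N-ε = N-boundary IsBoundary-[] ; N-∙ = N-++ ; N-⁻¹ = N-scale -1ℤ }

    _∼_ : Chain₁ → Chain₁ → Set
    _∼_ = AbelianGroup._≈_ (quotient span)

    edge : V → V → Chain₁
    edge a b = (1ℤ , a , b) ∷ []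

    tautological : Cocycle X (quotient span)
    tautological = record
      { ⟨_,_⟩ = edge
      ; resp  = λ {a} {a′} {b} {b′} p q → ≈⇒∼ span {edge a b} {edge a′ b′} (fe-cons (p , q) fe-refl)
      -- The simplex `(a , b , c)` bounds the defect of the cocycle identity; the swaps bring its
      -- three faces into the required order.
      ; cocyc = λ {a} {b} {c} p q r →
          N-boundary ((1ℤ , a , b , c) ∷ [] , (p , q , r) ∷ [] ,
            fe-trans (F₁.++-congˡ ((1ℤ , b , c) ∷ []) fe-swap) fe-swap) }

    along-walkChain : ∀ xs → along (quotient span) edge xs ≡ walkChain xs
    along-walkChain []          = ≡.refl
    along-walkChain (x ∷ [])    = ≡.refl
    along-walkChain (x ∷ y ∷ r) = cong ((1ℤ , x , y) ∷_) (along-walkChain (y ∷ r))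

    module Spanning (exact : Exact tautological) where
      c = proj₁ exact
      c-resp = proj₁ (proj₂ exact)
      c-edge = proj₂ (proj₂ exact)

      private
        ∼-refl  = λ {z} → AbelianGroup.refl (quotient span) {z}
        ∼-sym   = λ {y z} → AbelianGroup.sym (quotient span) {y} {z}
        ∼-trans = λ {x y z} → AbelianGroup.trans (quotient span) {x} {y} {z}
        ∼-cong  = λ {x y u v} → AbelianGroup.∙-cong (quotient span) {x} {y} {u} {v}

      scale-∼ : ∀ m {z z′} → z ∼ z′ → scale m z ∼ scale m z′
      scale-∼ m {z} {z′} p = N-resp (F₁.≡⇒≋ eq) (N-scale m p)
        where
        open ≡.≡-Reasoning
        eq : scale m (z ++ neg z′) ≡ scale m z ++ neg (scale m z′)
        eq = begin
          scale m (z ++ neg z′)            ≡⟨ F₁.scale-++ m z _ ⟩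
          scale m z ++ scale m (neg z′)    ≡⟨ cong (scale m z ++_) (F₁.scale-scale m -1ℤ z′) ⟩
          scale m z ++ scale (m ℤ.* -1ℤ) z′ ≡⟨ cong (λ r → scale m z ++ scale r z′) (ℤₚ.*-comm m -1ℤ) ⟩
          scale m z ++ scale (-1ℤ ℤ.* m) z′ ≡⟨ cong (scale m z ++_) (F₁.scale-scale -1ℤ m z′) ⟨
          scale m z ++ neg (scale m z′)    ∎

      extend : Chain₀ → Chain₁
      extend []            = []
      extend ((m , a) ∷ z) = scale m (c a) ++ extend z

      extend-resp : ∀ {y z} → y ≋₀ z → extend y ∼ extend z
      extend-resp {y} fe-refl    = ∼-refl {extend y}
      extend-resp (fe-sym {y} {z} p)           = ∼-sym {extend y} {extend z} (extend-resp p)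
      extend-resp (fe-trans {x} {y} {z} p q)   =
        ∼-trans {extend x} {extend y} {extend z} (extend-resp p) (extend-resp q)
      extend-resp (fe-cons {m} {a} {b} {y} {z} r p) =
        ∼-cong {scale m (c a)} {scale m (c b)} {extend y} {extend z}
          (scale-∼ m {c a} {c b} (c-resp r)) (extend-resp p)
      extend-resp (fe-swap {m} {n} {a} {b} {z}) = ≈⇒∼ span
        {scale m (c a) ++ (scale n (c b) ++ extend z)} {scale n (c b) ++ (scale m (c a) ++ extend z)}
        (x∙yz≈y∙xz commutativeSemigroup (scale m (c a)) (scale n (c b)) (extend z))
      extend-resp (fe-merge {m} {n} {a} {z}) = ≈⇒∼ span
        {scale m (c a) ++ (scale n (c a) ++ extend z)} {scale (m ℤ.+ n) (c a) ++ extend z}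
        (fe-trans (F₁.≡⇒≋ (≡.sym (Listₚ.++-assoc (scale m (c a)) (scale n (c a)) (extend z))))
          (F₁.++-congʳ (extend z) (fe-sym (F₁.scale-+ m n (c a)))))
      extend-resp (fe-zero {a} {z}) = ≈⇒∼ span {scale 0ℤ (c a) ++ extend z} {extend z}
        (F₁.++-congʳ (extend z) (F₁.scale-0 (c a)))

      scaled-edge : ∀ m {a b} → a ≃ b → ((m , a , b) ∷ []) ∼ (scale m (c b) ++ scale (ℤ.- m) (c a))
      scaled-edge m {a} {b} p = ∼-trans
        {(m , a , b) ∷ []} {scale m (edge a b ++ c a) ++ scale (ℤ.- m) (c a)} {scale m (c b) ++ scale (ℤ.- m) (c a)}
        (≈⇒∼ span {(m , a , b) ∷ []} {scale m (edge a b ++ c a) ++ scale (ℤ.- m) (c a)} eq)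
        (∼-cong {scale m (edge a b ++ c a)} {scale m (c b)} {scale (ℤ.- m) (c a)} {scale (ℤ.- m) (c a)}
          (scale-∼ m {edge a b ++ c a} {c b} (c-edge p)) (∼-refl {scale (ℤ.- m) (c a)}))
        where
        neg-scale : neg (scale m (c a)) ≡ scale (ℤ.- m) (c a)
        neg-scale = ≡.trans (F₁.scale-scale -1ℤ m (c a)) (cong (λ r → scale r (c a)) (ℤₚ.-1*i≡-i m))
        -- `m` times `c a` is inserted and removed again, so that the potential equation of the edge
        -- can be multiplied by `m`.
        eq : ((m , a , b) ∷ []) ≋₁ (scale m (edge a b ++ c a) ++ scale (ℤ.- m) (c a))
        eq = fe-trans (F₁.≡⇒≋ (cong (λ r → (r , a , b) ∷ []) (≡.sym (ℤₚ.*-identityʳ m))))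
          (F₁.++-congˡ (scale m (edge a b))
            (fe-trans (fe-sym (F₁.++-inverseʳ (scale m (c a)))) (F₁.++-congˡ (scale m (c a)) (F₁.≡⇒≋ neg-scale))))

      -- The potential equations of the edges of `z`, added up with coefficients. If `z` is a cycle,
      -- the right side is the extension of a zero boundary, so `z` lies in the span.
      extend-∂₁ : ∀ z → WF₁ z → z ∼ extend (∂₁ z)
      extend-∂₁ []                []       = ∼-refl {[]}
      extend-∂₁ ((m , a , b) ∷ z) (p ∷ wf) = ∼-trans
        {(m , a , b) ∷ z} {(scale m (c b) ++ scale (ℤ.- m) (c a)) ++ extend (∂₁ z)} {extend (∂₁ ((m , a , b) ∷ z))}
        (∼-cong {(m , a , b) ∷ []} {scale m (c b) ++ scale (ℤ.- m) (c a)} {z} {extend (∂₁ z)}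
          (scaled-edge m p) (extend-∂₁ z wf))
        (≈⇒∼ span {(scale m (c b) ++ scale (ℤ.- m) (c a)) ++ extend (∂₁ z)} {extend (∂₁ ((m , a , b) ∷ z))}
          (F₁.≡⇒≋ (Listₚ.++-assoc (scale m (c b)) (scale (ℤ.- m) (c a)) _)))

      spanning : ∀ z → IsCycle z → ∃ λ m → IsBoundary (z ++ neg (lincomb k m w))
      spanning z (wf , cyc) =
        proj₁ zN , ≡.subst (λ l → IsBoundary (z ++ neg l)) (≡.sym (lincomb-sumOf k (proj₁ zN) w)) (proj₂ zN)
        where
        zN : N z
        zN = N-resp (F₁.≡⇒≋ (Listₚ.++-identityʳ z)) (∼-trans {z} {extend (∂₁ z)} {[]} (extend-∂₁ z wf) (extend-resp cyc))

  module Evaluate (φ : Cocycle X ℤᴳ) where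
    open Cocycle φ

    eval : Chain₁ → ℤ
    eval []                = 0ℤ
    eval ((m , a , b) ∷ z) = m ℤ.* ⟨ a , b ⟩ ℤ.+ eval z

    eval-resp : ∀ {z z′} → z ≋₁ z′ → eval z ≡ eval z′
    eval-resp fe-refl        = ≡.refl
    eval-resp (fe-sym p)     = ≡.sym (eval-resp p)
    eval-resp (fe-trans p q) = ≡.trans (eval-resp p) (eval-resp q)
    eval-resp (fe-cons {m} r p) = cong₂ (λ s t → m ℤ.* s ℤ.+ t) (resp (proj₁ r) (proj₂ r)) (eval-resp p)
    eval-resp (fe-swap {m} {n} {x} {y} {z}) =
      x∙yz≈y∙xz (AbelianGroup.commutativeSemigroup ℤᴳ)
        (m ℤ.* ⟨ proj₁ x , proj₂ x ⟩) (n ℤ.* ⟨ proj₁ y , proj₂ y ⟩) (eval z)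
    eval-resp (fe-merge {m} {n} {x} {z}) = ≡.trans
      (≡.sym (ℤₚ.+-assoc (m ℤ.* ⟨ proj₁ x , proj₂ x ⟩) _ _))
      (cong (ℤ._+ eval z) (≡.sym (ℤₚ.*-distribʳ-+ ⟨ proj₁ x , proj₂ x ⟩ m n)))
    eval-resp (fe-zero {x} {z}) =
      ≡.trans (cong (ℤ._+ eval z) (ℤₚ.*-zeroˡ ⟨ proj₁ x , proj₂ x ⟩)) (ℤₚ.+-identityˡ _)

    eval-++ : ∀ y z → eval (y ++ z) ≡ eval y ℤ.+ eval z
    eval-++ []                z = ≡.sym (ℤₚ.+-identityˡ _)
    eval-++ ((m , a , b) ∷ y) z = ≡.trans (cong (λ r → m ℤ.* ⟨ a , b ⟩ ℤ.+ r) (eval-++ y z))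
      (≡.sym (ℤₚ.+-assoc (m ℤ.* ⟨ a , b ⟩) _ _))

    eval-scale : ∀ n z → eval (scale n z) ≡ n ℤ.* eval z
    eval-scale n []                = ≡.sym (ℤₚ.*-zeroʳ n)
    eval-scale n ((m , a , b) ∷ z) = ≡.trans
      (cong₂ ℤ._+_ (ℤₚ.*-assoc n m ⟨ a , b ⟩) (eval-scale n z))
      (≡.sym (ℤₚ.*-distribˡ-+ n _ _))

    eval-∂₂ : ∀ t → WF₂ t → eval (∂₂ t) ≡ 0ℤ
    eval-∂₂ []                    []               = ≡.refl
    eval-∂₂ ((m , a , b , c) ∷ t) ((p , q , r) ∷ wf) = begin
      m ℤ.* ⟨ b , c ⟩ ℤ.+ (ℤ.- m ℤ.* ⟨ a , c ⟩ ℤ.+ (m ℤ.* ⟨ a , b ⟩ ℤ.+ eval (∂₂ t)))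
        ≡⟨ cong₂ (λ s t → m ℤ.* ⟨ b , c ⟩ ℤ.+ (ℤ.- m ℤ.* s ℤ.+ (m ℤ.* ⟨ a , b ⟩ ℤ.+ t)))
             (≡.sym (cocyc p q r)) (eval-∂₂ t wf) ⟩
      m ℤ.* ⟨ b , c ⟩ ℤ.+ (ℤ.- m ℤ.* (⟨ a , b ⟩ ℤ.+ ⟨ b , c ⟩) ℤ.+ (m ℤ.* ⟨ a , b ⟩ ℤ.+ 0ℤ))
        ≡⟨ solve-∀ m ⟨ b , c ⟩ ⟨ a , b ⟩ ⟩
      0ℤ ∎
      where
      open ≡.≡-Reasoning
      solve-∀ : ∀ m x y → m ℤ.* x ℤ.+ (ℤ.- m ℤ.* (y ℤ.+ x) ℤ.+ (m ℤ.* y ℤ.+ 0ℤ)) ≡ 0ℤ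
      solve-∀ = solve 3 (λ m x y → m :* x :+ (:- m :* (y :+ x) :+ (m :* y :+ con 0ℤ)) := con 0ℤ) ≡.refl

    eval-boundary : ∀ {z} → IsBoundary z → eval z ≡ 0ℤ
    eval-boundary (t , wf , q) = ≡.trans (≡.sym (eval-resp q)) (eval-∂₂ t wf)

    eval-walkChain : ∀ xs → eval (walkChain xs) ≡ along ℤᴳ ⟨_,_⟩ xs
    eval-walkChain []          = ≡.refl
    eval-walkChain (x ∷ [])    = ≡.refl
    eval-walkChain (x ∷ y ∷ r) = cong₂ ℤ._+_ (ℤₚ.*-identityˡ ⟨ x , y ⟩) (eval-walkChain (y ∷ r))

    eval-sumOf-0 : ∀ k f → (∀ i → eval (f i) ≡ 0ℤ) → eval (sumOf k f) ≡ 0ℤ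
    eval-sumOf-0 zero    f p = ≡.refl
    eval-sumOf-0 (suc k) f p = ≡.trans (eval-++ (f fzero) _)
      (cong₂ ℤ._+_ (p fzero) (eval-sumOf-0 k (λ i → f (fsuc i)) (λ i → p (fsuc i))))

    eval-sumOf-single : ∀ k f i → (∀ j → j ≢ i → eval (f j) ≡ 0ℤ) → eval (sumOf k f) ≡ eval (f i)
    eval-sumOf-single (suc k) f fzero p = ≡.trans (eval-++ (f fzero) _)
      (≡.trans (cong (λ r → eval (f fzero) ℤ.+ r) (eval-sumOf-0 k (λ j → f (fsuc j)) (λ j → p (fsuc j) λ ())))
        (ℤₚ.+-identityʳ _))
    eval-sumOf-single (suc k) f (fsuc i) p = ≡.trans (eval-++ (f fzero) _)
      (≡.trans (cong₂ ℤ._+_ (p fzero λ ())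
          (eval-sumOf-single k (λ j → f (fsuc j)) i (λ j q → p (fsuc j) λ { ≡.refl → q ≡.refl })))
        (ℤₚ.+-identityˡ _))

    -- Pairing with `φ` kills the boundary on one side and all terms but the `i`-th on the other.
    dual-coefficient : ∀ {k} (w : Fin k → List V) m i →
      along ℤᴳ ⟨_,_⟩ (w i) ≡ 1ℤ → (∀ j → j ≢ i → along ℤᴳ ⟨_,_⟩ (w j) ≡ 0ℤ) →
      IsBoundary (lincomb k m w) → m i ≡ 0ℤ
    dual-coefficient {k} w m i p q b = begin
      m i              ≡⟨ ℤₚ.*-identityʳ (m i) ⟨
      m i ℤ.* 1ℤ       ≡⟨ value i p ⟨
      eval (f i)       ≡⟨ eval-sumOf-single k f i (λ j j≢i → ≡.trans (value j (q j j≢i)) (ℤₚ.*-zeroʳ (m j))) ⟨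
      eval (sumOf k f) ≡⟨ cong eval (lincomb-sumOf k m w) ⟨
      eval (lincomb k m w) ≡⟨ eval-boundary b ⟩
      0ℤ               ∎
      where
      open ≡.≡-Reasoning
      f : Fin k → Chain₁
      f j = scale (m j) (walkChain (w j))
      value : ∀ j {v} → along ℤᴳ ⟨_,_⟩ (w j) ≡ v → eval (f j) ≡ m j ℤ.* v
      value j r = ≡.trans (eval-scale (m j) (walkChain (w j))) (cong (m j ℤ.*_) (≡.trans (eval-walkChain (w j)) r))

  Dual : ∀ {k} → (Fin k → List V) → Fin k → Set
  Dual w i = ∃ λ (φ : Cocycle X ℤᴳ) →
    along ℤᴳ (Cocycle.⟨_,_⟩ φ) (w i) ≡ 1ℤ × (∀ j → j ≢ i → along ℤᴳ (Cocycle.⟨_,_⟩ φ) (w j) ≡ 0ℤ)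

  -- The exactness premise is applied to `tautological`, whose coefficient group is built from `w`;
  -- therefore it quantifies over all groups.
  isNTBasis : ∀ {k} (w : Fin k → List V) → (∀ i → ClosedWalk (w i)) →
    (∀ A (e : Cocycle X A) →
       (∀ i → AbelianGroup._≈_ A (along A (Cocycle.⟨_,_⟩ e) (w i)) (AbelianGroup.ε A)) → Exact e) →
    (∀ i → Dual w i) → IsNTBasis k w
  isNTBasis {k} w closed exact dual =
    closed ,
    Spanning.spanning (exact _ tautological λ i →
      ≡.subst (_∼ []) (≡.sym (along-walkChain (w i)))
        (N-resp (F₁.≡⇒≋ (≡.sym (Listₚ.++-identityʳ _))) (N-walk i))) ,
    λ m b i → let (φ , p , q) = dual i in Evaluate.dual-coefficient φ w m i p q b
    where open Linear w

-- Cocycles along walks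

-- Two parallel walks in a categorical product of reflexive graphs. Each square between them is a
-- clique; both diagonals are recorded because edges of the product run along either of them.
record Ladder (X : Graph) (f h : ℕ → Graph.V X) : Set where
  open Hom X using (_≃_)
  field
    rail₁    : ∀ j → f j ≃ f (suc j)
    rail₂    : ∀ j → h j ≃ h (suc j)
    rung     : ∀ j → f j ≃ h j
    diagonal : ∀ j → f j ≃ h (suc j)
    diagonal′ : ∀ j → f (suc j) ≃ h j

module Arcs {X : Graph} (≈-refl : ∀ {a} → Graph._≈_ X a a)
            {A : AbelianGroup 0ℓ 0ℓ} (e : Cocycle X A) where
  open Graph X using (V) renaming (_≈_ to _≈ⱽ_)
  open Hom X using (_≃_)
  open AbelianGroup A
  open AbelianGroupProperties A using (∙-cancelˡ; ∙-cancelʳ)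
  open Cocycle e
  open SetoidReasoning setoid

  ⟨⟩-refl : ∀ a → ⟨ a , a ⟩ ≈ ε
  ⟨⟩-refl a = ∙-cancelˡ ⟨ a , a ⟩ _ _
    (trans (cocyc (inj₁ ≈-refl) (inj₁ ≈-refl) (inj₁ ≈-refl)) (sym (identityʳ _)))

  ⟨⟩-≈ : ∀ {a b} → a ≈ⱽ b → ⟨ a , b ⟩ ≈ ε
  ⟨⟩-≈ {a} {b} p = trans (resp p ≈-refl) (⟨⟩-refl b)

  ⟨⟩-inverse : ∀ {a b} → a ≃ b → b ≃ a → ⟨ a , b ⟩ ∙ ⟨ b , a ⟩ ≈ ε
  ⟨⟩-inverse p q = trans (cocyc p (inj₁ ≈-refl) q) (⟨⟩-refl _)

  arc : (ℕ → V) → ℕ → Carrier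
  arc f zero    = ε
  arc f (suc n) = arc f n ∙ ⟨ f n , f (suc n) ⟩

  arc-cong : ∀ {f h} n → (∀ j → j ≤ n → f j ≈ⱽ h j) → arc f n ≈ arc h n
  arc-cong zero    p = refl
  arc-cong (suc n) p = ∙-cong (arc-cong n λ j j≤n → p j (ℕₚ.m≤n⇒m≤1+n j≤n))
    (resp (p n (ℕₚ.n≤1+n n)) (p (suc n) ℕₚ.≤-refl))

  arc-+ : ∀ f m n → arc f (m ℕ.+ n) ≈ arc f m ∙ arc (λ j → f (m ℕ.+ j)) n
  arc-+ f m zero    rewrite ℕₚ.+-identityʳ m = sym (identityʳ _)
  arc-+ f m (suc n) rewrite ℕₚ.+-suc m n = trans (∙-congʳ (arc-+ f m n)) (assoc _ _ _)

  arc-shift : ∀ f n → arc f (suc n) ≈ ⟨ f 0 , f 1 ⟩ ∙ arc (λ j → f (suc j)) n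
  arc-shift f n = trans (arc-+ f 1 n) (∙-congʳ (identityˡ _))

  arc-ε : ∀ f n → (∀ j → j < n → ⟨ f j , f (suc j) ⟩ ≈ ε) → arc f n ≈ ε
  arc-ε f zero    p = refl
  arc-ε f (suc n) p = trans
    (∙-cong (arc-ε f n λ j j<n → p j (ℕₚ.m≤n⇒m≤1+n j<n)) (p n ℕₚ.≤-refl)) (identityˡ ε)

  -- Each square is cut along a diagonal into two triangles, and the cocycle identity is used on
  -- both.
  ladder : ∀ {f h} → Ladder X f h → ∀ n → arc f n ∙ ⟨ f n , h n ⟩ ≈ ⟨ f 0 , h 0 ⟩ ∙ arc h n
  ladder         l zero    = trans (identityˡ _) (sym (identityʳ _))
  ladder {f} {h} l (suc n) = begin
    (arc f n ∙ ⟨ f n , f (suc n) ⟩) ∙ ⟨ f (suc n) , h (suc n) ⟩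
      ≈⟨ assoc _ _ _ ⟩
    arc f n ∙ (⟨ f n , f (suc n) ⟩ ∙ ⟨ f (suc n) , h (suc n) ⟩)
      ≈⟨ ∙-congˡ (cocyc (rail₁ n) (diagonal n) (rung (suc n))) ⟩
    arc f n ∙ ⟨ f n , h (suc n) ⟩
      ≈⟨ ∙-congˡ (cocyc (rung n) (diagonal n) (rail₂ n)) ⟨
    arc f n ∙ (⟨ f n , h n ⟩ ∙ ⟨ h n , h (suc n) ⟩)
      ≈⟨ assoc _ _ _ ⟨
    (arc f n ∙ ⟨ f n , h n ⟩) ∙ ⟨ h n , h (suc n) ⟩
      ≈⟨ ∙-congʳ (ladder l n) ⟩
    (⟨ f 0 , h 0 ⟩ ∙ arc h n) ∙ ⟨ h n , h (suc n) ⟩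
      ≈⟨ assoc _ _ _ ⟩
    ⟨ f 0 , h 0 ⟩ ∙ (arc h n ∙ ⟨ h n , h (suc n) ⟩) ∎
    where open Ladder l

  -- The first and the last rung coincide and cancel: homotopic closed walks have the same period.
  ladder-closed : ∀ {f h} → Ladder X f h → ∀ n → f n ≈ⱽ f 0 → h n ≈ⱽ h 0 → arc f n ≈ arc h n
  ladder-closed {f} {h} l n p q = ∙-cancelʳ ⟨ f 0 , h 0 ⟩ _ _ (begin
    arc f n ∙ ⟨ f 0 , h 0 ⟩ ≈⟨ ∙-congˡ (resp p q) ⟨
    arc f n ∙ ⟨ f n , h n ⟩ ≈⟨ ladder l n ⟩
    ⟨ f 0 , h 0 ⟩ ∙ arc h n ≈⟨ comm _ _ ⟩
    arc h n ∙ ⟨ f 0 , h 0 ⟩ ∎)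

  -- Vanishing periods make the arc from 0 a function on the cycle and not merely on its universal
  -- cover; this is what admits the edges that wrap around.
  ladder-cyclic : ∀ {f h} → Ladder X f h → ∀ {n} → f n ≡ f 0 → h n ≡ h 0 → arc f n ≈ ε → arc h n ≈ ε →
    ∀ {b b′} → cycAdjℕ n b b′ → arc f b ∙ ⟨ f b , h b′ ⟩ ≈ ⟨ f 0 , h 0 ⟩ ∙ arc h b′
  ladder-cyclic {f} {h} l {n} fn hn f-closed h-closed = go
    where
    open Ladder l
    forward : ∀ b → arc f b ∙ ⟨ f b , h (suc b) ⟩ ≈ ⟨ f 0 , h 0 ⟩ ∙ arc h (suc b)
    forward b = begin
      arc f b ∙ ⟨ f b , h (suc b) ⟩                  ≈⟨ ∙-congˡ (cocyc (rung b) (diagonal b) (rail₂ b)) ⟨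
      arc f b ∙ (⟨ f b , h b ⟩ ∙ ⟨ h b , h (suc b) ⟩) ≈⟨ assoc _ _ _ ⟨
      (arc f b ∙ ⟨ f b , h b ⟩) ∙ ⟨ h b , h (suc b) ⟩ ≈⟨ ∙-congʳ (ladder l b) ⟩
      (⟨ f 0 , h 0 ⟩ ∙ arc h b) ∙ ⟨ h b , h (suc b) ⟩ ≈⟨ assoc _ _ _ ⟩
      ⟨ f 0 , h 0 ⟩ ∙ arc h (suc b)                  ∎
    backward : ∀ b → arc f (suc b) ∙ ⟨ f (suc b) , h b ⟩ ≈ ⟨ f 0 , h 0 ⟩ ∙ arc h b
    backward b = begin
      (arc f b ∙ ⟨ f b , f (suc b) ⟩) ∙ ⟨ f (suc b) , h b ⟩ ≈⟨ assoc _ _ _ ⟩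
      arc f b ∙ (⟨ f b , f (suc b) ⟩ ∙ ⟨ f (suc b) , h b ⟩) ≈⟨ ∙-congˡ (cocyc (rail₁ b) (rung b) (diagonal′ b)) ⟩
      arc f b ∙ ⟨ f b , h b ⟩                               ≈⟨ ladder l b ⟩
      ⟨ f 0 , h 0 ⟩ ∙ arc h b                               ∎
    go : ∀ {b b′} → cycAdjℕ n b b′ → arc f b ∙ ⟨ f b , h b′ ⟩ ≈ ⟨ f 0 , h 0 ⟩ ∙ arc h b′
    go {b}      (inj₁ ≡.refl) = ladder l b
    go {b}      (inj₂ (inj₁ ≡.refl)) = forward b
    go {b′ = b} (inj₂ (inj₂ (inj₁ ≡.refl))) = backward b
    -- The edge from `n - 1` to 0 is read as a step to `n`: the vertices at `n` and 0 agree, and so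
    -- do the arcs, by `h-closed`.
    go {b}      (inj₂ (inj₂ (inj₂ (inj₁ (≡.refl , ≡.refl))))) = begin
      arc f b ∙ ⟨ f b , h 0 ⟩         ≡⟨ cong (λ x → arc f b ∙ ⟨ f b , x ⟩) hn ⟨
      arc f b ∙ ⟨ f b , h (suc b) ⟩   ≈⟨ forward b ⟩
      ⟨ f 0 , h 0 ⟩ ∙ arc h (suc b)   ≈⟨ ∙-congˡ h-closed ⟩
      ⟨ f 0 , h 0 ⟩ ∙ ε               ∎
    go {b′ = b} (inj₂ (inj₂ (inj₂ (inj₂ (≡.refl , ≡.refl))))) = begin
      ε ∙ ⟨ f 0 , h b ⟩                   ≈⟨ ∙-congʳ f-closed ⟨
      arc f (suc b) ∙ ⟨ f 0 , h b ⟩       ≡⟨ cong (λ x → arc f (suc b) ∙ ⟨ x , h b ⟩) fn ⟨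
      arc f (suc b) ∙ ⟨ f (suc b) , h b ⟩ ≈⟨ backward b ⟩
      ⟨ f 0 , h 0 ⟩ ∙ arc h b             ∎

  arc-path : ∀ f → (∀ j → f j ≃ f (suc j)) → (∀ j → f (suc j) ≃ f j) →
    ∀ {p q} → pathAdjℕ p q → ⟨ f p , f q ⟩ ∙ arc f p ≈ arc f q
  arc-path f up down {p} (inj₁ ≡.refl) = trans (∙-congʳ (⟨⟩-refl (f p))) (identityˡ _)
  arc-path f up down     (inj₂ (inj₁ ≡.refl)) = comm _ _
  arc-path f up down {q = q} (inj₂ (inj₂ ≡.refl)) = begin
    ⟨ f (suc q) , f q ⟩ ∙ (arc f q ∙ ⟨ f q , f (suc q) ⟩) ≈⟨ comm _ _ ⟩
    (arc f q ∙ ⟨ f q , f (suc q) ⟩) ∙ ⟨ f (suc q) , f q ⟩ ≈⟨ assoc _ _ _ ⟩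
    arc f q ∙ (⟨ f q , f (suc q) ⟩ ∙ ⟨ f (suc q) , f q ⟩) ≈⟨ ∙-congˡ (⟨⟩-inverse (up q) (down q)) ⟩
    arc f q ∙ ε                                           ≈⟨ identityʳ _ ⟩
    arc f q                                               ∎

  -- Walking back from `N` cancels the last `m` steps of the arc. Needed for the reversed
  -- attachments, where label `j` of a gadget meets label `g ∸ j`.
  arc-reverse : ∀ f N → (∀ j → f j ≃ f (suc j)) → (∀ j → f (suc j) ≃ f j) →
    ∀ m → m ≤ N → arc (λ j → f (N ∸ j)) m ∙ arc f N ≈ arc f (N ∸ m)
  arc-reverse f N up down zero    _   = identityˡ _
  arc-reverse f N up down (suc m) m<N = begin
    (arc r m ∙ ⟨ f (N ∸ m) , f n ⟩) ∙ arc f N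
      ≈⟨ trans (assoc _ _ _) (∙-congˡ (comm _ _)) ⟩
    arc r m ∙ (arc f N ∙ ⟨ f (N ∸ m) , f n ⟩)
      ≈⟨ assoc _ _ _ ⟨
    (arc r m ∙ arc f N) ∙ ⟨ f (N ∸ m) , f n ⟩
      ≈⟨ ∙-congʳ (arc-reverse f N up down m (ℕₚ.<⇒≤ m<N)) ⟩
    arc f (N ∸ m) ∙ ⟨ f (N ∸ m) , f n ⟩
      ≡⟨ cong (λ k → arc f k ∙ ⟨ f k , f n ⟩) (ℕₚ.+-∸-assoc 1 m<N) ⟩
    (arc f n ∙ ⟨ f n , f (suc n) ⟩) ∙ ⟨ f (suc n) , f n ⟩
      ≈⟨ assoc _ _ _ ⟩
    arc f n ∙ (⟨ f n , f (suc n) ⟩ ∙ ⟨ f (suc n) , f n ⟩)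
      ≈⟨ trans (∙-congˡ (⟨⟩-inverse (up n) (down n))) (identityʳ _) ⟩
    arc f n ∎
    where
    r = λ j → f (N ∸ j)
    n = N ∸ suc m

  along-up : ∀ f n y ys → along A ⟨_,_⟩ (applyUpTo f (suc n) ++ y ∷ ys) ≈
    arc f n ∙ (⟨ f n , y ⟩ ∙ along A ⟨_,_⟩ (y ∷ ys))
  along-up f zero    y ys = sym (identityˡ _)
  along-up f (suc n) y ys = begin
    ⟨ f 0 , f 1 ⟩ ∙ along A ⟨_,_⟩ (applyUpTo (λ j → f (suc j)) (suc n) ++ y ∷ ys)
      ≈⟨ ∙-congˡ (along-up (λ j → f (suc j)) n y ys) ⟩
    ⟨ f 0 , f 1 ⟩ ∙ (arc (λ j → f (suc j)) n ∙ rest)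
      ≈⟨ assoc _ _ _ ⟨
    (⟨ f 0 , f 1 ⟩ ∙ arc (λ j → f (suc j)) n) ∙ rest
      ≈⟨ ∙-congʳ (arc-shift f n) ⟨
    arc f (suc n) ∙ rest ∎
    where rest = ⟨ f (suc n) , y ⟩ ∙ along A ⟨_,_⟩ (y ∷ ys)

  -- The arc stands on the left in place of its inverse on the right, so that each step down cancels
  -- the last step of the arc.
  along-down : ∀ f → (∀ j → f j ≃ f (suc j)) → (∀ j → f (suc j) ≃ f j) → ∀ n y ys →
    arc f n ∙ along A ⟨_,_⟩ (applyDownFrom f (suc n) ++ y ∷ ys) ≈ ⟨ f 0 , y ⟩ ∙ along A ⟨_,_⟩ (y ∷ ys)
  along-down f up down zero    y ys = identityˡ _
  along-down f up down (suc n) y ys = begin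
    (arc f n ∙ ⟨ f n , f (suc n) ⟩) ∙ (⟨ f (suc n) , f n ⟩ ∙ rest)
      ≈⟨ assoc _ _ _ ⟩
    arc f n ∙ (⟨ f n , f (suc n) ⟩ ∙ (⟨ f (suc n) , f n ⟩ ∙ rest))
      ≈⟨ ∙-congˡ (assoc _ _ _) ⟨
    arc f n ∙ ((⟨ f n , f (suc n) ⟩ ∙ ⟨ f (suc n) , f n ⟩) ∙ rest)
      ≈⟨ ∙-congˡ (trans (∙-congʳ (⟨⟩-inverse (up n) (down n))) (identityˡ _)) ⟩
    arc f n ∙ rest
      ≈⟨ along-down f up down n y ys ⟩
    ⟨ f 0 , y ⟩ ∙ along A ⟨_,_⟩ (y ∷ ys) ∎
    where rest = along A ⟨_,_⟩ (applyDownFrom f (suc n) ++ y ∷ ys)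

  along-applyUpTo : ∀ f n → along A ⟨_,_⟩ (applyUpTo f (suc n)) ≈ arc f n
  along-applyUpTo f zero    = refl
  along-applyUpTo f (suc n) = trans (∙-congˡ (along-applyUpTo (λ j → f (suc j)) n)) (sym (arc-shift f n))

lastOr-applyUpTo : ∀ {V : Set} (f : ℕ → V) n → lastOr (f 0) (applyUpTo (λ j → f (suc j)) n) ≡ f n
lastOr-applyUpTo f zero    = ≡.refl
lastOr-applyUpTo f (suc n) = lastOr-applyUpTo (λ j → f (suc j)) n

lastOr-snoc : ∀ {V : Set} (a : V) xs ys b c → lastOr a (xs ++ ys ++ b ∷ c ∷ []) ≡ c
lastOr-snoc a []       []       b c = ≡.refl
lastOr-snoc a []       (y ∷ ys) b c = lastOr-snoc y [] ys b c
lastOr-snoc a (x ∷ xs) ys       b c = lastOr-snoc x xs ys b c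

module _ {V : Set} {R : V → V → Set} where

  linked-up : ∀ (f : ℕ → V) n {y ys} → (∀ j → R (f j) (f (suc j))) → R (f n) y → Linked R (y ∷ ys) →
    Linked R (applyUpTo f (suc n) ++ y ∷ ys)
  linked-up f zero    p q l = q ∷ l
  linked-up f (suc n) p q l = p 0 ∷ linked-up (λ j → f (suc j)) n (λ j → p (suc j)) q l

  linked-down : ∀ (f : ℕ → V) n {y ys} → (∀ j → R (f (suc j)) (f j)) → R (f 0) y → Linked R (y ∷ ys) →
    Linked R (applyDownFrom f (suc n) ++ y ∷ ys)
  linked-down f zero    p q l = q ∷ l
  linked-down f (suc n) p q l = p n ∷ linked-down f n p q l

closedWalk-applyUpTo : ∀ (X : Graph) (f : ℕ → Graph.V X) n → (∀ j → Hom._≃_ X (f j) (f (suc j))) →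
  Graph._≈_ X (f n) (f 0) → Hom.ClosedWalk X (applyUpTo f (suc n))
closedWalk-applyUpTo X f n p q = f 0 , applyUpTo (λ j → f (suc j)) n , ≡.refl ,
  Linkedₚ.applyUpTo⁺₂ f (suc n) p , ≡.subst (λ a → Graph._≈_ X a (f 0)) (≡.sym (lastOr-applyUpTo f n)) q

-- Cocycles on a gadget. Vertices of cycles are indexed by ℕ modulo the length, so that no step wraps around.

toℕ-mod : ∀ b m .{{_ : NonZero m}} → toℕ (b mod m) ≡ b % m
toℕ-mod b m = Finₚ.toℕ-fromℕ< (m%n<n b m)

toℕ-mod-< : ∀ {b m} .{{_ : NonZero m}} → b < m → toℕ (b mod m) ≡ b
toℕ-mod-< {b} {m} b<m = ≡.trans (toℕ-mod b m) (m<n⇒m%n≡m b<m)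

mod-toℕ : ∀ {m} .{{_ : NonZero m}} (b : Fin m) → toℕ b mod m ≡ b
mod-toℕ b = Finₚ.toℕ-injective (toℕ-mod-< (Finₚ.toℕ<n b))

n-mod-n : ∀ n .{{_ : NonZero n}} → n mod n ≡ 0 mod n
n-mod-n n = Finₚ.toℕ-injective
  (≡.trans (toℕ-mod n n) (≡.trans (n%n≡0 n) (≡.sym (≡.trans (toℕ-mod 0 n) (m*n%n≡0 0 n)))))

cycAdj-sym : ∀ {m} {a b : Fin m} → cycAdj a b → cycAdj b a
cycAdj-sym (inj₁ p)                      = inj₁ (≡.sym p)
cycAdj-sym (inj₂ (inj₁ p))               = inj₂ (inj₂ (inj₁ p))
cycAdj-sym (inj₂ (inj₂ (inj₁ p)))        = inj₂ (inj₁ p)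
cycAdj-sym (inj₂ (inj₂ (inj₂ (inj₁ p)))) = inj₂ (inj₂ (inj₂ (inj₂ p)))
cycAdj-sym (inj₂ (inj₂ (inj₂ (inj₂ p)))) = inj₂ (inj₂ (inj₂ (inj₁ p)))

pathAdj-sym : ∀ {ℓ} {a b : Fin (suc ℓ)} → pathAdj a b → pathAdj b a
pathAdj-sym (inj₁ p)        = inj₁ (≡.sym p)
pathAdj-sym (inj₂ (inj₁ p)) = inj₂ (inj₂ p)
pathAdj-sym (inj₂ (inj₂ p)) = inj₂ (inj₁ p)

%-suc : ∀ b m .{{_ : NonZero m}} → suc b % m ≡ suc (b % m) % m
%-suc b m = ≡.trans (%-distribˡ-+ 1 b m)
  (≡.trans (cong (λ r → (1 % m + r) % m) (≡.sym (m%n%n≡m%n b m))) (≡.sym (%-distribˡ-+ 1 (b % m) m)))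

cycAdj-mod : ∀ b m .{{_ : NonZero m}} → cycAdj (b mod m) (suc b mod m)
cycAdj-mod b m = ≡.subst₂ (cycAdjℕ m) (≡.sym (toℕ-mod b m))
  (≡.sym (≡.trans (toℕ-mod (suc b) m) (%-suc b m))) adj
  where
  adj : cycAdjℕ m (b % m) (suc (b % m) % m)
  adj with ℕₚ.m≤n⇒m<n∨m≡n (m%n<n b m)
  ... | inj₁ lt = inj₂ (inj₁ (m<n⇒m%n≡m lt))
  ... | inj₂ eq = inj₂ (inj₂ (inj₂ (inj₁ (eq , ≡.trans (cong (_% m) eq) (n%n≡0 m)))))

block-< : ∀ {j n i s} → j < n → i < s → j * s + i < n * s
block-< {j} {n} {i} {s} j<n i<s = ℕₚ.<-≤-trans (ℕₚ.+-monoʳ-< (j * s) i<s)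
  (ℕₚ.≤-trans (ℕₚ.≤-reflexive (ℕₚ.+-comm (j * s) s)) (ℕₚ.*-monoˡ-≤ s j<n))

-- The label on A^v_i of the vertex j of an end cycle attached to it; the flag marks the reversed attachments of step (3).
relabel : ℕ → Bool → ℕ → ℕ
relabel g false j = j
relabel g true  j = g ∸ j

-- The position on the cycle is forgotten and the slice is kept. This is compatible with the
-- identifications because all vertices `(0, ig)` of a gadget are one vertex.
foot : ∀ {g s ℓ} .{{_ : NonZero g}} .{{sg≢0 : NonZero (s * g)}} → SRaw g s ℓ → SRaw g s ℓ
foot {g} {s} (prod p b)  = prod p (0 mod (s * g))
foot {g}     (cyl i t j) = cyl i t (0 mod g)

-- Only preservation of edges and identifications is assumed of `ι`, so that one analysis covers all
-- copies of `S_2` and `S_3`.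
module GadgetMap (X : Graph) (≈-refl : ∀ {a} → Graph._≈_ X a a)
    (≈-sym : ∀ {a b} → Graph._≈_ X a b → Graph._≈_ X b a)
    (≈-trans : ∀ {a b c} → Graph._≈_ X a b → Graph._≈_ X b c → Graph._≈_ X a c)
    (g s ℓ : ℕ) .{{_ : NonZero g}} .{{s≢0 : NonZero s}} .{{sg≢0 : NonZero (s * g)}}
    (ι : SRaw g s ℓ → Graph.V X)
    (ι-edge : ∀ {r r′} → SEdge r r′ → Hom._≃_ X (ι r) (ι r′))
    (ι-ident : ∀ {r r′} → SIdent r r′ → Graph._≈_ X (ι r) (ι r′)) where
  open Graph X using (V) renaming (_≈_ to _≈ⱽ_)
  open Hom X using (_≃_)

  slice-at : Fin (suc ℓ) → ℕ → V
  slice-at p b = ι (prod p (b mod (s * g)))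

  cyl-at : Fin s → Fin 2 → ℕ → V
  cyl-at i t j = ι (cyl i t (j mod g))

  top : Fin (suc ℓ)
  top = fromℕ ℓ

  top-at : ℕ → V
  top-at j = slice-at top (j * s)

  -- Prolongs the spine beyond `ℓ` by standing still, so that consecutive indices are adjacent
  -- without a bound.
  clamp : ℕ → Fin (suc ℓ)
  clamp q = fromℕ< (s≤s (ℕₚ.m⊓n≤n q ℓ))

  toℕ-clamp : ∀ q → toℕ (clamp q) ≡ q ⊓ ℓ
  toℕ-clamp q = Finₚ.toℕ-fromℕ< _

  clamp-toℕ : ∀ p → clamp (toℕ p) ≡ p
  clamp-toℕ p = Finₚ.toℕ-injective (≡.trans (toℕ-clamp (toℕ p)) (ℕₚ.m≤n⇒m⊓n≡m (ℕₚ.≤-pred (Finₚ.toℕ<n p))))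

  clamp-top : clamp ℓ ≡ top
  clamp-top = Finₚ.toℕ-injective (≡.trans (toℕ-clamp ℓ) (≡.trans (ℕₚ.⊓-idem ℓ) (≡.sym (Finₚ.toℕ-fromℕ ℓ))))

  clamp-adj : ∀ q → pathAdj (clamp q) (clamp (suc q))
  clamp-adj q rewrite toℕ-clamp q | toℕ-clamp (suc q) with ℕₚ.≤-total ℓ q
  ... | inj₁ ℓ≤q rewrite ℕₚ.m≥n⇒m⊓n≡n ℓ≤q | ℕₚ.m≥n⇒m⊓n≡n (ℕₚ.m≤n⇒m≤1+n ℓ≤q) = inj₁ ≡.refl
  ... | inj₂ q≤ℓ with ℕₚ.m≤n⇒m<n∨m≡n q≤ℓ
  ...   | inj₁ q<ℓ rewrite ℕₚ.m≤n⇒m⊓n≡m q≤ℓ | ℕₚ.m≤n⇒m⊓n≡m q<ℓ = inj₂ (inj₁ ≡.refl)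
  ...   | inj₂ ≡.refl rewrite ℕₚ.⊓-idem q | ℕₚ.m≥n⇒m⊓n≡n (ℕₚ.n≤1+n q) = inj₁ ≡.refl

  spine : ℕ → V
  spine q = slice-at (clamp q) 0

  slice-ladder : ∀ {p p′} → pathAdj p p′ → Ladder X (slice-at p) (slice-at p′)
  slice-ladder {p} {p′} a = record
    { rail₁     = λ j → ι-edge (inj₁ ≡.refl , cycAdj-mod j _)
    ; rail₂     = λ j → ι-edge (inj₁ ≡.refl , cycAdj-mod j _)
    ; rung      = λ j → ι-edge (a , inj₁ ≡.refl)
    ; diagonal  = λ j → ι-edge (a , cycAdj-mod j _)
    ; diagonal′ = λ j → ι-edge (a , cycAdj-sym {a = j mod (s * g)} (cycAdj-mod j _)) }

  cyl-ladder : ∀ i t t′ → Ladder X (cyl-at i t) (cyl-at i t′)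
  cyl-ladder i t t′ = record
    { rail₁     = λ j → ι-edge (≡.refl , cycAdj-mod j g)
    ; rail₂     = λ j → ι-edge (≡.refl , cycAdj-mod j g)
    ; rung      = λ j → ι-edge (≡.refl , inj₁ ≡.refl)
    ; diagonal  = λ j → ι-edge (≡.refl , cycAdj-mod j g)
    ; diagonal′ = λ j → ι-edge (≡.refl , cycAdj-sym {a = j mod g} (cycAdj-mod j g)) }

  spine-up : ∀ q → spine q ≃ spine (suc q)
  spine-up q = ι-edge (clamp-adj q , inj₁ ≡.refl)

  spine-down : ∀ q → spine (suc q) ≃ spine q
  spine-down q = ι-edge (pathAdj-sym {a = clamp q} (clamp-adj q) , inj₁ ≡.refl)

  slice-period : ∀ p → slice-at p (s * g) ≡ slice-at p 0
  slice-period p = cong (λ b → ι (prod p b)) (n-mod-n (s * g))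

  cyl-period : ∀ i t → cyl-at i t g ≡ cyl-at i t 0
  cyl-period i t = cong (λ j → ι (cyl i t j)) (n-mod-n g)

  bottom-base : ∀ i → slice-at fzero (i * g) ≈ⱽ slice-at fzero 0
  -- The remainder `i % s` is the number of the block: `i` may be `s`, where the position is back at
  -- 0.
  bottom-base i = ι-ident (inj₂ (≡.refl , ≡.refl , i % s , 0 ,
    ≡.trans (toℕ-mod (i * g) (s * g)) (≡.sym (m%n*o≡m*o%[n*o] i s g)) ,
    toℕ-mod-< (ℕ.>-nonZero⁻¹ (s * g))))

  bottom-cyl-< : ∀ i {j} → j < g → slice-at fzero (toℕ i * g + j) ≈ⱽ cyl-at i fzero j
  bottom-cyl-< i j<g = ≈-sym (ι-ident (≡.refl , ≡.refl ,
    ≡.trans (toℕ-mod-< (block-< (Finₚ.toℕ<n i) j<g)) (cong (toℕ i * g +_) (≡.sym (toℕ-mod-< j<g)))))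

  bottom-cyl : ∀ i j → j ≤ g → slice-at fzero (toℕ i * g + j) ≈ⱽ cyl-at i fzero j
  bottom-cyl i j j≤g with ℕₚ.m≤n⇒m<n∨m≡n j≤g
  ... | inj₁ j<g    = bottom-cyl-< i j<g
  -- At `j = g` the position is the start of the next block, hence the common base vertex, which is
  -- also vertex 0 of the cylinder.
  ... | inj₂ ≡.refl = ≈-trans
          (≡.subst (λ b → slice-at fzero b ≈ⱽ slice-at fzero 0) (ℕₚ.+-comm j (toℕ i * j)) (bottom-base (suc (toℕ i))))
          (≈-trans (≈-sym (bottom-base (toℕ i)))
            (≡.subst₂ (λ b c → slice-at fzero b ≈ⱽ c) (ℕₚ.+-identityʳ _) (≡.sym (cyl-period i fzero))
              (bottom-cyl-< i (ℕ.>-nonZero⁻¹ g))))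

  cyl-base : ∀ i → cyl-at i fzero 0 ≈ⱽ slice-at fzero 0
  cyl-base i = ≈-trans (≈-sym (bottom-cyl-< i (ℕ.>-nonZero⁻¹ g)))
    (≡.subst (λ b → slice-at fzero b ≈ⱽ slice-at fzero 0) (≡.sym (ℕₚ.+-identityʳ _)) (bottom-base (toℕ i)))

  top-block : ∀ j i → j < g → i < s → slice-at top (j * s + i) ≈ⱽ top-at j
  top-block j i j<g i<s = ι-ident (inj₁ (Finₚ.toℕ-fromℕ ℓ , Finₚ.toℕ-fromℕ ℓ , j , i , 0 , i<s , 0<s ,
    toℕ-mod-< (≡.subst (j * s + i <_) (ℕₚ.*-comm g s) (block-< j<g i<s)) ,
    ≡.trans (toℕ-mod-< (≡.subst₂ _<_ (ℕₚ.+-identityʳ _) (ℕₚ.*-comm g s) (block-< j<g 0<s)))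
      (≡.sym (ℕₚ.+-identityʳ _))))
    where
    0<s = ℕₚ.≤-<-trans z≤n i<s

  module Values {A : AbelianGroup 0ℓ 0ℓ} (e : Cocycle X A) where
    open AbelianGroup A
    open Cocycle e
    open Arcs {X} ≈-refl {A} e
    open SetoidReasoning setoid

    -- The integral of `e` from the foot of a vertex to the vertex. It depends on the raw vertex
    -- until the periods of the end cycles vanish.
    swing : SRaw g s ℓ → Carrier
    swing (prod p b)  = arc (slice-at p) (toℕ b)
    swing (cyl i t j) = arc (cyl-at i t) (toℕ j)

    bottom-arc : ∀ i j → j ≤ g →
      arc (slice-at fzero) (toℕ i * g + j) ≈ arc (slice-at fzero) (toℕ i * g) ∙ arc (cyl-at i fzero) j
    bottom-arc i j j≤g = trans (arc-+ (slice-at fzero) (toℕ i * g) j)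
      (∙-congˡ (arc-cong j λ n n≤j → bottom-cyl i n (ℕₚ.≤-trans n≤j j≤g)))

    cyl-arc : ∀ i t t′ → arc (cyl-at i t) g ≈ arc (cyl-at i t′) g
    cyl-arc i t t′ = ladder-closed (cyl-ladder i t t′) g
      (reflexiveⱽ (cyl-period i t)) (reflexiveⱽ (cyl-period i t′))
      where
      reflexiveⱽ : ∀ {a b} → a ≡ b → a ≈ⱽ b
      reflexiveⱽ ≡.refl = ≈-refl

    -- The cylinder makes block `i` of the bottom slice homotopic to `A_i`. Over all blocks this
    -- yields the relation of the gadget: a slice is the sum of the `A_i`.
    bottom-next : ∀ i → arc (slice-at fzero) (suc (toℕ i) * g) ≈
      arc (slice-at fzero) (toℕ i * g) ∙ arc (cyl-at i (fsuc fzero)) g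
    bottom-next i = begin
      arc (slice-at fzero) (g + toℕ i * g)
        ≡⟨ cong (arc (slice-at fzero)) (ℕₚ.+-comm g (toℕ i * g)) ⟩
      arc (slice-at fzero) (toℕ i * g + g)
        ≈⟨ bottom-arc i g ℕₚ.≤-refl ⟩
      arc (slice-at fzero) (toℕ i * g) ∙ arc (cyl-at i fzero) g
        ≈⟨ ∙-congˡ (cyl-arc i fzero (fsuc fzero)) ⟩
      arc (slice-at fzero) (toℕ i * g) ∙ arc (cyl-at i (fsuc fzero)) g ∎

    slice-arc : ∀ p → arc (slice-at p) (s * g) ≈ arc (slice-at fzero) (s * g)
    slice-arc = <-weakInduction (λ p → arc (slice-at p) (s * g) ≈ arc (slice-at fzero) (s * g)) refl
      λ p ih → trans (ladder-closed
        (slice-ladder (inj₂ (inj₂ (cong suc (≡.sym (Finₚ.toℕ-inject₁ p)))))) (s * g)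
        (reflexiveⱽ (slice-period _)) (reflexiveⱽ (slice-period _))) ih
      where
      reflexiveⱽ : ∀ {a b} → a ≡ b → a ≈ⱽ b
      reflexiveⱽ ≡.refl = ≈-refl

    private
      block : ∀ j → j < g → ∀ i → i < s → arc (λ n → slice-at top (j * s + n)) i ≈ ε
      block j j<g i i<s = arc-ε _ i λ n n<i → ⟨⟩-≈ (≈-trans
        (top-block j n j<g (ℕₚ.<-trans n<i i<s)) (≈-sym (top-block j (suc n) j<g (ℕₚ.<-≤-trans (s≤s n<i) i<s))))

    -- On the top slice the `s` positions of a block are one vertex, so a block contributes only its
    -- last step.
    top-arc : ∀ j → j ≤ g → arc (slice-at top) (j * s) ≈ arc top-at j
    top-arc zero    _   = refl
    top-arc (suc j) j<g = begin
      arc (slice-at top) (s + j * s)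
        ≡⟨ cong (arc (slice-at top)) (ℕₚ.+-comm s (j * s)) ⟩
      arc (slice-at top) (j * s + s)
        ≈⟨ arc-+ (slice-at top) (j * s) s ⟩
      arc (slice-at top) (j * s) ∙ arc f s
        ≈⟨ ∙-cong (top-arc j (ℕₚ.<⇒≤ j<g)) (last-step s (ℕₚ.suc-pred s)) ⟩
      arc top-at j ∙ ⟨ top-at j , top-at (suc j) ⟩ ∎
      where
      f : ℕ → V
      f n = slice-at top (j * s + n)
      -- Of the `s` steps, the first `pred s` stay within the block and the last one leaves it; `s`
      -- is presented as a successor so that `arc` splits off that step.
      last-step : ∀ m → suc (ℕ.pred s) ≡ m → arc f m ≈ ⟨ top-at j , top-at (suc j) ⟩
      last-step .(suc (ℕ.pred s)) ≡.refl = begin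
        arc f (ℕ.pred s) ∙ ⟨ f (ℕ.pred s) , f (suc (ℕ.pred s)) ⟩
          ≈⟨ ∙-cong (block j j<g (ℕ.pred s) lt) (resp (top-block j (ℕ.pred s) j<g lt) end) ⟩
        ε ∙ ⟨ top-at j , top-at (suc j) ⟩
          ≈⟨ identityˡ _ ⟩
        ⟨ top-at j , top-at (suc j) ⟩ ∎
        where
        lt : ℕ.pred s < s
        lt = ≡.subst (ℕ.pred s <_) (ℕₚ.suc-pred s) ℕₚ.≤-refl
        end : f (suc (ℕ.pred s)) ≈ⱽ top-at (suc j)
        end = ≡.subst (λ b → slice-at top b ≈ⱽ top-at (suc j))
          (≡.trans (ℕₚ.+-comm s (j * s)) (cong (j * s +_) (≡.sym (ℕₚ.suc-pred s)))) ≈-refl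

    top-swing : ∀ j i → j < g → i < s → arc (slice-at top) (j * s + i) ≈ arc top-at j
    top-swing j i j<g i<s = begin
      arc (slice-at top) (j * s + i) ≈⟨ arc-+ (slice-at top) (j * s) i ⟩
      arc (slice-at top) (j * s) ∙ arc (λ n → slice-at top (j * s + n)) i
        ≈⟨ ∙-cong (top-arc j (ℕₚ.<⇒≤ j<g)) (block j j<g i i<s) ⟩
      arc top-at j ∙ ε               ≈⟨ identityʳ _ ⟩
      arc top-at j                   ∎

    -- If the `A_i` have period zero, so has every slice, and `swing` becomes compatible with
    -- wrapping and with gluing.
    module Killed (ends : ∀ i → arc (cyl-at i (fsuc fzero)) g ≈ ε) where

      cyl-closed : ∀ i t → arc (cyl-at i t) g ≈ ε
      cyl-closed i t = trans (cyl-arc i t (fsuc fzero)) (ends i)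

      bottom-closed : ∀ i → i ≤ s → arc (slice-at fzero) (i * g) ≈ ε
      bottom-closed zero    _   = refl
      bottom-closed (suc i) i<s = ≡.subst (λ k → arc (slice-at fzero) (suc k * g) ≈ ε)
        (Finₚ.toℕ-fromℕ< i<s) (begin
          arc (slice-at fzero) (suc (toℕ k) * g)
            ≈⟨ bottom-next k ⟩
          arc (slice-at fzero) (toℕ k * g) ∙ arc (cyl-at k (fsuc fzero)) g
            ≈⟨ ∙-cong (≡.subst (λ k → arc (slice-at fzero) (k * g) ≈ ε) (≡.sym (Finₚ.toℕ-fromℕ< i<s))
                 (bottom-closed i (ℕₚ.<⇒≤ i<s))) (ends k) ⟩
          ε ∙ ε ≈⟨ identityˡ ε ⟩
          ε     ∎)
        where k = fromℕ< i<s

      slice-closed : ∀ p → arc (slice-at p) (s * g) ≈ ε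
      slice-closed p = trans (slice-arc p) (bottom-closed s ℕₚ.≤-refl)

      swing-edge : ∀ {r r′} → SEdge r r′ →
        swing r ∙ ⟨ ι r , ι r′ ⟩ ≈ ⟨ ι (foot r) , ι (foot r′) ⟩ ∙ swing r′
      swing-edge {prod p b} {prod p′ b′} (pp , bb) =
        ≡.subst₂ (λ x y → swing (prod p b) ∙ ⟨ ι (prod p x) , ι (prod p′ y) ⟩ ≈
            ⟨ slice-at p 0 , slice-at p′ 0 ⟩ ∙ swing (prod p′ b′)) (mod-toℕ b) (mod-toℕ b′)
          (ladder-cyclic (slice-ladder pp) (slice-period p) (slice-period p′) (slice-closed p) (slice-closed p′) bb)
      swing-edge {cyl i t j} {cyl .i t′ j′} (≡.refl , jj) =
        ≡.subst₂ (λ x y → swing (cyl i t j) ∙ ⟨ ι (cyl i t x) , ι (cyl i t′ y) ⟩ ≈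
            ⟨ cyl-at i t 0 , cyl-at i t′ 0 ⟩ ∙ swing (cyl i t′ j′)) (mod-toℕ j) (mod-toℕ j′)
          (ladder-cyclic (cyl-ladder i t t′) (cyl-period i t) (cyl-period i t′) (cyl-closed i t) (cyl-closed i t′) jj)

      top-swing′ : ∀ {p b j i} → toℕ p ≡ ℓ → i < s → toℕ b ≡ j * s + i →
        swing (prod p b) ≈ arc top-at j
      top-swing′ {p} {b} {j} {i} pℓ i<s eq = begin
        arc (slice-at p) (toℕ b)       ≡⟨ cong₂ (λ q n → arc (slice-at q) n)
          (Finₚ.toℕ-injective (≡.trans pℓ (≡.sym (Finₚ.toℕ-fromℕ ℓ)))) eq ⟩
        arc (slice-at top) (j * s + i) ≈⟨ top-swing j i j<g i<s ⟩
        arc top-at j                   ∎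
        where
        j<g : j < g
        j<g = ℕₚ.*-cancelˡ-< s j g (≡.subst (_< s * g) (ℕₚ.*-comm j s)
          (ℕₚ.≤-<-trans (ℕₚ.m≤m+n (j * s) i) (≡.subst (_< s * g) eq (Finₚ.toℕ<n b))))

      bottom-swing : ∀ {p b i} → toℕ p ≡ 0 → toℕ b ≡ i * g → swing (prod p b) ≈ ε
      bottom-swing {fzero} {b} {i} _ eq = trans (reflexive (cong (arc (slice-at fzero)) eq))
        (bottom-closed i (ℕₚ.<⇒≤ (ℕₚ.*-cancelʳ-< g i s (≡.subst (_< s * g) eq (Finₚ.toℕ<n b)))))

      swing-ident : ∀ {r r′} → SIdent r r′ → swing r ≈ swing r′
      swing-ident {prod p b} {prod p′ b′} (inj₁ (pℓ , p′ℓ , j , i , i′ , i<s , i′<s , eq , eq′)) =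
        trans (top-swing′ {p} {b} {j} pℓ i<s eq) (sym (top-swing′ {p′} {b′} {j} p′ℓ i′<s eq′))
      swing-ident {prod p b} {prod p′ b′} (inj₂ (p0 , p′0 , i , i′ , eq , eq′)) =
        trans (bottom-swing {p} {b} {i} p0 eq) (sym (bottom-swing {p′} {b′} {i′} p′0 eq′))
      swing-ident {cyl i fzero j} {prod fzero b} (_ , _ , eq) = begin
        arc (cyl-at i fzero) (toℕ j)
          ≈⟨ identityˡ _ ⟨
        ε ∙ arc (cyl-at i fzero) (toℕ j)
          ≈⟨ ∙-congʳ (bottom-closed (toℕ i) (ℕₚ.<⇒≤ (Finₚ.toℕ<n i))) ⟨
        arc (slice-at fzero) (toℕ i * g) ∙ arc (cyl-at i fzero) (toℕ j)
          ≈⟨ bottom-arc i (toℕ j) (ℕₚ.<⇒≤ (Finₚ.toℕ<n j)) ⟨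
        arc (slice-at fzero) (toℕ i * g + toℕ j)
          ≡⟨ cong (arc (slice-at fzero)) eq ⟨
        arc (slice-at fzero) (toℕ b) ∎

-- Exactness on G# and T*

closure-fold : ∀ {V : Set} {R S : V → V → Set} →
  (∀ {a} → S a a) → (∀ {a b} → S a b → S b a) → (∀ {a b c} → S a b → S b c → S a c) →
  (∀ {a b} → R a b → S a b) → ∀ {a b} → EqClosure R a b → S a b
closure-fold rf sy tr f nil         = rf
closure-fold rf sy tr f (fwd p ◅ q) = tr (f p) (closure-fold rf sy tr f q)
closure-fold rf sy tr f (bwd p ◅ q) = tr (sy (f p)) (closure-fold rf sy tr f q)

resp₂-≡ : ∀ {B : Set} (S : B → B → Set) {a a′ b b′} → a ≡ a′ → b ≡ b′ → S a b → S a′ b′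
resp₂-≡ S = ≡.subst₂ S

Fin? : ∀ n → Dec (Fin n)
Fin? zero    = no λ ()
Fin? (suc n) = yes fzero

-- The glued graph and maps out of it

module SharpGraph (G : IGraph) (g ℓ₂ ℓ₃ : ℕ) .{{_ : NonZero g}} where
  open IGraph G using (n)
  open EdgeIx
  open Sharp G g ℓ₂ ℓ₃ public
  open Hom G# using (_≃_) public

  ≈-refl : ∀ {a} → a ≈# a
  ≈-refl = nil

  ≈-sym : ∀ {a b} → a ≈# b → b ≈# a
  ≈-sym = EqClosureₚ.symmetric I#

  ≈-trans : ∀ {a b c} → a ≈# b → b ≈# c → a ≈# c
  ≈-trans = _◅◅_

  I⇒≈ : ∀ {a b} → I# a b → a ≈# b
  I⇒≈ p = fwd p ◅ nil

  E⇒≃ : ∀ {a b} → E# a b → a ≃ b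
  E⇒≃ p = inj₂ (inj₂ (_ , _ , inj₁ p , nil , nil))

  E⇒≃′ : ∀ {a b} → E# a b → b ≃ a
  E⇒≃′ p = inj₂ (inj₂ (_ , _ , inj₂ p , nil , nil))

  ≃-resp : ∀ {a a′ b b′} → a ≈# a′ → b ≈# b′ → a ≃ b → a′ ≃ b′
  ≃-resp p q (inj₁ r)        = inj₁ (≈-trans (≈-sym p) (≈-trans r q))
  ≃-resp p q (inj₂ (inj₁ r)) = inj₁ (≈-trans (≈-sym p) (≈-trans r q))
  ≃-resp p q (inj₂ (inj₂ (x , y , r , s , t))) = inj₂ (inj₂ (x , y , r , ≈-trans s p , ≈-trans t q))

  embed-edge : ∀ k {r r′} → SEdge r r′ → E# (embed k r) (embed k r′)
  embed-edge (idS v)   p = ≡.refl , p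
  embed-edge (idP v q) p = ≡.refl , ≡.refl , p
  embed-edge (idE e i) p = ≡.refl , ≡.refl , p

  embed-ident : ∀ k {r r′} → SIdent r r′ → I# (embed k r) (embed k r′)
  embed-ident (idS v)   p = ≡.refl , p
  embed-ident (idP v q) p = ≡.refl , ≡.refl , p
  embed-ident (idE e i) p = ≡.refl , ≡.refl , p

  s≢0 : ∀ k → NonZero (sOf k)
  s≢0 (idS _)   = _
  s≢0 (idP _ _) = _
  s≢0 (idE _ _) = _

  sg≢0 : ∀ k → NonZero (sOf k * g)
  sg≢0 k = ℕₚ.m*n≢0 (sOf k) g {{s≢0 k}}

  module K (k : GadgetId) = GadgetMap G# ≈-refl ≈-sym ≈-trans g (sOf k) (ℓOf k) {{s≢0 = s≢0 k}} {{sg≢0 = sg≢0 k}}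
    (embed k) (λ p → E⇒≃ (embed-edge k p)) (λ p → I⇒≈ (embed-ident k p))

  -- (v , i) stands for the cycle A^v_i.
  Outer : Set
  Outer = Fin n × Fin 3

  fst# snd# : P3 → Fin 3
  fst# p01 = fzero
  fst# p02 = fzero
  fst# p12 = fsuc fzero
  snd# p01 = fsuc fzero
  snd# p02 = fsuc (fsuc fzero)
  snd# p12 = fsuc (fsuc fzero)

  toℕ-fst# : ∀ p → toℕ (fst# p) ≡ fstP p
  toℕ-fst# p01 = ≡.refl
  toℕ-fst# p02 = ≡.refl
  toℕ-fst# p12 = ≡.refl

  toℕ-snd# : ∀ p → toℕ (snd# p) ≡ sndP p
  toℕ-snd# p01 = ≡.refl
  toℕ-snd# p02 = ≡.refl
  toℕ-snd# p12 = ≡.refl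

  endOf : ∀ k → Fin (sOf k) → Outer
  endOf (idS v)   i            = v , i
  endOf (idP v p) fzero        = v , fst# p
  endOf (idP v p) (fsuc fzero) = v , snd# p
  endOf (idE e i) fzero        = eu e , i
  endOf (idE e i) (fsuc fzero) = ev e , i

  flipped : ∀ k → Fin (sOf k) → Bool
  flipped (idP v p) (fsuc fzero) = true
  flipped _         _            = false

  A-at : Outer → ℕ → V#
  A-at (v , i) j = outA v i (j mod g)

  Z-at : ℕ → V#
  Z-at j = outZ (j mod g)

  -- At `j = 0` and `j = g` both residues are 0, which is the separate case of `NegMod`; elsewhere
  -- they add up to `g`.
  negMod : ∀ j → j ≤ g → NegMod g (toℕ (j mod g)) (toℕ ((g ∸ j) mod g))
  negMod zero    _ = inj₁ (toℕ-mod-< (ℕ.>-nonZero⁻¹ g) ,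
    ≡.trans (cong toℕ (n-mod-n g)) (toℕ-mod-< (ℕ.>-nonZero⁻¹ g)))
  negMod (suc j) j≤g with ℕₚ.m≤n⇒m<n∨m≡n j≤g
  ... | inj₁ j<g = inj₂ (≡.trans
          (cong₂ _+_ (toℕ-mod-< j<g) (toℕ-mod-< (ℕₚ.∸-monoʳ-< {g} {suc j} {0} z<s j≤g))) (ℕₚ.m+[n∸m]≡n j≤g))
  ... | inj₂ eq  = inj₁ (
          ≡.trans (cong (λ b → toℕ (b mod g)) eq) (≡.trans (cong toℕ (n-mod-n g)) (toℕ-mod-< (ℕ.>-nonZero⁻¹ g))) ,
          ≡.trans (cong (λ b → toℕ ((g ∸ b) mod g)) eq)
            (≡.trans (cong (λ b → toℕ (b mod g)) (ℕₚ.n∸n≡0 g)) (toℕ-mod-< (ℕ.>-nonZero⁻¹ g))))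

  negMod-toℕ : ∀ (j : Fin g) → NegMod g (toℕ j) (toℕ ((g ∸ toℕ j) mod g))
  negMod-toℕ j = ≡.subst (λ l → NegMod g (toℕ l) (toℕ ((g ∸ toℕ j) mod g))) (mod-toℕ j)
    (negMod (toℕ j) (ℕₚ.<⇒≤ (Finₚ.toℕ<n j)))

  -- `I#` mentions the negated label only through a relation; uniqueness allows it to be replaced by
  -- the residue of `g ∸ j`.
  neg-unique : ∀ {j j₁ j₂ : Fin g} → NegMod g (toℕ j) (toℕ j₁) → NegMod g (toℕ j) (toℕ j₂) → toℕ j₁ ≡ toℕ j₂
  neg-unique (inj₁ (_ , p)) (inj₁ (_ , q)) = ≡.trans p (≡.sym q)
  neg-unique {j} {j₁} {j₂} (inj₁ (p , _)) (inj₂ q) =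
    ⊥-elim (ℕₚ.<-irrefl (≡.trans (cong (_+ toℕ j₂) (≡.sym p)) q) (Finₚ.toℕ<n j₂))
  neg-unique {j} {j₁} (inj₂ p) (inj₁ (q , _)) =
    ⊥-elim (ℕₚ.<-irrefl (≡.trans (cong (_+ toℕ j₁) (≡.sym q)) p) (Finₚ.toℕ<n j₁))
  neg-unique {j} (inj₂ p) (inj₂ q) = ℕₚ.+-cancelˡ-≡ (toℕ j) _ _ (≡.trans p (≡.sym q))

  end-≈ : ∀ k i j → j ≤ g → K.cyl-at k i (fsuc fzero) j ≈# A-at (endOf k i) (relabel g (flipped k i) j)
  end-≈ (idS v)   i            j _ = I⇒≈ (≡.refl , ≡.refl , ≡.refl , ≡.refl)
  end-≈ (idP v p) fzero        j _ = I⇒≈ (≡.refl , inj₁ (toℕ-fst# p , ≡.refl , ≡.refl , ≡.refl))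
  end-≈ (idP v p) (fsuc fzero) j j≤g =
    I⇒≈ (≡.refl , inj₂ (toℕ-snd# p , j mod g , (≡.refl , ≡.refl , ≡.refl) , negMod j j≤g))
  end-≈ (idE e i) fzero        j _ = I⇒≈ (≡.refl , inj₁ (≡.refl , ≡.refl , ≡.refl , ≡.refl))
  end-≈ (idE e i) (fsuc fzero) j _ = I⇒≈ (≡.refl , inj₂ (≡.refl , ≡.refl , ≡.refl , ≡.refl))

  -- The many clauses of `I#` in three uniform kinds, indexed by the gadget. A map out of `G#` then
  -- needs three compatibility checks.
  data Ident : V# → V# → Set where
    within : ∀ k {r r′} → SIdent r r′ → Ident (embed k r) (embed k r′)
    toA    : ∀ k i j → Ident (embed k (cyl i (fsuc fzero) j)) (A-at (endOf k i) (relabel g (flipped k i) (toℕ j)))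
    toZ    : ∀ v {r j} → ZEnd r j → Ident (gS v r) (outZ j)

  private
    relabelled : ∀ k i j → flipped k i ≡ false →
      Ident (embed k (cyl i (fsuc fzero) j)) (outA (proj₁ (endOf k i)) (proj₂ (endOf k i)) j)
    relabelled k i j unflipped = ≡.subst (λ l → Ident (embed k (cyl i (fsuc fzero) j)) (outA (proj₁ (endOf k i)) (proj₂ (endOf k i)) l))
      (≡.trans (cong (λ b → relabel g b (toℕ j) mod g) unflipped) (mod-toℕ j)) (toA k i j)

    attached : ∀ k r v i j → I# (embed k r) (outA v i j) → Ident (embed k r) (outA v i j)
    attached (idS v) (cyl e (fsuc fzero) j) .v i .j (≡.refl , e≡i , _ , ≡.refl)
      with Finₚ.toℕ-injective e≡i
    ... | ≡.refl = relabelled (idS v) e j ≡.refl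
    attached (idP v p) (cyl fzero (fsuc fzero) j) .v i .j (≡.refl , inj₁ (i≡ , _ , _ , ≡.refl))
      with Finₚ.toℕ-injective (≡.trans i≡ (≡.sym (toℕ-fst# p)))
    ... | ≡.refl = relabelled (idP v p) fzero j ≡.refl
    attached (idP v p) (cyl (fsuc fzero) (fsuc fzero) j) .v i j′ (≡.refl , inj₂ (i≡ , .j , (_ , _ , ≡.refl) , nm))
      with Finₚ.toℕ-injective (≡.trans i≡ (≡.sym (toℕ-snd# p)))
         | Finₚ.toℕ-injective (neg-unique nm (negMod-toℕ j))
    ... | ≡.refl | ≡.refl = toA (idP v p) (fsuc fzero) j
    attached (idE e i) (cyl fzero (fsuc fzero) j) .(eu e) .i .j (≡.refl , inj₁ (≡.refl , _ , _ , ≡.refl)) =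
      relabelled (idE e i) fzero j ≡.refl
    attached (idE e i) (cyl (fsuc fzero) (fsuc fzero) j) .(ev e) .i .j (≡.refl , inj₂ (≡.refl , _ , _ , ≡.refl)) =
      relabelled (idE e i) (fsuc fzero) j ≡.refl

  ident-view : ∀ {a b} → I# a b → Ident a b
  ident-view {gS v r}   {gS .v r′}     (≡.refl , p)          = within (idS v) p
  ident-view {gP v q r} {gP .v .q r′}  (≡.refl , ≡.refl , p) = within (idP v q) p
  ident-view {gE e i r} {gE .e .i r′}  (≡.refl , ≡.refl , p) = within (idE e i) p
  ident-view {gS v r}   {outZ j}       p                     = toZ v p
  ident-view {gS v r}   {outA v′ i j}  p = attached (idS v) r v′ i j p
  ident-view {gP v q r} {outA v′ i j}  p = attached (idP v q) r v′ i j p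
  ident-view {gE e i r} {outA v′ i′ j} p = attached (idE e i) r v′ i′ j p

  data Edge : V# → V# → Set where
    edge : ∀ k {r r′} → SEdge r r′ → Edge (embed k r) (embed k r′)

  edge-view : ∀ {a b} → E# a b → Edge a b
  edge-view {gS v r}   {gS .v r′}    (≡.refl , p)          = edge (idS v) p
  edge-view {gP v q r} {gP .v .q r′} (≡.refl , ≡.refl , p) = edge (idP v q) p
  edge-view {gE e i r} {gE .e .i r′} (≡.refl , ≡.refl , p) = edge (idE e i) p

  module Fold {ℓᴮ} {B : Set ℓᴮ} (fA : Outer → Fin g → B) (fZ : Fin g → B)
              (fS : ∀ k → SRaw g (sOf k) (ℓOf k) → B) where

    fold : V# → B
    fold (outA v i j) = fA (v , i) j
    fold (outZ j)     = fZ j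
    fold (gS v r)     = fS (idS v) r
    fold (gP v p r)   = fS (idP v p) r
    fold (gE e i r)   = fS (idE e i) r

    -- For a variable gadget `k` the term `embed k r` does not reduce, so this equation is not
    -- definitional.
    fold-embed : ∀ k r → fold (embed k r) ≡ fS k r
    fold-embed (idS v)   r = ≡.refl
    fold-embed (idP v p) r = ≡.refl
    fold-embed (idE e i) r = ≡.refl

    module Resp {S : B → B → Set}
      (S-refl : ∀ {a} → S a a) (S-sym : ∀ {a b} → S a b → S b a) (S-trans : ∀ {a b c} → S a b → S b c → S a c)
      (within-resp : ∀ k {r r′} → SIdent r r′ → S (fS k r) (fS k r′))
      (A-resp : ∀ k i j → S (fS k (cyl i (fsuc fzero) j)) (fA (endOf k i) (relabel g (flipped k i) (toℕ j) mod g)))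
      (Z-resp : ∀ v {r j} → ZEnd r j → S (fS (idS v) r) (fZ j)) where

      fold-ident : ∀ {a b} → Ident a b → S (fold a) (fold b)
      fold-ident (within k p) = ≡.subst₂ S (≡.sym (fold-embed k _)) (≡.sym (fold-embed k _)) (within-resp k p)
      fold-ident (toA k i j)  = ≡.subst (λ x → S x _) (≡.sym (fold-embed k _)) (A-resp k i j)
      fold-ident (toZ v p)    = Z-resp v p

      fold-resp : ∀ {a b} → a ≈# b → S (fold a) (fold b)
      fold-resp = closure-fold S-refl S-sym S-trans (λ {a} {b} p → fold-ident (ident-view {a} {b} p))

      -- `T` is the adjacency of a reflexive graph on `B` with equality `S`; a fold that respects
      -- raw edges is then a homomorphism on all of `≃`.
      module Morphism {T : B → B → Set} (T-refl : ∀ {a} → T a a) (T-sym : ∀ {a b} → T a b → T b a)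
        (T-resp : ∀ {a a′ b b′} → S a a′ → S b b′ → T a b → T a′ b′)
        (edge-resp : ∀ k {r r′} → SEdge r r′ → T (fS k r) (fS k r′)) where

        fold-edge : ∀ {a b} → E# a b → T (fold a) (fold b)
        fold-edge p with edge-view p
        ... | edge k q = ≡.subst₂ T (≡.sym (fold-embed k _)) (≡.sym (fold-embed k _)) (edge-resp k q)

        fold-hom : ∀ {a b} → a ≃ b → T (fold a) (fold b)
        fold-hom (inj₁ p)        = T-resp S-refl (fold-resp p) T-refl
        fold-hom (inj₂ (inj₁ p)) = T-resp S-refl (fold-resp p) T-refl
        fold-hom (inj₂ (inj₂ (x , y , inj₁ p , s , t))) = T-resp (fold-resp s) (fold-resp t) (fold-edge p)
        fold-hom (inj₂ (inj₂ (x , y , inj₂ p , s , t))) = T-resp (fold-resp s) (fold-resp t) (T-sym (fold-edge p))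

  -- No raw edge joins two vertices `outA`; adjacency on `A^v_i` is borrowed from the cylinder of
  -- the copy of `S_3` at `v`.
  A-adj : ∀ o j → (A-at o j ≃ A-at o (suc j)) × (A-at o (suc j) ≃ A-at o j)
  A-adj (v , i) j =
    ≃-resp (A≈ j) (A≈ (suc j)) (E⇒≃ (adj j)) , ≃-resp (A≈ (suc j)) (A≈ j) (E⇒≃′ (adj j))
    where
    A≈ : ∀ j → K.cyl-at (idS v) i (fsuc fzero) j ≈# outA v i (j mod g)
    A≈ j = I⇒≈ (≡.refl , ≡.refl , ≡.refl , ≡.refl)
    adj : ∀ j → E# (K.cyl-at (idS v) i (fsuc fzero) j) (K.cyl-at (idS v) i (fsuc fzero) (suc j))
    adj j = ≡.refl , ≡.refl , cycAdj-mod j g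

  top-Z : ∀ v j → j < g → K.top-at (idS v) j ≈# Z-at j
  top-Z v j j<g = I⇒≈ (Finₚ.toℕ-fromℕ _ , 0 , z<s ,
    ≡.trans (toℕ-mod-< {{sg≢0 (idS v)}} (≡.subst₂ _<_ (ℕₚ.+-identityʳ (j * 3)) (ℕₚ.*-comm g 3) (block-< j<g z<s)))
      (≡.trans (cong (_* 3) (≡.sym (toℕ-mod-< j<g))) (≡.sym (ℕₚ.+-identityʳ _))))

  -- The vertex in which all the cycles `A_i'` of the gadget meet; in `T*` it carries one leg to
  -- each end cycle.
  centre : GadgetId → V#
  centre k = K.spine k 0

  end-base : ∀ k i → K.cyl-at k i (fsuc fzero) 0 ≈# A-at (endOf k i) 0
  end-base k i = ≡.subst (K.cyl-at k i (fsuc fzero) 0 ≈#_) (go (flipped k i)) (end-≈ k i 0 z≤n)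
    where
    go : ∀ b → A-at (endOf k i) (relabel g b 0) ≡ A-at (endOf k i) 0
    go false = ≡.refl
    go true  = cong (outA _ _) (n-mod-n g)

  leg-adj : ∀ k i → (centre k ≃ A-at (endOf k i) 0) × (A-at (endOf k i) 0 ≃ centre k)
  leg-adj k i =
    ≃-resp (K.cyl-base k i) (end-base k i) (E⇒≃ rung) , ≃-resp (end-base k i) (K.cyl-base k i) (E⇒≃′ rung)
    where
    rung : E# (K.cyl-at k i fzero 0) (K.cyl-at k i (fsuc fzero) 0)
    rung = embed-edge k (≡.refl , inj₁ ≡.refl)

  top-Z₀ : ∀ v → K.slice-at (idS v) (K.top (idS v)) 0 ≈# Z-at 0
  top-Z₀ v = top-Z v 0 (ℕ.>-nonZero⁻¹ g)

  module FootFold = Fold (λ o _ → A-at o 0) (λ _ → Z-at 0) (λ k r → embed k (foot {{sg≢0 = sg≢0 k}} r))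

  -- The retraction of G# onto T*.
  footV : V# → V#
  footV = FootFold.fold

  foot-ident : ∀ k {r r′} → SIdent r r′ →
    embed k (foot {{sg≢0 = sg≢0 k}} r) ≈# embed k (foot {{sg≢0 = sg≢0 k}} r′)
  foot-ident k {prod p b} {prod p′ b′} (inj₁ (pℓ , p′ℓ , _)) =
    ≡.subst (λ q → K.slice-at k p 0 ≈# K.slice-at k q 0) (Finₚ.toℕ-injective (≡.trans pℓ (≡.sym p′ℓ))) ≈-refl
  foot-ident k {prod p b} {prod p′ b′} (inj₂ (p0 , p′0 , _)) =
    ≡.subst (λ q → K.slice-at k p 0 ≈# K.slice-at k q 0) (Finₚ.toℕ-injective (≡.trans p0 (≡.sym p′0))) ≈-refl
  foot-ident k {cyl i fzero j} {prod fzero b} _ = K.cyl-base k i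

  foot-edge : ∀ k {r r′} → SEdge r r′ →
    embed k (foot {{sg≢0 = sg≢0 k}} r) ≃ embed k (foot {{sg≢0 = sg≢0 k}} r′)
  foot-edge k {prod p b}  {prod p′ b′}    (pp , _)     = E⇒≃ (embed-edge k (pp , inj₁ ≡.refl))
  foot-edge k {cyl i t j} {cyl .i t′ j′} (≡.refl , _) = E⇒≃ (embed-edge k (≡.refl , inj₁ ≡.refl))

  foot-Z : ∀ v {r j} → ZEnd r j → embed (idS v) (foot {{sg≢0 = sg≢0 (idS v)}} r) ≈# Z-at 0
  foot-Z v {prod p b} (pℓ , _) = ≡.subst (λ q → K.slice-at (idS v) q 0 ≈# Z-at 0)
    (Finₚ.toℕ-injective (≡.trans (Finₚ.toℕ-fromℕ _) (≡.sym pℓ))) (top-Z₀ v)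

  ≃-sym : ∀ {a b} → a ≃ b → b ≃ a
  ≃-sym (inj₁ p)        = inj₁ (≈-sym p)
  ≃-sym (inj₂ (inj₁ p)) = inj₁ (≈-sym p)
  ≃-sym (inj₂ (inj₂ (x , y , inj₁ p , s , t))) = inj₂ (inj₂ (y , x , inj₂ p , t , s))
  ≃-sym (inj₂ (inj₂ (x , y , inj₂ p , s , t))) = inj₂ (inj₂ (y , x , inj₁ p , t , s))

  module FootResp = FootFold.Resp {S = _≈#_} ≈-refl ≈-sym ≈-trans foot-ident (λ k i j → end-base k i) foot-Z
  module FootHom = FootResp.Morphism {T = _≃_} (inj₁ ≈-refl) ≃-sym ≃-resp foot-edge

  foot-idem : ∀ a → footV (footV a) ≡ footV a
  foot-idem (outA v i j)           = ≡.refl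
  foot-idem (outZ j)               = ≡.refl
  foot-idem (gS v (prod p b))      = ≡.refl
  foot-idem (gS v (cyl i t j))     = ≡.refl
  foot-idem (gP v q (prod p b))    = ≡.refl
  foot-idem (gP v q (cyl i t j))   = ≡.refl
  foot-idem (gE e i (prod p b))    = ≡.refl
  foot-idem (gE e i (cyl i′ t j)) = ≡.refl

  foot-TRaw : ∀ k r → TRaw r → footV (embed k r) ≡ embed k r
  foot-TRaw k r p = ≡.trans (FootFold.fold-embed k r) (cong (embed k) (fixed k r p))
    where
    fixed : ∀ k (r : SRaw g (sOf k) (ℓOf k)) → TRaw r → foot {{sg≢0 = sg≢0 k}} r ≡ r
    fixed k (prod p b)  b0       = cong (prod p)
      (≡.trans (cong (λ c → _mod_ c (sOf k * g) {{sg≢0 k}}) (≡.sym b0)) (mod-toℕ {{sg≢0 k}} b))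
    fixed k (cyl i t j) (_ , j0) = cong (cyl i t) (≡.trans (cong (_mod g) (≡.sym j0)) (mod-toℕ j))

  foot-InT : ∀ {a} → InT a → footV a ≈# a
  foot-InT (k , r , tr , p) = ≈-trans (FootResp.fold-resp (≈-sym p))
    (≡.subst (_≈# _) (≡.sym (foot-TRaw k r tr)) p)

  spine-InT : ∀ k q → InT (K.spine k q)
  spine-InT k q = k , prod (K.clamp k q) (_mod_ 0 (sOf k * g) {{sg≢0 k}}) ,
    toℕ-mod-< {{sg≢0 k}} (ℕ.>-nonZero⁻¹ _ {{sg≢0 k}}) , ≈-refl

  outer-InT : ∀ o → InT (A-at o 0)
  outer-InT (v , i) = idS v , cyl i (fsuc fzero) (0 mod g) , (≡.refl , toℕ-mod-< (ℕ.>-nonZero⁻¹ g)) , end-base (idS v) i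

  InT-resp : ∀ {a b} → a ≈# b → InT a → InT b
  InT-resp p (k , r , tr , q) = k , r , tr , ≈-trans q p

  foot-embed-InT : ∀ k r → InT (embed k (foot {{sg≢0 = sg≢0 k}} r))
  foot-embed-InT k (prod p b) = ≡.subst (λ q → InT (K.slice-at k q 0)) (K.clamp-toℕ k p) (spine-InT k (toℕ p))
  foot-embed-InT k (cyl i fzero j)        = InT-resp (≈-sym (K.cyl-base k i)) (spine-InT k 0)
  foot-embed-InT k (cyl i (fsuc fzero) j) = InT-resp (≈-sym (end-base k i)) (outer-InT (endOf k i))

  -- The vertex `v₀` serves the foot of `Z*`, which lies in `T*` as the last vertex of the spine of
  -- some `S^v`.
  footV-InT : Fin n → ∀ a → InT (footV a)
  footV-InT v₀ (outA v i j) = outer-InT (v , i)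
  footV-InT v₀ (outZ j)     = InT-resp (top-Z₀ v₀)
    (≡.subst (λ q → InT (K.slice-at (idS v₀) q 0)) (K.clamp-top (idS v₀)) (spine-InT (idS v₀) ℓ₃))
  footV-InT v₀ (gS v r)     = foot-embed-InT (idS v) r
  footV-InT v₀ (gP v p r)   = foot-embed-InT (idP v p) r
  footV-InT v₀ (gE e i r)   = foot-embed-InT (idE e i) r

  -- Transport of cocycles along slices

  module Swing {A : AbelianGroup 0ℓ 0ℓ} (e : Cocycle G# A)
    (outer : ∀ o → AbelianGroup._≈_ A (Arcs.arc {G#} ≈-refl {A} e (A-at o) g) (AbelianGroup.ε A)) where
    open AbelianGroup A renaming (refl to refl≈; sym to sym≈; trans to trans≈)
    open Cocycle e
    open Arcs {G#} ≈-refl {A} e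
    open SetoidReasoning setoid

    -- Running backwards from `g` and forwards from 0 differ by a full turn, which `outer` makes
    -- trivial.
    A-reversed : ∀ o j → j ≤ g → arc (λ l → A-at o (g ∸ l)) j ≈ arc (A-at o) (g ∸ j)
    A-reversed o j j≤g = begin
      arc (λ l → A-at o (g ∸ l)) j                 ≈⟨ identityʳ _ ⟨
      arc (λ l → A-at o (g ∸ l)) j ∙ ε             ≈⟨ ∙-congˡ (outer o) ⟨
      arc (λ l → A-at o (g ∸ l)) j ∙ arc (A-at o) g
        ≈⟨ arc-reverse (A-at o) g (λ j → proj₁ (A-adj o j)) (λ j → proj₂ (A-adj o j)) j j≤g ⟩
      arc (A-at o) (g ∸ j)                         ∎

    end-arc : ∀ k i j → j ≤ g →
      arc (K.cyl-at k i (fsuc fzero)) j ≈ arc (A-at (endOf k i)) (relabel g (flipped k i) j)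
    end-arc k i j j≤g = trans≈ (arc-cong j λ l l≤j → end-≈ k i l (ℕₚ.≤-trans l≤j j≤g)) (go (flipped k i))
      where
      go : ∀ b → arc (λ l → A-at (endOf k i) (relabel g b l)) j ≈ arc (A-at (endOf k i)) (relabel g b j)
      go false = refl≈
      go true  = A-reversed (endOf k i) j j≤g

    end-closed : ∀ k i → arc (K.cyl-at k i (fsuc fzero)) g ≈ ε
    end-closed k i = trans≈ (end-arc k i g ℕₚ.≤-refl) (go (flipped k i))
      where
      go : ∀ b → arc (A-at (endOf k i)) (relabel g b g) ≈ ε
      go false = outer (endOf k i)
      go true  = reflexive (cong (arc (A-at (endOf k i))) (ℕₚ.n∸n≡0 g))

    A-mod : ∀ o j → j ≤ g → arc (A-at o) j ≈ arc (A-at o) (toℕ (j mod g))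
    A-mod o j j≤g with ℕₚ.m≤n⇒m<n∨m≡n j≤g
    ... | inj₁ j<g    = reflexive (cong (arc (A-at o)) (≡.sym (toℕ-mod-< j<g)))
    ... | inj₂ ≡.refl = trans≈ (outer o) (reflexive (cong (arc (A-at o))
            (≡.sym (≡.trans (cong toℕ (n-mod-n j)) (toℕ-mod-< (ℕ.>-nonZero⁻¹ j))))))

    relabel-≤ : ∀ b {j} → j ≤ g → relabel g b j ≤ g
    relabel-≤ false j≤g = j≤g
    relabel-≤ true  {j} _ = ℕₚ.m∸n≤m g j

    private
      module KK (k : GadgetId) = K.Values.Killed k e (end-closed k)
      module SwingFold = Fold
        (λ o j → arc (A-at o) (toℕ j)) (λ j → arc Z-at (toℕ j)) (λ k → K.Values.swing k e)

    swing : V# → Carrier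
    swing = SwingFold.fold

    swing-resp : ∀ {a b} → a ≈# b → swing a ≈ swing b
    swing-resp = SwingFold.Resp.fold-resp {S = _≈_} refl≈ sym≈ trans≈
      (λ k → KK.swing-ident k)
      (λ k i j → let j≤g = ℕₚ.<⇒≤ (Finₚ.toℕ<n j) in
        trans≈ (end-arc k i (toℕ j) j≤g) (A-mod (endOf k i) _ (relabel-≤ (flipped k i) j≤g)))
      to-Z
      where
      to-Z : ∀ v {r j} → ZEnd r j → K.Values.swing (idS v) e r ≈ arc Z-at (toℕ j)
      to-Z v {prod p b} {j} (pℓ , i , i<3 , eq) = trans≈ (KK.top-swing′ (idS v) {p} {b} {toℕ j} pℓ i<3 eq)
        (arc-cong (toℕ j) λ l l≤j → top-Z v l (ℕₚ.≤-<-trans l≤j (Finₚ.toℕ<n j)))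

    swing-edge : ∀ {a b} → E# a b → swing a ∙ ⟨ a , b ⟩ ≈ ⟨ footV a , footV b ⟩ ∙ swing b
    swing-edge {a} {b} p with edge-view {a} {b} p
    ... | edge (idS v)   q = KK.swing-edge (idS v) q
    ... | edge (idP v s) q = KK.swing-edge (idP v s) q
    ... | edge (idE d i) q = KK.swing-edge (idE d i) q

  -- The copies of `S_2`. The spanning tree contains their tail legs and omits their head legs; of
  -- the copies of `S_3` it contains everything in `T*`.
  Extra : Set
  Extra = (Fin n × P3) ⊎ (EdgeIx G × Fin 3)

  extra : Extra → GadgetId
  extra (inj₁ (v , p)) = idP v p
  extra (inj₂ (e , i)) = idE e i

  tail head : ∀ x → Fin (sOf (extra x))
  tail (inj₁ _) = fzero
  tail (inj₂ _) = fzero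
  head (inj₁ _) = fsuc fzero
  head (inj₂ _) = fsuc fzero

  tailEnd headEnd : Extra → Outer
  tailEnd x = endOf (extra x) (tail x)
  headEnd x = endOf (extra x) (head x)

  spineT : ∀ v → ℕ → TV
  spineT v q = K.spine (idS v) q , spine-InT (idS v) q

  centreT : GadgetId → TV
  centreT k = centre k , spine-InT k 0

  outerT : Outer → TV
  outerT o = A-at o 0 , outer-InT o

  -- Down the spine of the copy of S₃ at the head to the common cycle Z*, and back up the one at the tail.
  loopT : Extra → List TV
  loopT x = centreT (extra x) ∷ outerT (headEnd x) ∷
    applyUpTo (spineT (proj₁ (headEnd x))) (suc ℓ₃) ++
    applyDownFrom (spineT (proj₁ (tailEnd x))) (suc ℓ₃) ++ outerT (tailEnd x) ∷ centreT (extra x) ∷ []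

  loop : Extra → List V#
  loop x = centre (extra x) ∷ A-at (headEnd x) 0 ∷
    applyUpTo (K.spine (idS (proj₁ (headEnd x)))) (suc ℓ₃) ++
    applyDownFrom (K.spine (idS (proj₁ (tailEnd x)))) (suc ℓ₃) ++ A-at (tailEnd x) 0 ∷ centre (extra x) ∷ []

  map-loopT : ∀ x → map proj₁ (loopT x) ≡ loop x
  map-loopT x = cong (λ l → centre (extra x) ∷ A-at (headEnd x) 0 ∷ l)
    (≡.trans (Listₚ.map-++ proj₁ (applyUpTo (spineT v) (suc ℓ₃)) _)
      (cong₂ _++_ (Listₚ.map-applyUpTo (spineT v) proj₁ (suc ℓ₃))
        (≡.trans (Listₚ.map-++ proj₁ (applyDownFrom (spineT u) (suc ℓ₃)) _)
          (cong (_++ A-at (tailEnd x) 0 ∷ centre (extra x) ∷ []) (Listₚ.map-applyDownFrom (spineT u) proj₁ (suc ℓ₃))))))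
    where
    v = proj₁ (headEnd x)
    u = proj₁ (tailEnd x)

  spine-end : ∀ v → K.spine (idS v) ℓ₃ ≈# Z-at 0
  spine-end v = ≡.subst (λ q → K.slice-at (idS v) q 0 ≈# Z-at 0) (≡.sym (K.clamp-top (idS v))) (top-Z₀ v)

  spine-ends : ∀ v u → K.spine (idS v) ℓ₃ ≈# K.spine (idS u) ℓ₃
  spine-ends v u = ≈-trans (spine-end v) (≈-sym (spine-end u))

  -- The potential on the spanning tree

  module Tree {A : AbelianGroup 0ℓ 0ℓ} (e : Cocycle G# A)
    (loops : ∀ x → AbelianGroup._≈_ A (along A (Cocycle.⟨_,_⟩ e) (loop x)) (AbelianGroup.ε A)) where
    open AbelianGroup A renaming (refl to refl≈; sym to sym≈; trans to trans≈)
    open AbelianGroupProperties A using (inverseˡ-unique; ⁻¹-anti-homo-∙; \\-leftDividesʳ)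
    open Cocycle e
    open Arcs {G#} ≈-refl {A} e
    open SetoidReasoning setoid

    leg : ∀ k → Fin (sOf k) → Carrier
    leg k i = ⟨ centre k , A-at (endOf k i) 0 ⟩

    leg⁻ : ∀ k → Fin (sOf k) → Carrier
    leg⁻ k i = ⟨ A-at (endOf k i) 0 , centre k ⟩

    leg-inverse : ∀ k i → leg k i ∙ leg⁻ k i ≈ ε
    leg-inverse k i = ⟨⟩-inverse (proj₁ (leg-adj k i)) (proj₂ (leg-adj k i))

    height : ∀ k → ℕ → Carrier
    height k = arc (K.spine k)

    -- Chosen so that the climb along the spine of `S^v` arrives at `Z*` with value `ε`,
    -- independently of `v`.
    atS : Fin n → Carrier
    atS v = height (idS v) ℓ₃ ⁻¹

    atA : Outer → Carrier
    atA (v , i) = leg (idS v) i ∙ atS v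

    atCentre : GadgetId → Carrier
    atCentre (idS v)   = atS v
    atCentre (idP v p) = leg⁻ (idP v p) fzero ∙ atA (endOf (idP v p) fzero)
    atCentre (idE d i) = leg⁻ (idE d i) fzero ∙ atA (endOf (idE d i) fzero)

    -- Apart from the head leg, the loop of `x` runs inside the tree. Vanishing on it therefore says
    -- that the head leg agrees with the values already assigned to its two ends.
    loop-value : ∀ x → leg (extra x) (head x) ∙ (leg⁻ (extra x) (tail x) ∙ atA (tailEnd x)) ≈ atA (headEnd x)
    loop-value x = begin
      a ∙ (m ∙ (l₀ ∙ h₀ ⁻¹))          ≈⟨ ∙-congˡ (sym≈ D≈) ⟩
      a ∙ D                           ≈⟨ a∙D ⟩
      l₁ ∙ h₁ ⁻¹                      ∎
      where
      v = proj₁ (headEnd x)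
      u = proj₁ (tailEnd x)
      f₁ = K.spine (idS v)
      f₀ = K.spine (idS u)
      a  = leg (extra x) (head x)
      m  = leg⁻ (extra x) (tail x)
      b  = leg⁻ (idS v) (proj₂ (headEnd x))
      l₁ = leg (idS v) (proj₂ (headEnd x))
      l₀ = leg (idS u) (proj₂ (tailEnd x))
      h₁ = height (idS v) ℓ₃
      h₀ = height (idS u) ℓ₃
      end = A-at (tailEnd x) 0 ∷ centre (extra x) ∷ []
      D  = along A ⟨_,_⟩ (applyDownFrom f₀ (suc ℓ₃) ++ end)
      D≈ : D ≈ m ∙ (l₀ ∙ h₀ ⁻¹)
      D≈ = begin
        D                     ≈⟨ \\-leftDividesʳ h₀ D ⟨
        h₀ ⁻¹ ∙ (h₀ ∙ D)      ≈⟨ ∙-congˡ (along-down f₀ (K.spine-up (idS u)) (K.spine-down (idS u)) ℓ₃ _ _) ⟩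
        h₀ ⁻¹ ∙ (l₀ ∙ (m ∙ ε)) ≈⟨ ∙-congˡ (∙-congˡ (identityʳ m)) ⟩
        h₀ ⁻¹ ∙ (l₀ ∙ m)      ≈⟨ comm _ _ ⟩
        (l₀ ∙ m) ∙ h₀ ⁻¹      ≈⟨ ∙-congʳ (comm l₀ m) ⟩
        (m ∙ l₀) ∙ h₀ ⁻¹      ≈⟨ assoc _ _ _ ⟩
        m ∙ (l₀ ∙ h₀ ⁻¹)      ∎
      closed : (a ∙ D) ∙ (b ∙ h₁) ≈ ε
      closed = begin
        (a ∙ D) ∙ (b ∙ h₁)          ≈⟨ assoc _ _ _ ⟩
        a ∙ (D ∙ (b ∙ h₁))          ≈⟨ ∙-congˡ (comm _ _) ⟩
        a ∙ ((b ∙ h₁) ∙ D)          ≈⟨ ∙-congˡ (assoc _ _ _) ⟩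
        -- The walk lists the meeting point of the two spines twice, as raw vertices of two gadgets;
        -- the trivial step between them is inserted here.
        a ∙ (b ∙ (h₁ ∙ D))          ≈⟨ ∙-congˡ (∙-congˡ (∙-congˡ (identityˡ D))) ⟨
        a ∙ (b ∙ (h₁ ∙ (ε ∙ D)))
          ≈⟨ ∙-congˡ (∙-congˡ (∙-congˡ (∙-congʳ (⟨⟩-≈ (spine-ends v u))))) ⟨
        a ∙ (b ∙ (h₁ ∙ (⟨ f₁ ℓ₃ , f₀ ℓ₃ ⟩ ∙ D)))
          ≈⟨ ∙-congˡ (∙-congˡ (along-up f₁ ℓ₃ (f₀ ℓ₃) (applyDownFrom f₀ ℓ₃ ++ end))) ⟨
        along A ⟨_,_⟩ (loop x)      ≈⟨ loops x ⟩
        ε                           ∎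
      a∙D : a ∙ D ≈ l₁ ∙ h₁ ⁻¹
      a∙D = begin
        a ∙ D        ≈⟨ inverseˡ-unique _ _ closed ⟩
        (b ∙ h₁) ⁻¹  ≈⟨ ⁻¹-anti-homo-∙ b h₁ ⟩
        h₁ ⁻¹ ∙ b ⁻¹ ≈⟨ comm _ _ ⟩
        b ⁻¹ ∙ h₁ ⁻¹ ≈⟨ ∙-congʳ (inverseˡ-unique l₁ b (leg-inverse (idS v) (proj₂ (headEnd x)))) ⟨
        l₁ ∙ h₁ ⁻¹   ∎

    leg-cancel : ∀ k i c → leg k i ∙ (leg⁻ k i ∙ c) ≈ c
    leg-cancel k i c = trans≈ (sym≈ (assoc _ _ _)) (trans≈ (∙-congʳ (leg-inverse k i)) (identityˡ c))

    leg-centre : ∀ k i → leg k i ∙ atCentre k ≈ atA (endOf k i)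
    leg-centre (idS v)   i            = refl≈
    leg-centre (idP v p) fzero        = leg-cancel (idP v p) fzero _
    leg-centre (idP v p) (fsuc fzero) = loop-value (inj₁ (v , p))
    leg-centre (idE d i) fzero        = leg-cancel (idE d i) fzero _
    leg-centre (idE d i) (fsuc fzero) = loop-value (inj₂ (d , i))

    treeᵏ : ∀ k → SRaw g (sOf k) (ℓOf k) → Carrier
    treeᵏ k (prod p b)             = atCentre k ∙ height k (toℕ p)
    treeᵏ k (cyl i fzero j)        = atCentre k
    treeᵏ k (cyl i (fsuc fzero) j) = atA (endOf k i)

    module TreeFold = Fold (λ o _ → atA o) (λ _ → ε) treeᵏ

    tree : V# → Carrier
    tree = TreeFold.fold

    tree-ident : ∀ k {r r′} → SIdent r r′ → treeᵏ k r ≈ treeᵏ k r′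
    tree-ident k {prod p b} {prod p′ b′} (inj₁ (pℓ , p′ℓ , _)) =
      reflexive (cong (λ q → atCentre k ∙ height k q) (≡.trans pℓ (≡.sym p′ℓ)))
    tree-ident k {prod p b} {prod p′ b′} (inj₂ (p0 , p′0 , _)) =
      reflexive (cong (λ q → atCentre k ∙ height k q) (≡.trans p0 (≡.sym p′0)))
    tree-ident k {cyl i fzero j} {prod fzero b} _ = sym≈ (identityʳ _)

    tree-Z : ∀ v {r j} → ZEnd r j → treeᵏ (idS v) r ≈ ε
    tree-Z v {prod p b} (pℓ , _) =
      trans≈ (reflexive (cong (λ q → atCentre (idS v) ∙ height (idS v) q) pℓ)) (inverseˡ _)

    tree-resp : ∀ {a b} → a ≈# b → tree a ≈ tree b
    tree-resp = TreeFold.Resp.fold-resp {S = _≈_} refl≈ sym≈ trans≈ tree-ident (λ k i j → refl≈) tree-Z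

    spine-slice : ∀ k p → K.spine k (toℕ p) ≡ K.slice-at k p 0
    spine-slice k p = cong (λ q → K.slice-at k q 0) (K.clamp-toℕ k p)

    treeᵏ-edge : ∀ k {r r′} → SEdge r r′ →
      ⟨ embed k (foot {{sg≢0 = sg≢0 k}} r) , embed k (foot {{sg≢0 = sg≢0 k}} r′) ⟩ ∙ treeᵏ k r ≈ treeᵏ k r′
    treeᵏ-edge k {prod p b} {prod p′ b′} (pp , _) = begin
      ⟨ K.slice-at k p 0 , K.slice-at k p′ 0 ⟩ ∙ (atCentre k ∙ height k (toℕ p))
        ≡⟨ cong₂ (λ x y → ⟨ x , y ⟩ ∙ (atCentre k ∙ height k (toℕ p))) (spine-slice k p) (spine-slice k p′) ⟨
      ⟨ K.spine k (toℕ p) , K.spine k (toℕ p′) ⟩ ∙ (atCentre k ∙ height k (toℕ p))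
        ≈⟨ x∙yz≈y∙xz commutativeSemigroup _ _ _ ⟩
      atCentre k ∙ (⟨ K.spine k (toℕ p) , K.spine k (toℕ p′) ⟩ ∙ height k (toℕ p))
        ≈⟨ ∙-congˡ (arc-path (K.spine k) (K.spine-up k) (K.spine-down k) pp) ⟩
      atCentre k ∙ height k (toℕ p′) ∎
    treeᵏ-edge k {cyl i fzero j} {cyl .i fzero j′} (≡.refl , _) =
      trans≈ (∙-congʳ (⟨⟩-refl _)) (identityˡ _)
    treeᵏ-edge k {cyl i (fsuc fzero) j} {cyl .i (fsuc fzero) j′} (≡.refl , _) =
      trans≈ (∙-congʳ (⟨⟩-refl _)) (identityˡ _)
    treeᵏ-edge k {cyl i fzero j} {cyl .i (fsuc fzero) j′} (≡.refl , _) =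
      trans≈ (∙-congʳ (resp (K.cyl-base k i) (end-base k i))) (leg-centre k i)
    treeᵏ-edge k {cyl i (fsuc fzero) j} {cyl .i fzero j′} (≡.refl , _) = begin
      ⟨ K.cyl-at k i (fsuc fzero) 0 , K.cyl-at k i fzero 0 ⟩ ∙ atA (endOf k i)
        ≈⟨ ∙-cong (resp (end-base k i) (K.cyl-base k i)) (sym≈ (leg-centre k i)) ⟩
      leg⁻ k i ∙ (leg k i ∙ atCentre k)
        ≈⟨ x∙yz≈y∙xz commutativeSemigroup _ _ _ ⟩
      leg k i ∙ (leg⁻ k i ∙ atCentre k)
        ≈⟨ leg-cancel k i _ ⟩
      atCentre k ∎

    tree-edge : ∀ {a b} → E# a b → ⟨ footV a , footV b ⟩ ∙ tree a ≈ tree b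
    tree-edge {a} {b} p with edge-view {a} {b} p
    ... | edge (idS v)   q = treeᵏ-edge (idS v) q
    ... | edge (idP v s) q = treeᵏ-edge (idP v s) q
    ... | edge (idE d i) q = treeᵏ-edge (idE d i) q

  module _ {A : AbelianGroup 0ℓ 0ℓ} (e : Cocycle G# A) where
    open AbelianGroup A renaming (refl to refl≈; sym to sym≈; trans to trans≈)
    open Cocycle e
    open Arcs {G#} ≈-refl {A} e
    open SetoidReasoning setoid

    -- Adjacency closes the raw edges under reversal and under identification of the ends; both
    -- closures are dealt with here, once for all potentials.
    exact-from-edges : (c : V# → Carrier) → (∀ {a b} → a ≈# b → c a ≈ c b) →
      (∀ {a b} → E# a b → ⟨ a , b ⟩ ∙ c a ≈ c b) → Exact e
    exact-from-edges c c-resp c-edge = c , c-resp , go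
      where
      along-≈ : ∀ {a b} → a ≈# b → ⟨ a , b ⟩ ∙ c a ≈ c b
      along-≈ p = trans≈ (∙-congʳ (⟨⟩-≈ p)) (trans≈ (identityˡ _) (c-resp p))
      transport : ∀ {a b x y} → x ≈# a → y ≈# b → ⟨ x , y ⟩ ∙ c x ≈ c y → ⟨ a , b ⟩ ∙ c a ≈ c b
      transport p q r = trans≈ (∙-cong (sym≈ (resp p q)) (sym≈ (c-resp p))) (trans≈ r (c-resp q))
      backward : ∀ {a b} → E# a b → ⟨ b , a ⟩ ∙ c b ≈ c a
      backward {a} {b} p = trans≈ (∙-congˡ (sym≈ (c-edge {a} {b} p))) (trans≈ (sym≈ (assoc _ _ _))
        (trans≈ (∙-congʳ (⟨⟩-inverse (E⇒≃′ {a} {b} p) (E⇒≃ {a} {b} p))) (identityˡ _)))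
      go : ∀ {a b} → a ≃ b → ⟨ a , b ⟩ ∙ c a ≈ c b
      go (inj₁ p)        = along-≈ p
      go (inj₂ (inj₁ p)) = along-≈ p
      go (inj₂ (inj₂ (x , y , inj₁ p , s , t))) = transport s t (c-edge {x} {y} p)
      go (inj₂ (inj₂ (x , y , inj₂ p , s , t))) = transport s t (backward {y} {x} p)

    -- `tree a` is the value of the potential at the foot of `a`, and `swing a` leads from the foot
    -- to `a`.
    exact-G# : (∀ o → arc (A-at o) g ≈ ε) → (∀ x → along A ⟨_,_⟩ (loop x) ≈ ε) → Exact e
    exact-G# outer loops = exact-from-edges (λ a → tree a ∙ swing a)
      (λ p → ∙-cong (tree-resp p) (swing-resp p))
      (λ {a} {b} p → begin
        ⟨ a , b ⟩ ∙ (tree a ∙ swing a)             ≈⟨ x∙yz≈y∙xz commutativeSemigroup _ _ _ ⟩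
        tree a ∙ (⟨ a , b ⟩ ∙ swing a)             ≈⟨ ∙-congˡ (comm _ _) ⟩
        tree a ∙ (swing a ∙ ⟨ a , b ⟩)             ≈⟨ ∙-congˡ (swing-edge {a} {b} p) ⟩
        tree a ∙ (⟨ footV a , footV b ⟩ ∙ swing b) ≈⟨ x∙yz≈y∙xz commutativeSemigroup _ _ _ ⟩
        ⟨ footV a , footV b ⟩ ∙ (tree a ∙ swing b) ≈⟨ assoc _ _ _ ⟨
        (⟨ footV a , footV b ⟩ ∙ tree a) ∙ swing b ≈⟨ ∙-congʳ (tree-edge {a} {b} p) ⟩
        tree b ∙ swing b                           ∎)
      where
      open Tree e loops
      open Swing e outer

  TV-nonempty : TV → Fin n
  TV-nonempty (_ , idS v , _)   = v
  TV-nonempty (_ , idP v _ , _) = v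
  TV-nonempty (_ , idE e _ , _) = eu e

  module _ {A : AbelianGroup 0ℓ 0ℓ} (e : Cocycle T* A) where
    open AbelianGroup A
    open Cocycle e

    -- The cocycle is pulled back along the retraction `footV`, which changes nothing on `T*`. The
    -- pull-back sees only feet, so the tree potential alone solves it.
    exact-T* : (∀ x → along A ⟨_,_⟩ (loopT x) ≈ ε) → Exact e
    exact-T* loops with Fin? n
    -- Without vertices of `G` the raw cycle `outZ` is still there, but `T*` is empty.
    ... | no  empty = (λ _ → ε) , (λ _ → refl) , λ {a} _ → ⊥-elim (empty (TV-nonempty a))
    ... | yes v₀    = (λ a → proj₁ exact (proj₁ a)) , proj₁ (proj₂ exact) ,
        λ {a} {b} p → trans (∙-congʳ (sym (agree a b))) (proj₂ (proj₂ exact) p)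
      where
      footT : V# → TV
      footT a = footV a , footV-InT v₀ a
      pulled : Cocycle G# A
      pulled = record
        { ⟨_,_⟩ = λ a b → ⟨ footT a , footT b ⟩
        ; resp  = λ p q → resp (FootResp.fold-resp p) (FootResp.fold-resp q)
        ; cocyc = λ p q r → cocyc (FootHom.fold-hom p) (FootHom.fold-hom q) (FootHom.fold-hom r) }
      agree : ∀ a b → ⟨ footT (proj₁ a) , footT (proj₁ b) ⟩ ≈ ⟨ a , b ⟩
      agree a b = resp (foot-InT (proj₂ a)) (foot-InT (proj₂ b))
      along-agree : ∀ xs → along A (Cocycle.⟨_,_⟩ pulled) (map proj₁ xs) ≈ along A ⟨_,_⟩ xs
      along-agree []           = refl
      along-agree (a ∷ [])     = refl
      along-agree (a ∷ b ∷ xs) = ∙-cong (agree a b) (along-agree (b ∷ xs))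
      loops′ : ∀ x → along A (Cocycle.⟨_,_⟩ pulled) (loop x) ≈ ε
      loops′ x = trans (reflexive (cong (along A (Cocycle.⟨_,_⟩ pulled)) (≡.sym (map-loopT x))))
        (trans (along-agree (loopT x)) (loops x))
      open Tree pulled loops′
      unfoot : ∀ a → footV (footV a) ≈# footV a
      unfoot a = ≡.subst (_≈# footV a) (≡.sym (foot-idem a)) ≈-refl
      exact : Exact pulled
      exact = exact-from-edges pulled tree tree-resp
        (λ {a} {b} p → trans (∙-congʳ (sym (resp (unfoot a) (unfoot b)))) (tree-edge {a} {b} p))

-- Winding cochains

-- Four-cycles that share all their vertices except the fourth, which carries the weight of the cycle.
data Bouquet : Set where
  b0 b1 b2 : Bouquet
  b3       : ℤ → Bouquet

data _⌢_ : Bouquet → Bouquet → Set where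
  ⌢-refl : ∀ {p} → p ⌢ p
  e01    : b0 ⌢ b1
  e10    : b1 ⌢ b0
  e12    : b1 ⌢ b2
  e21    : b2 ⌢ b1
  e23    : ∀ {w} → b2 ⌢ b3 w
  e32    : ∀ {w} → b3 w ⌢ b2
  e30    : ∀ {w} → b3 w ⌢ b0
  e03    : ∀ {w} → b0 ⌢ b3 w

-- The signed count of crossings of the edge from `b3 w` to `b0`, with weight `w`; it generalises
-- the dual class of a four-cycle.
wind : Bouquet → Bouquet → ℤ
wind (b3 w) b0     = w
wind b0     (b3 w) = ℤ.- w
wind _      _      = 0ℤ

⌢-sym : ∀ {p q} → p ⌢ q → q ⌢ p
⌢-sym ⌢-refl = ⌢-refl
⌢-sym e01 = e10
⌢-sym e10 = e01
⌢-sym e12 = e21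
⌢-sym e21 = e12
⌢-sym e23 = e32
⌢-sym e32 = e23
⌢-sym e30 = e03
⌢-sym e03 = e30

wind-self : ∀ p → wind p p ≡ 0ℤ
wind-self b0     = ≡.refl
wind-self b1     = ≡.refl
wind-self b2     = ≡.refl
wind-self (b3 w) = ≡.refl

wind-antisym : ∀ p q → wind q p ≡ ℤ.- wind p q
wind-antisym b0     b0     = ≡.refl
wind-antisym b0     b1     = ≡.refl
wind-antisym b0     b2     = ≡.refl
wind-antisym b0     (b3 w) = ≡.sym (ℤₚ.neg-involutive w)
wind-antisym b1     b0     = ≡.refl
wind-antisym b1     b1     = ≡.refl
wind-antisym b1     b2     = ≡.refl
wind-antisym b1     (b3 w) = ≡.refl
wind-antisym b2     b0     = ≡.refl
wind-antisym b2     b1     = ≡.refl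
wind-antisym b2     b2     = ≡.refl
wind-antisym b2     (b3 w) = ≡.refl
wind-antisym (b3 w) b0     = ≡.refl
wind-antisym (b3 w) b1     = ≡.refl
wind-antisym (b3 w) b2     = ≡.refl
wind-antisym (b3 w) (b3 _) = ≡.refl

wind-b1ˡ : ∀ q → wind b1 q ≡ 0ℤ
wind-b1ˡ b0     = ≡.refl
wind-b1ˡ b1     = ≡.refl
wind-b1ˡ b2     = ≡.refl
wind-b1ˡ (b3 _) = ≡.refl

wind-b1ʳ : ∀ q → wind q b1 ≡ 0ℤ
wind-b1ʳ b0     = ≡.refl
wind-b1ʳ b1     = ≡.refl
wind-b1ʳ b2     = ≡.refl
wind-b1ʳ (b3 _) = ≡.refl

-- The bouquet is bipartite, so of three pairwise adjacent vertices two coincide; each clause treats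
-- one pair, and no further case exists.
wind-cocycle : ∀ {p q r} → p ⌢ q → p ⌢ r → q ⌢ r → wind p q ℤ.+ wind q r ≡ wind p r
wind-cocycle {p} {q} {r} ⌢-refl _ _ = ≡.trans (cong (ℤ._+ wind p r) (wind-self p)) (ℤₚ.+-identityˡ _)
wind-cocycle {p} {q} {r} _ ⌢-refl _ =
  ≡.trans (cong (λ z → wind p q ℤ.+ z) (wind-antisym p q)) (≡.trans (ℤₚ.+-inverseʳ (wind p q)) (≡.sym (wind-self p)))
wind-cocycle {p} {q} {r} _ _ ⌢-refl = ≡.trans (cong (λ z → wind p q ℤ.+ z) (wind-self q)) (ℤₚ.+-identityʳ _)

-- The vertices p = 0, 0 < p < ℓ and p = ℓ of a gadget go to P, R and T. A step in P or R counts weighted crossings in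
-- the bouquet, a step in T counts crossings of y with weight X, and the potential u is the difference of the two.
data Target : Set where
  P : Bouquet → Target
  R : Bouquet → ℤ → Bouquet → ℤ → Target
  T : ℤ → Bouquet → Target

-- The equation in `rr` says that the two countings differ by the coboundary of the potential;
-- triangles with two vertices in `R` and one in `T` depend on it. Nothing joins `P` to `T`, where
-- no comparison would be available.
data _⇌_ : Target → Target → Set where
  pp : ∀ {p q} → p ⌢ q → P p ⇌ P q
  pr : ∀ {p q X y u} → p ⌢ q → P p ⇌ R q X y u
  rp : ∀ {p q X y u} → p ⌢ q → R p X y u ⇌ P q
  rr : ∀ {p q X y y′ u u′} → p ⌢ q → y ⌢ y′ → wind p q ≡ X ℤ.* wind y y′ ℤ.+ (u′ ℤ.- u) →
       R p X y u ⇌ R q X y′ u′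
  rt : ∀ {p X y y′ u} → y ⌢ y′ → R p X y u ⇌ T X y′
  tr : ∀ {p X y y′ u} → y ⌢ y′ → T X y ⇌ R p X y′ u
  tt : ∀ {X y y′} → y ⌢ y′ → T X y ⇌ T X y′

flow : Target → Target → ℤ
flow (P p)       (P q)        = wind p q
flow (P p)       (R q X y u)  = wind p q
flow (R p X y u) (P q)        = wind p q
flow (R p X y u) (R q _ _ _)  = wind p q
flow (R p X y u) (T _ y′)     = X ℤ.* wind y y′ ℤ.- u
flow (T X y)     (R q _ y′ u) = X ℤ.* wind y y′ ℤ.+ u
flow (T X y)     (T _ y′)     = X ℤ.* wind y y′
-- A default on non-adjacent pairs; with the value 0, basepoints of any two kinds have no flow
-- between them.
flow (P _)       (T _ _)      = 0ℤ
flow (T _ _)     (P _)        = 0ℤ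

⇌-refl : ∀ {a} → a ⇌ a
⇌-refl {P p}       = pp ⌢-refl
⇌-refl {R p X y u} = rr ⌢-refl ⌢-refl (≡.trans (wind-self p)
  (≡.trans (solve 2 (λ X u → con 0ℤ := X :* con 0ℤ :+ (u :- u)) ≡.refl X u)
    (cong (λ z → X ℤ.* z ℤ.+ (u ℤ.- u)) (≡.sym (wind-self y)))))
⇌-refl {T X y}     = tt ⌢-refl

⇌-sym : ∀ {a b} → a ⇌ b → b ⇌ a
⇌-sym (pp c) = pp (⌢-sym c)
⇌-sym (pr c) = rp (⌢-sym c)
⇌-sym (rp c) = pr (⌢-sym c)
⇌-sym (rr {p} {q} {X} {y} {y′} {u} {u′} c d eq) = rr (⌢-sym c) (⌢-sym d) (begin
  wind q p                                       ≡⟨ wind-antisym p q ⟩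
  ℤ.- wind p q                                   ≡⟨ cong ℤ.-_ eq ⟩
  ℤ.- (X ℤ.* wind y y′ ℤ.+ (u′ ℤ.- u))
    ≡⟨ solve 4 (λ X w u u′ → :- (X :* w :+ (u′ :- u)) := X :* (:- w) :+ (u :- u′)) ≡.refl X (wind y y′) u u′ ⟩
  X ℤ.* (ℤ.- wind y y′) ℤ.+ (u ℤ.- u′)           ≡⟨ cong (λ z → X ℤ.* z ℤ.+ (u ℤ.- u′)) (wind-antisym y y′) ⟨
  X ℤ.* wind y′ y ℤ.+ (u ℤ.- u′)                 ∎)
  where open ≡.≡-Reasoning
⇌-sym (rt c) = tr (⌢-sym c)
⇌-sym (tr c) = rt (⌢-sym c)
⇌-sym (tt c) = tt (⌢-sym c)

-- A triangle lies in `P` and `R`, where only the first bouquet is counted, or in `R` and `T`, where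
-- the equations of `rr` turn everything into `X` times the identity for `y` and the potentials
-- cancel.
flow-cocycle : ∀ {a b c} → a ⇌ b → a ⇌ c → b ⇌ c → flow a b ℤ.+ flow b c ≡ flow a c
flow-cocycle (pp p) (pp q) (pp r) = wind-cocycle p q r
flow-cocycle (pp p) (pr q) (pr r) = wind-cocycle p q r
flow-cocycle (pr p) (pp q) (rp r) = wind-cocycle p q r
flow-cocycle (pr p) (pr q) (rr r _ _) = wind-cocycle p q r
flow-cocycle (rp p) (rp q) (pp r) = wind-cocycle p q r
flow-cocycle (rp p) (rr q _ _) (pr r) = wind-cocycle p q r
flow-cocycle (rr p _ _) (rp q) (rp r) = wind-cocycle p q r
flow-cocycle (rr p _ _) (rr q _ _) (rr r _ _) = wind-cocycle p q r
flow-cocycle (rr {X = X} {y} {y′} {u} {u′} p c eq) (rt {y′ = z} d) (rt e)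
  rewrite eq | ≡.sym (wind-cocycle c d e) =
  solve 5 (λ X a b u u′ → (X :* a :+ (u′ :- u)) :+ (X :* b :- u′) := X :* (a :+ b) :- u) ≡.refl
    X (wind y y′) (wind y′ z) u u′
flow-cocycle (rt {X = X} {y} {z} {u} c) (rr {y′ = y′} {u′ = u′} p d eq) (tr e)
  rewrite eq | ≡.sym (wind-cocycle c d e) =
  solve 5 (λ X a b u u′ → (X :* a :- u) :+ (X :* b :+ u′) := X :* (a :+ b) :+ (u′ :- u)) ≡.refl
    X (wind y z) (wind z y′) u u′
flow-cocycle (rt {X = X} {y} {z} {u} c) (rt {y′ = z′} d) (tt e)
  rewrite ≡.sym (wind-cocycle c d e) =
  solve 4 (λ X a b u → (X :* a :- u) :+ X :* b := X :* (a :+ b) :- u) ≡.refl X (wind y z) (wind z z′) u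
flow-cocycle (tr {X = X} {z} {y} {u} c) (tr {y′ = y′} {u = u′} d) (rr p e eq)
  rewrite eq | ≡.sym (wind-cocycle c d e) =
  solve 5 (λ X a b u u′ → (X :* a :+ u) :+ (X :* b :+ (u′ :- u)) := X :* (a :+ b) :+ u′) ≡.refl
    X (wind z y) (wind y y′) u u′
flow-cocycle (tr {X = X} {z} {y} {u} c) (tt {y′ = z′} d) (rt e)
  rewrite ≡.sym (wind-cocycle c d e) =
  solve 4 (λ X a b u → (X :* a :+ u) :+ (X :* b :- u) := X :* (a :+ b)) ≡.refl X (wind z y) (wind y z′) u
flow-cocycle (tt {X = X} {z} {z′} c) (tr {y′ = y} {u = u} d) (tr e)
  rewrite ≡.sym (wind-cocycle c d e) =
  solve 4 (λ X a b u → X :* a :+ (X :* b :+ u) := X :* (a :+ b) :+ u) ≡.refl X (wind z z′) (wind z′ y) u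
flow-cocycle (tt {X = X} {z} {z′} c) (tt {y′ = z″} d) (tt e)
  rewrite ≡.sym (wind-cocycle c d e) = ≡.sym (ℤₚ.*-distribˡ-+ X (wind z z′) (wind z′ z″))

-- The images of the vertices of `T*`. Since there is no flow between any two of them, the winding
-- cocycles vanish on every walk in `T*`, in particular on the loops.
data Basepoint : Target → Set where
  at-P : Basepoint (P b0)
  at-R : ∀ {X} → Basepoint (R b0 X b0 0ℤ)
  at-T : ∀ {X} → Basepoint (T X b0)

flow-basepoint : ∀ {a b} → Basepoint a → Basepoint b → flow a b ≡ 0ℤ
flow-basepoint at-P     at-P = ≡.refl
flow-basepoint at-P     at-R = ≡.refl
flow-basepoint at-P     at-T = ≡.refl
flow-basepoint at-R     at-P = ≡.refl
flow-basepoint at-R     at-R = ≡.refl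
flow-basepoint (at-R {X}) at-T = cong (ℤ._- 0ℤ) (ℤₚ.*-zeroʳ X)
flow-basepoint at-T     at-P = ≡.refl
flow-basepoint (at-T {X}) at-R = cong (ℤ._+ 0ℤ) (ℤₚ.*-zeroʳ X)
flow-basepoint (at-T {X}) at-T = ℤₚ.*-zeroʳ X

-- Block and offset of a position

div-unique : ∀ e {j d} .{{_ : NonZero d}} → j < d → (e * d + j) / d ≡ e
div-unique e {j} {d} j<d = ≡.trans (+-distrib-/-∣ˡ j (n∣m*n e))
  (≡.trans (cong₂ _+_ (m*n/n≡m e d) (m<n⇒m/n≡0 j<d)) (ℕₚ.+-identityʳ e))

mod-unique : ∀ e {j d} .{{_ : NonZero d}} → j < d → (e * d + j) % d ≡ j
mod-unique e {j} {d} j<d = ≡.trans (cong (_% d) (ℕₚ.+-comm (e * d) j))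
  (≡.trans ([m+kn]%n≡m%n j e d) (m<n⇒m%n≡m j<d))

data DigitSuc (d b : ℕ) .{{_ : NonZero d}} : Set where
  same  : suc (b % d) < d → suc b / d ≡ b / d → suc b % d ≡ suc (b % d) → DigitSuc d b
  carry : suc (b % d) ≡ d → suc b / d ≡ suc (b / d) → suc b % d ≡ 0 → DigitSuc d b

digitSuc : ∀ d b .{{_ : NonZero d}} → DigitSuc d b
digitSuc d b with ℕₚ.m≤n⇒m<n∨m≡n (m%n<n b d)
... | inj₁ lt = same lt (≡.trans (cong (_/ d) eq) (div-unique (b / d) lt)) (≡.trans (cong (_% d) eq) (mod-unique (b / d) lt))
  where
  eq : suc b ≡ (b / d) * d + suc (b % d)
  eq = ≡.trans (cong suc (≡.trans (m≡m%n+[m/n]*n b d) (ℕₚ.+-comm (b % d) _))) (≡.sym (ℕₚ.+-suc _ _))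
... | inj₂ full = carry full (≡.trans (cong (_/ d) eq) (div-unique (suc (b / d)) 0<d))
                             (≡.trans (cong (_% d) eq) (mod-unique (suc (b / d)) 0<d))
  where
  0<d = ℕ.>-nonZero⁻¹ d
  eq : suc b ≡ suc (b / d) * d + 0
  eq = ≡.trans (cong suc (m≡m%n+[m/n]*n b d)) (≡.trans (cong (_+ (b / d) * d) full) (≡.sym (ℕₚ.+-identityʳ _)))

-- Wrapping a cycle of length `g` around a four-cycle

module Label (g : ℕ) (4≤g : 4 ≤ g) where

  -- The labels 0, 1 and `g - 1` keep vertices of their own and 2 to `g - 2` collapse to `b2`, a
  -- nonempty range since `4 ≤ g`. Label `g` goes to `b0`, like 0.
  lab : ℤ → ℕ → Bouquet
  lab w zero          = b0
  lab w (suc zero)    = b1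
  lab w (suc (suc j)) with ℕₚ.<-cmp (3 + j) g
  ... | tri< _ _ _ = b2
  ... | tri≈ _ _ _ = b3 w
  ... | tri> _ _ _ = b0

  -- For `j ≤ g` this is the crossing count of the walk from 0 to `j`: only the step into `g`
  -- crosses.
  lap : ℤ → ℕ → ℤ
  lap w j with j ℕₚ.≟ g
  ... | yes _ = w
  ... | no  _ = 0ℤ

  lap-< : ∀ w {j} → j < g → lap w j ≡ 0ℤ
  lap-< w {j} j<g with j ℕₚ.≟ g
  ... | yes j≡g = ⊥-elim (ℕₚ.<⇒≢ j<g j≡g)
  ... | no  _   = ≡.refl

  lap-g : ∀ w → lap w g ≡ w
  lap-g w with g ℕₚ.≟ g
  ... | yes _   = ≡.refl
  ... | no  g≢g = ⊥-elim (g≢g ≡.refl)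

  lab-g : ∀ w {j} → j ≡ g → lab w j ≡ b0
  lab-g w {zero}        _   = ≡.refl
  lab-g w {suc zero}    eq  = ⊥-elim (ℕₚ.<⇒≢ (ℕₚ.≤-trans (s≤s (s≤s z≤n)) 4≤g) eq)
  lab-g w {suc (suc j)} eq with ℕₚ.<-cmp (3 + j) g
  ... | tri< lt _ _ = ⊥-elim (ℕₚ.<-asym lt (ℕₚ.≤-reflexive (cong suc (≡.sym eq))))
  ... | tri≈ _ e _  = ⊥-elim (ℕₚ.1+n≢n (≡.trans e (≡.sym eq)))
  ... | tri> _ _ _  = ≡.refl

  lab-step : ∀ w j → j < g → (lab w j ⌢ lab w (suc j)) × (wind (lab w j) (lab w (suc j)) ≡ lap w (suc j))
  lab-step w zero _ = e01 , ≡.sym (lap-< w (ℕₚ.≤-trans (s≤s (s≤s z≤n)) 4≤g))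
  lab-step w (suc zero) _ with ℕₚ.<-cmp 3 g
  ... | tri< _ _ _ = e12 , ≡.sym (lap-< w (ℕₚ.<⇒≤ 4≤g))
  ... | tri≈ n _ _ = ⊥-elim (n 4≤g)
  ... | tri> n _ _ = ⊥-elim (n 4≤g)
  lab-step w (suc (suc j)) j<g with ℕₚ.<-cmp (3 + j) g
  ... | tri> _ _ gt = ⊥-elim (ℕₚ.<⇒≱ gt j<g)
  ... | tri≈ _ eq _ rewrite lab-g w {3 + j} eq = e30 , ≡.sym (≡.trans (cong (lap w) eq) (lap-g w))
  ... | tri< lt _ _ with ℕₚ.<-cmp (4 + j) g
  ...   | tri< _ _ _  = ⌢-refl , ≡.sym (lap-< w lt)
  ...   | tri≈ _ _ _  = e23 , ≡.sym (lap-< w lt)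
  ...   | tri> _ _ gt = ⊥-elim (ℕₚ.<⇒≱ gt lt)

  end : Bool → ℤ → ℕ → Bouquet
  end f w j = lab w (relabel g f j)

  -- The crossing count along `end`. The reversed cycle makes its crossing in the first step, from
  -- `b0` to `b3 w`, and in the negative direction; so the count is `- w` from 1 on.
  lift : Bool → ℤ → ℕ → ℤ
  lift false w j       = lap w j
  lift true  w zero    = 0ℤ
  lift true  w (suc j) = ℤ.- w

  lift-0 : ∀ f w → lift f w 0 ≡ 0ℤ
  lift-0 false w = lap-< w (ℕₚ.≤-trans (s≤s z≤n) 4≤g)
  lift-0 true  w = ≡.refl

  end-0 : ∀ f w → end f w 0 ≡ b0
  end-0 false w = ≡.refl
  end-0 true  w = lab-g w ≡.refl

  end-g : ∀ f w → end f w g ≡ b0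
  end-g false w = lab-g w ≡.refl
  end-g true  w = cong (lab w) (ℕₚ.n∸n≡0 g)

  end-step : ∀ f w j → j < g →
    (end f w j ⌢ end f w (suc j)) × (wind (end f w j) (end f w (suc j)) ≡ lift f w (suc j) ℤ.- lift f w j)
  end-step false w j j<g = proj₁ (lab-step w j j<g) ,
    ≡.trans (proj₂ (lab-step w j j<g)) (≡.sym (≡.trans (cong (λ z → lap w (suc j) ℤ.- z) (lap-< w j<g)) (ℤₚ.+-identityʳ _)))
  end-step true w j j<g = ≡.subst (λ i → lab w i ⌢ lab w k) (≡.sym k+) (⌢-sym (proj₁ step)) , (begin
    wind (lab w (g ∸ j)) (lab w k)  ≡⟨ cong (λ i → wind (lab w i) (lab w k)) k+ ⟩
    wind (lab w (suc k)) (lab w k)  ≡⟨ wind-antisym (lab w k) (lab w (suc k)) ⟩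
    ℤ.- wind (lab w k) (lab w (suc k)) ≡⟨ cong ℤ.-_ (proj₂ step) ⟩
    ℤ.- lap w (suc k)               ≡⟨ cong (λ i → ℤ.- lap w i) k+ ⟨
    ℤ.- lap w (g ∸ j)               ≡⟨ rest j j<g ⟩
    ℤ.- w ℤ.- lift true w j         ∎)
    where
    open ≡.≡-Reasoning
    k = g ∸ suc j
    k+ : g ∸ j ≡ suc k
    k+ = ℕₚ.+-∸-assoc 1 j<g
    step = lab-step w k (ℕₚ.∸-monoʳ-< {g} {suc j} {0} z<s j<g)
    rest : ∀ j → j < g → ℤ.- lap w (g ∸ j) ≡ ℤ.- w ℤ.- lift true w j
    rest zero    _   = ≡.trans (cong ℤ.-_ (lap-g w)) (≡.sym (ℤₚ.+-identityʳ _))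
    rest (suc i) i<g = ≡.trans (cong ℤ.-_ (lap-< w (ℕₚ.∸-monoʳ-< {g} {suc i} {0} z<s (ℕₚ.<⇒≤ i<g))))
      (≡.sym (ℤₚ.+-inverseʳ (ℤ.- w)))

-- The two countings inside a gadget

data Layer : Set where
  bottom middle top : Layer

-- Weights and orientations of the ends are functions on `ℕ`, because the block number reaches `s`
-- at the position `s * g` that closes the cycle.
module Cut (g s ℓ : ℕ) .{{_ : NonZero g}} .{{s≢0 : NonZero s}} (4≤g : 4 ≤ g) (2≤ℓ : 2 ≤ ℓ)
           (wt : ℕ → ℤ) (fl : ℕ → Bool) where
  open Label g 4≤g

  total : ℕ → ℤ
  total zero    = 0ℤ
  total (suc i) = total i ℤ.+ lift (fl i) (wt i) g

  X : ℤ
  X = total s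

  -- The weight of the cuts of the cycle B between 0 and b.
  u : ℕ → ℤ
  u b = total (b / g) ℤ.+ lift (fl (b / g)) (wt (b / g)) (b % g)

  bq : ℕ → Bouquet
  bq b = end (fl (b / g)) (wt (b / g)) (b % g)

  -- The map `β` of the sum gadget followed by the wrapping of `Z`, with weight one; the actual
  -- weight enters as the factor `X` in `flow`.
  β : ℕ → Bouquet
  β b = lab 1ℤ (b / s)

  bq-step : ∀ b → (bq b ⌢ bq (suc b)) × (wind (bq b) (bq (suc b)) ≡ u (suc b) ℤ.- u b)
  bq-step b with digitSuc g b | end-step (fl (b / g)) (wt (b / g)) (b % g) (m%n<n b g)
  ... | same lt q r  | c , eq rewrite q | r = c , ≡.trans eq
          (solve 3 (λ t a b → a :- b := (t :+ a) :- (t :+ b)) ≡.refl (total (b / g)) _ _)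
  -- At the end of a block the walk is at `b0`, from which the next block starts; the count of the
  -- block moves from `lift` into `total`.
  ... | carry full q r | c , eq
    rewrite q | r | full | end-0 (fl (suc (b / g))) (wt (suc (b / g))) | end-g (fl (b / g)) (wt (b / g))
          | lift-0 (fl (suc (b / g))) (wt (suc (b / g))) = c , ≡.trans eq
          (solve 3 (λ t a b → a :- b := ((t :+ a) :+ con 0ℤ) :- (t :+ b)) ≡.refl (total (b / g)) _ _)

  β-step : ∀ b → b / s < g → (β b ⌢ β (suc b)) × (wind (β b) (β (suc b)) ≡ lap 1ℤ (suc b / s))
  β-step b lt with digitSuc s b
  ... | same _ q _  rewrite q = ⌢-refl , ≡.trans (wind-self (β b)) (≡.sym (lap-< 1ℤ lt))
  ... | carry _ q _ rewrite q = lab-step 1ℤ (b / s) lt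

  record Next (b b′ : ℕ) : Set where
    field
      bq-adj : bq b ⌢ bq b′
      β-adj  : β b ⌢ β b′
      potential : wind (bq b) (bq b′) ≡ X ℤ.* wind (β b) (β b′) ℤ.+ (u b′ ℤ.- u b)
  open Next

  bq-block : ∀ i → bq (i * g) ≡ b0
  bq-block i = ≡.subst (λ b → bq b ≡ b0) (ℕₚ.+-identityʳ (i * g)) (≡.trans
    (cong₂ (λ e j → end (fl e) (wt e) j) (div-unique i 0<g) (mod-unique i 0<g)) (end-0 (fl i) (wt i)))
    where 0<g = ℕ.>-nonZero⁻¹ g

  u-block : ∀ i → u (i * g) ≡ total i
  u-block i = ≡.subst (λ b → u b ≡ total i) (ℕₚ.+-identityʳ (i * g)) (≡.trans
    (cong₂ (λ e j → total e ℤ.+ lift (fl e) (wt e) j) (div-unique i 0<g) (mod-unique i 0<g))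
    (≡.trans (cong (λ z → total i ℤ.+ z) (lift-0 (fl i) (wt i))) (ℤₚ.+-identityʳ _)))
    where 0<g = ℕ.>-nonZero⁻¹ g

  period/s : (s * g) / s ≡ g
  period/s = ≡.trans (cong (_/ s) (≡.trans (ℕₚ.*-comm s g) (≡.sym (ℕₚ.+-identityʳ _)))) (div-unique g (ℕ.>-nonZero⁻¹ s))

  block/s : ∀ {b} → b < s * g → b / s < g
  block/s {b} b< = m<n*o⇒m/o<n (≡.subst (b <_) (ℕₚ.*-comm s g) b<)

  next : ∀ b → suc b < s * g → Next b (suc b)
  next b sb< = record
    { bq-adj = proj₁ (bq-step b)
    ; β-adj = proj₁ βs
    ; potential = ≡.trans (proj₂ (bq-step b)) (≡.sym (≡.trans
        (cong (λ z → X ℤ.* z ℤ.+ (u (suc b) ℤ.- u b)) (≡.trans (proj₂ βs) (lap-< 1ℤ (block/s sb<))))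
        (≡.trans (cong (ℤ._+ (u (suc b) ℤ.- u b)) (ℤₚ.*-zeroʳ X)) (ℤₚ.+-identityˡ _)))) }
    where βs = β-step b (block/s (ℕₚ.<⇒≤ sb<))

  bq-0 : bq 0 ≡ b0
  bq-0 = bq-block 0

  u-0 : u 0 ≡ 0ℤ
  u-0 = u-block 0

  β-0 : β 0 ≡ b0
  β-0 = cong (lab 1ℤ) (m<n⇒m/n≡0 (ℕ.>-nonZero⁻¹ s))

  β-period : β (s * g) ≡ b0
  β-period = lab-g 1ℤ period/s

  -- Here `u` falls from `X` back to 0, and the single crossing of `Z`, taken `X` times, makes up
  -- for it. The potential closes up because both cycles have the same total weight.
  wrap : ∀ b → suc b ≡ s * g → Next b 0
  wrap b eq = record
    { bq-adj = ≡.subst (bq b ⌢_) bq≡ (proj₁ (bq-step b))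
    ; β-adj = ≡.subst (β b ⌢_) β≡ (proj₁ βs)
    ; potential = begin
        wind (bq b) (bq 0)                               ≡⟨ cong (wind (bq b)) bq≡ ⟨
        wind (bq b) (bq (suc b))                         ≡⟨ proj₂ (bq-step b) ⟩
        u (suc b) ℤ.- u b                                ≡⟨ cong (ℤ._- u b) (≡.trans (cong u eq) (u-block s)) ⟩
        X ℤ.- u b
          ≡⟨ solve 2 (λ X u → X :- u := X :* con 1ℤ :+ (con 0ℤ :- u)) ≡.refl X (u b) ⟩
        X ℤ.* 1ℤ ℤ.+ (0ℤ ℤ.- u b)
          ≡⟨ cong₂ (λ w z → X ℤ.* w ℤ.+ (z ℤ.- u b)) wind-β u-0 ⟨
        X ℤ.* wind (β b) (β 0) ℤ.+ (u 0 ℤ.- u b)         ∎ }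
    where
    open ≡.≡-Reasoning
    βs = β-step b (block/s (ℕₚ.≤-reflexive eq))
    bq≡ : bq (suc b) ≡ bq 0
    bq≡ = ≡.trans (cong bq eq) (≡.trans (bq-block s) (≡.sym bq-0))
    β≡ : β (suc b) ≡ β 0
    β≡ = ≡.trans (cong β eq) (≡.trans β-period (≡.sym β-0))
    wind-β : wind (β b) (β 0) ≡ 1ℤ
    wind-β = ≡.trans (cong (wind (β b)) (≡.sym β≡)) (≡.trans (proj₂ βs)
      (≡.trans (cong (λ n → lap 1ℤ (n / s)) eq) (≡.trans (cong (lap 1ℤ) period/s) (lap-g 1ℤ))))

  vert : Layer → ℕ → Target
  vert bottom b = P (bq b)
  vert middle b = R (bq b) X (β b) (u b)
  vert top    b = T X (β b)

  data Adjacent : Layer → Layer → Set where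
    bb : Adjacent bottom bottom
    bm : Adjacent bottom middle
    mb : Adjacent middle bottom
    mm : Adjacent middle middle
    mt : Adjacent middle top
    tm : Adjacent top middle
    tt : Adjacent top top

  Adjacent-sym : ∀ {l l′} → Adjacent l l′ → Adjacent l′ l
  Adjacent-sym bb = bb
  Adjacent-sym bm = mb
  Adjacent-sym mb = bm
  Adjacent-sym mm = mm
  Adjacent-sym mt = tm
  Adjacent-sym tm = mt
  Adjacent-sym tt = tt

  vert-next : ∀ {l l′ b b′} → Adjacent l l′ → Next b b′ → vert l b ⇌ vert l′ b′
  vert-next bb x = pp (bq-adj x)
  vert-next bm x = pr (bq-adj x)
  vert-next mb x = rp (bq-adj x)
  vert-next mm x = rr (bq-adj x) (β-adj x) (potential x)
  vert-next mt x = rt (β-adj x)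
  vert-next tm x = tr (β-adj x)
  vert-next tt x = _⇌_.tt (β-adj x)

  next-refl : ∀ b → Next b b
  next-refl b = record
    { bq-adj = ⌢-refl
    ; β-adj = ⌢-refl
    ; potential = ≡.trans (wind-self (bq b)) (≡.trans
        (solve 2 (λ X u → con 0ℤ := X :* con 0ℤ :+ (u :- u)) ≡.refl X (u b))
        (cong (λ z → X ℤ.* z ℤ.+ (u b ℤ.- u b)) (≡.sym (wind-self (β b))))) }

  vert-adj : ∀ {l l′ b b′} → Adjacent l l′ → b < s * g → b′ < s * g → cycAdjℕ (s * g) b b′ → vert l b ⇌ vert l′ b′
  vert-adj {b = b} a _ _ (inj₁ ≡.refl) = vert-next a (next-refl b)
  vert-adj {b = b} a _ lt (inj₂ (inj₁ ≡.refl)) = vert-next a (next b lt)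
  vert-adj {b′ = b} a lt _ (inj₂ (inj₂ (inj₁ ≡.refl))) = ⇌-sym (vert-next (Adjacent-sym a) (next b lt))
  vert-adj {b = b} a _ _ (inj₂ (inj₂ (inj₂ (inj₁ (eq , ≡.refl))))) = vert-next a (wrap b eq)
  vert-adj {b′ = b} a _ _ (inj₂ (inj₂ (inj₂ (inj₂ (eq , ≡.refl))))) = ⇌-sym (vert-next (Adjacent-sym a) (wrap b eq))

  layer : ℕ → Layer
  layer zero    = bottom
  layer (suc q) with suc q ℕₚ.≟ ℓ
  ... | yes _ = top
  ... | no  _ = middle

  layer-ℓ : ∀ {q} → q ≡ ℓ → layer q ≡ top
  layer-ℓ {zero}  eq = ⊥-elim (ℕₚ.<⇒≢ (ℕₚ.≤-trans (s≤s z≤n) 2≤ℓ) eq)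
  layer-ℓ {suc q} eq with suc q ℕₚ.≟ ℓ
  ... | yes _  = ≡.refl
  ... | no neq = ⊥-elim (neq eq)

  layer-self : ∀ q → Adjacent (layer q) (layer q)
  layer-self zero = bb
  layer-self (suc q) with suc q ℕₚ.≟ ℓ
  ... | yes _ = tt
  ... | no  _ = mm

  layer-next : ∀ q → suc q ≤ ℓ → Adjacent (layer q) (layer (suc q))
  layer-next zero q<ℓ with 1 ℕₚ.≟ ℓ
  -- `2 ≤ ℓ` keeps the bottom slice from being adjacent to the top slice.
  ... | yes eq = ⊥-elim (ℕₚ.<⇒≢ 2≤ℓ eq)
  ... | no  _  = bm
  layer-next (suc q) q<ℓ with suc q ℕₚ.≟ ℓ | suc (suc q) ℕₚ.≟ ℓ
  ... | yes eq | _     = ⊥-elim (ℕₚ.<⇒≢ q<ℓ eq)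
  ... | no _   | yes _ = mt
  ... | no _   | no _  = mm

  layer-adj : ∀ {q q′} → q ≤ ℓ → q′ ≤ ℓ → pathAdjℕ q q′ → Adjacent (layer q) (layer q′)
  layer-adj {q}      _ _ (inj₁ ≡.refl)        = layer-self q
  layer-adj {q}      _ l (inj₂ (inj₁ ≡.refl)) = layer-next q l
  layer-adj {q′ = q} l _ (inj₂ (inj₂ ≡.refl)) = Adjacent-sym (layer-next q l)

  circle : ℕ → ℕ → Bouquet
  circle i = end (fl i) (wt i)

  circle-wrap : ∀ i j → suc j ≡ g → circle i j ⌢ circle i 0
  circle-wrap i j eq = ≡.subst (circle i j ⌢_)
    (≡.trans (cong (circle i) eq) (≡.trans (end-g (fl i) (wt i)) (≡.sym (end-0 (fl i) (wt i)))))
    (proj₁ (end-step (fl i) (wt i) j (ℕₚ.≤-reflexive eq)))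

  circle-adj : ∀ i {j j′} → j < g → j′ < g → cycAdjℕ g j j′ → circle i j ⌢ circle i j′
  circle-adj i _  _  (inj₁ ≡.refl)                = ⌢-refl
  circle-adj i lt _  (inj₂ (inj₁ ≡.refl))         = proj₁ (end-step (fl i) (wt i) _ lt)
  circle-adj i _  lt (inj₂ (inj₂ (inj₁ ≡.refl)))  = ⌢-sym (proj₁ (end-step (fl i) (wt i) _ lt))
  circle-adj i {j}      _ _ (inj₂ (inj₂ (inj₂ (inj₁ (eq , ≡.refl))))) = circle-wrap i j eq
  circle-adj i {j′ = j} _ _ (inj₂ (inj₂ (inj₂ (inj₂ (eq , ≡.refl))))) = ⌢-sym (circle-wrap i j eq)

  -- Both rims of a cylinder go to the circle of its end cycle, which is also the image of the block
  -- of the bottom slice glued to it.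
  cut : SRaw g s ℓ → Target
  cut (prod p b)  = vert (layer (toℕ p)) (toℕ b)
  cut (cyl i t j) = P (circle (toℕ i) (toℕ j))

  cut-edge : ∀ {r r′} → SEdge r r′ → cut r ⇌ cut r′
  cut-edge {prod p b}  {prod p′ b′}   (pp′ , bb′)    = vert-adj
    (layer-adj (ℕₚ.≤-pred (Finₚ.toℕ<n p)) (ℕₚ.≤-pred (Finₚ.toℕ<n p′)) pp′) (Finₚ.toℕ<n b) (Finₚ.toℕ<n b′) bb′
  cut-edge {cyl i t j} {cyl .i t′ j′} (≡.refl , jj′) =
    pp (circle-adj (toℕ i) (Finₚ.toℕ<n j) (Finₚ.toℕ<n j′) jj′)

  cut-top : ∀ {p b} j i → toℕ p ≡ ℓ → i < s → toℕ b ≡ j * s + i → cut (prod p b) ≡ T X (lab 1ℤ j)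
  cut-top j i pℓ i<s eq = ≡.trans (cong₂ vert (layer-ℓ pℓ) eq) (cong (λ n → T X (lab 1ℤ n)) (div-unique j i<s))

  cut-bottom : ∀ {p b} i → toℕ p ≡ 0 → toℕ b ≡ i * g → cut (prod p b) ≡ P b0
  cut-bottom i p0 eq = ≡.trans (cong₂ (λ q c → vert (layer q) c) p0 eq) (cong P (bq-block i))

  cut-ident : ∀ {r r′} → SIdent r r′ → cut r ≡ cut r′
  cut-ident {prod p b} {prod p′ b′} (inj₁ (pℓ , p′ℓ , j , i , i′ , i<s , i′<s , eq , eq′)) =
    ≡.trans (cut-top {p} {b} j i pℓ i<s eq) (≡.sym (cut-top {p′} {b′} j i′ p′ℓ i′<s eq′))
  cut-ident {prod p b} {prod p′ b′} (inj₂ (p0 , p′0 , i , i′ , eq , eq′)) =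
    ≡.trans (cut-bottom {p} {b} i p0 eq) (≡.sym (cut-bottom {p′} {b′} i′ p′0 eq′))
  cut-ident {cyl i t j} {prod p b} (_ , p0 , eq) = ≡.sym (≡.trans
    (cong₂ (λ q c → vert (layer q) c) p0 eq)
    (cong₂ (λ e l → P (circle e l)) (div-unique (toℕ i) (Finₚ.toℕ<n j)) (mod-unique (toℕ i) (Finₚ.toℕ<n j))))

  cut-basepoint : ∀ p b → toℕ b ≡ 0 → Basepoint (cut (prod p b))
  cut-basepoint p b b0≡ = ≡.subst (λ c → Basepoint (vert (layer (toℕ p)) c)) (≡.sym b0≡) (go (layer (toℕ p)))
    where
    go : ∀ l → Basepoint (vert l 0)
    go bottom = ≡.subst (λ q → Basepoint (P q)) (≡.sym bq-0) at-P
    go middle = ≡.subst₂ (λ q y → Basepoint (R q X y (u 0))) (≡.sym bq-0) (≡.sym β-0)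
      (≡.subst (λ z → Basepoint (R b0 X b0 z)) (≡.sym u-0) at-R)
    go top    = ≡.subst (λ y → Basepoint (T X y)) (≡.sym β-0) at-T

-- The basis and its dual cocycles

tabulate-applyUpTo : ∀ {A : Set} n (h : ℕ → A) → tabulate {n = n} (λ i → h (toℕ i)) ≡ applyUpTo h n
tabulate-applyUpTo zero    h = ≡.refl
tabulate-applyUpTo (suc n) h = cong (h 0 ∷_) (tabulate-applyUpTo n (λ j → h (suc j)))

closeList-applyUpTo : ∀ {A : Set} m .{{_ : NonZero m}} (f : Fin m → A) →
  closeList (map f (allFin m)) ≡ applyUpTo (λ j → f (j mod m)) (suc m)
closeList-applyUpTo m@(suc _) f = begin
  closeList (map f (allFin m))                       ≡⟨ cong closeList (Listₚ.map-tabulate {n = m} (λ i → i) f) ⟩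
  closeList (tabulate f)
    ≡⟨ cong closeList (Listₚ.tabulate-cong {n = m} (λ i → cong f (≡.sym (mod-toℕ i)))) ⟩
  closeList (tabulate {n = m} (λ i → h (toℕ i)))             ≡⟨ cong closeList (tabulate-applyUpTo m h) ⟩
  applyUpTo h m ++ h 0 ∷ []                          ≡⟨ cong (λ a → applyUpTo h m ++ a ∷ []) (cong f (n-mod-n m)) ⟨
  applyUpTo h m ++ h m ∷ []                          ≡⟨ Listₚ.applyUpTo-∷ʳ h m ⟩
  applyUpTo h (suc m)                                ∎
  where
  open ≡.≡-Reasoning
  h : ℕ → _
  h j = f (j mod m)

infix 4 _≟ᴾ_
_≟ᴾ_ : DecidableEquality P3
p01 ≟ᴾ p01 = yes ≡.refl
p01 ≟ᴾ p02 = no λ ()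
p01 ≟ᴾ p12 = no λ ()
p02 ≟ᴾ p01 = no λ ()
p02 ≟ᴾ p02 = yes ≡.refl
p02 ≟ᴾ p12 = no λ ()
p12 ≟ᴾ p01 = no λ ()
p12 ≟ᴾ p02 = no λ ()
p12 ≟ᴾ p12 = yes ≡.refl

EdgeIx-≡ : ∀ {G} {d e : EdgeIx G} → EdgeIx.eu d ≡ EdgeIx.eu e → EdgeIx.ev d ≡ EdgeIx.ev e → d ≡ e
EdgeIx-≡ {d = record { e-lt = p ; e-adj = q }} {record { e-lt = p′ ; e-adj = q′ }} ≡.refl ≡.refl
  rewrite ℕₚ.<-irrelevant p p′ | Decidable⇒UIP.≡-irrelevant Boolₚ._≟_ q q′ = ≡.refl

infix 4 _≟ᴱ_
_≟ᴱ_ : ∀ {G} → DecidableEquality (EdgeIx G)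
d ≟ᴱ e with EdgeIx.eu d Finₚ.≟ EdgeIx.eu e | EdgeIx.ev d Finₚ.≟ EdgeIx.ev e
... | yes p | yes q = yes (EdgeIx-≡ p q)
... | no ¬p | _     = no λ eq → ¬p (cong EdgeIx.eu eq)
... | yes _ | no ¬q = no λ eq → ¬q (cong EdgeIx.ev eq)

module _ {V : Set} {A : AbelianGroup 0ℓ 0ℓ} where
  open AbelianGroup A
  along-ε : ∀ {e : V → V → Carrier} {Q : V → Set} → (∀ {a b} → Q a → Q b → e a b ≈ ε) →
    ∀ {xs} → All Q xs → along A e xs ≈ ε
  along-ε z []            = refl
  along-ε z (_ ∷ [])      = refl
  along-ε z (p ∷ q ∷ ps)  = trans (∙-cong (z p q) (along-ε z (q ∷ ps))) (identityˡ ε)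

module SharpCycles (G : IGraph) (g ℓ₂ ℓ₃ : ℕ) .{{_ : NonZero g}} where
  open IGraph G using (n)
  open EdgeIx
  open SharpGraph G g ℓ₂ ℓ₃

  gcWalk-slice : ∀ k p → gcWalk (k , slice p) ≡ applyUpTo (K.slice-at k p) (suc (sOf k * g))
  gcWalk-slice k p = ≡.trans (cong (map (embed k)) (closeList-applyUpTo (sOf k * g) {{sg≢0 k}} (prod p)))
    (Listₚ.map-applyUpTo (λ j → prod p (_mod_ j (sOf k * g) {{sg≢0 k}})) (embed k) (suc (sOf k * g)))

  gcWalk-acyc : ∀ k i → gcWalk (k , acyc i) ≡ applyUpTo (K.cyl-at k i (fsuc fzero)) (suc g)
  gcWalk-acyc k i = ≡.trans (cong (map (embed k)) (closeList-applyUpTo g (cyl i (fsuc fzero))))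
    (Listₚ.map-applyUpTo (λ j → cyl i (fsuc fzero) (j mod g)) (embed k) (suc g))

  gcWalk-closed : ∀ c → Hom.ClosedWalk G# (gcWalk c)
  gcWalk-closed (k , slice p) = ≡.subst (Hom.ClosedWalk G#) (≡.sym (gcWalk-slice k p))
    (closedWalk-applyUpTo G# (K.slice-at k p) (sOf k * g)
      (Ladder.rail₁ (K.slice-ladder k {p} {p} (inj₁ ≡.refl)))
      (≡.subst (_≈# K.slice-at k p 0) (≡.sym (K.slice-period k p)) ≈-refl))
  gcWalk-closed (k , acyc i) = ≡.subst (Hom.ClosedWalk G#) (≡.sym (gcWalk-acyc k i))
    (closedWalk-applyUpTo G# (K.cyl-at k i (fsuc fzero)) g
      (Ladder.rail₁ (K.cyl-ladder k i (fsuc fzero) (fsuc fzero)))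
      (≡.subst (_≈# K.cyl-at k i (fsuc fzero) 0) (≡.sym (K.cyl-period k i (fsuc fzero))) ≈-refl))

  loopT-closed : ∀ x → Hom.ClosedWalk T* (loopT x)
  loopT-closed x = centreT (extra x) , _ , ≡.refl , linked , last≈
    where
    v = proj₁ (headEnd x)
    u = proj₁ (tailEnd x)
    linked = proj₁ (leg-adj (extra x) (head x)) ∷
      (proj₂ (leg-adj (idS v) (proj₂ (headEnd x))) ∷
      linked-up (spineT v) ℓ₃ (K.spine-up (idS v)) (inj₁ (spine-ends v u))
        (linked-down (spineT u) ℓ₃ (K.spine-down (idS u)) (proj₁ (leg-adj (idS u) (proj₂ (tailEnd x))))
          (proj₂ (leg-adj (extra x) (tail x)) ∷ [-])))
    last≈ = ≡.subst (λ a → proj₁ a ≈# centre (extra x)) (≡.sym last≡) ≈-refl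
      where
      last≡ = lastOr-snoc (outerT (headEnd x)) (applyUpTo (spineT v) (suc ℓ₃)) (applyDownFrom (spineT u) (suc ℓ₃))
        (outerT (tailEnd x)) (centreT (extra x))

  module Periods {A : AbelianGroup 0ℓ 0ℓ} (e : Cocycle G# A) where
    open AbelianGroup A
    open Cocycle e
    open Arcs {G#} ≈-refl {A} e
    open SetoidReasoning setoid

    along-acyc : ∀ v i → along A ⟨_,_⟩ (gcWalk (idS v , acyc i)) ≈ arc (A-at (v , i)) g
    along-acyc v i = begin
      along A ⟨_,_⟩ (gcWalk (idS v , acyc i))                ≡⟨ cong (along A ⟨_,_⟩) (gcWalk-acyc (idS v) i) ⟩
      along A ⟨_,_⟩ (applyUpTo (K.cyl-at (idS v) i (fsuc fzero)) (suc g)) ≈⟨ along-applyUpTo _ g ⟩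
      arc (K.cyl-at (idS v) i (fsuc fzero)) g                ≈⟨ arc-cong g (λ j → end-≈ (idS v) i j) ⟩
      arc (A-at (v , i)) g                                   ∎

    top-arc-Z : ∀ v → arc (K.slice-at (idS v) (K.top (idS v))) (3 * g) ≈ arc Z-at g
    top-arc-Z v = begin
      arc (K.slice-at (idS v) (K.top (idS v))) (3 * g) ≡⟨ cong (arc _) (ℕₚ.*-comm 3 g) ⟩
      arc (K.slice-at (idS v) (K.top (idS v))) (g * 3) ≈⟨ K.Values.top-arc (idS v) e g ℕₚ.≤-refl ⟩
      arc (K.top-at (idS v)) g                         ≈⟨ arc-cong g (λ j → top-Z≤ v j) ⟩
      arc Z-at g                                       ∎
      where
      top-Z≤ : ∀ v j → j ≤ g → K.top-at (idS v) j ≈# Z-at j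
      top-Z≤ v j j≤g with ℕₚ.m≤n⇒m<n∨m≡n j≤g
      ... | inj₁ j<g    = top-Z v j j<g
      ... | inj₂ ≡.refl = ≡.subst₂ _≈#_
        (≡.trans (≡.sym (K.slice-period (idS v) _)) (cong (K.slice-at (idS v) _) (ℕₚ.*-comm 3 j)))
        (cong outZ (≡.sym (n-mod-n j))) (top-Z₀ v)

    along-top : ∀ v → along A ⟨_,_⟩ (gcWalk (idS v , slice (K.top (idS v)))) ≈ arc Z-at g
    along-top v = begin
      along A ⟨_,_⟩ (gcWalk (idS v , slice (K.top (idS v))))
        ≡⟨ cong (along A ⟨_,_⟩) (gcWalk-slice (idS v) (K.top (idS v))) ⟩
      along A ⟨_,_⟩ (applyUpTo (K.slice-at (idS v) (K.top (idS v))) (suc (3 * g)))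
        ≈⟨ along-applyUpTo _ (3 * g) ⟩
      arc (K.slice-at (idS v) (K.top (idS v))) (3 * g)
        ≈⟨ top-arc-Z v ⟩
      arc Z-at g ∎

    -- The relation of the copy of `S_3` at `v`, solved for its last term; this is why `A^v_2` can
    -- be left out of the basis.
    third-outer : ∀ v → arc Z-at g ≈ ε → arc (A-at (v , fzero)) g ≈ ε → arc (A-at (v , fsuc fzero)) g ≈ ε →
      arc (A-at (v , fsuc (fsuc fzero))) g ≈ ε
    third-outer v z p q = begin
      a 2F                 ≈⟨ identityˡ _ ⟨
      ε ∙ a 2F             ≈⟨ ∙-congʳ two ⟨
      B 2 ∙ a 2F           ≈⟨ ∙-congˡ (arc-cong g (λ j → end-≈ (idS v) 2F j)) ⟨
      B 2 ∙ arc (K.cyl-at (idS v) 2F (fsuc fzero)) g ≈⟨ bottom-next 2F ⟨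
      B 3                  ≈⟨ slice-arc (K.top (idS v)) ⟨
      arc (K.slice-at (idS v) (K.top (idS v))) (3 * g) ≈⟨ top-arc-Z v ⟩
      arc Z-at g           ≈⟨ z ⟩
      ε                    ∎
      where
      open K.Values (idS v) e using (bottom-next; slice-arc)
      1F 2F : Fin 3
      1F = fsuc fzero
      2F = fsuc (fsuc fzero)
      a : Fin 3 → Carrier
      a i = arc (A-at (v , i)) g
      B : ℕ → Carrier
      B i = arc (K.slice-at (idS v) fzero) (i * g)
      step : ∀ i → B (toℕ i) ≈ ε → a i ≈ ε → B (suc (toℕ i)) ≈ ε
      step i Bi ai = begin
        B (suc (toℕ i)) ≈⟨ bottom-next i ⟩
        B (toℕ i) ∙ arc (K.cyl-at (idS v) i (fsuc fzero)) g
          ≈⟨ ∙-cong Bi (trans (arc-cong g (λ j → end-≈ (idS v) i j)) ai) ⟩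
        ε ∙ ε           ≈⟨ identityˡ ε ⟩
        ε               ∎
      two : B 2 ≈ ε
      two = step 1F (step fzero refl p) q

  -- A homomorphism carries a triangle of `G#` to a triangle of the target, so only the latter need
  -- be understood.
  pull : ∀ {B : Set} {_~ᴮ_ : B → B → Set} (h : V# → B) → (∀ {a b} → a ≈# b → h a ≡ h b) →
    (∀ {a b} → a ≃ b → h a ~ᴮ h b) → (φ : B → B → ℤ) →
    (∀ {p q r} → p ~ᴮ q → p ~ᴮ r → q ~ᴮ r → φ p q ℤ.+ φ q r ≡ φ p r) → Cocycle G# ℤᴳ
  pull h h-resp h-hom φ φ-cocycle = record
    { ⟨_,_⟩ = λ a b → φ (h a) (h b)
    ; resp  = λ p q → cong₂ φ (h-resp p) (h-resp q)
    ; cocyc = λ p q r → φ-cocycle (h-hom p) (h-hom q) (h-hom r) }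

  _≟ˣ_ : DecidableEquality Extra
  _≟ˣ_ = Sumₚ.≡-dec (Productₚ.≡-dec Finₚ._≟_ _≟ᴾ_) (Productₚ.≡-dec _≟ᴱ_ Finₚ._≟_)

  _≟ᴼ_ : DecidableEquality Outer
  _≟ᴼ_ = Productₚ.≡-dec Finₚ._≟_ Finₚ._≟_

  -- The ends of the counted gadget must go to opposite vertices of the four-cycle. In step (4) they
  -- differ because an edge of `G` joins two distinct vertices.
  tail≢head : ∀ x → tailEnd x ≢ headEnd x
  tail≢head (inj₁ (v , p01)) ()
  tail≢head (inj₁ (v , p02)) ()
  tail≢head (inj₁ (v , p12)) ()
  tail≢head (inj₂ (d , i)) eq = ℕₚ.<⇒≢ (e-lt d) (cong (λ o → toℕ (proj₁ o)) eq)

  -- Collapses G# to a four-cycle whose edge from b3 to b0 is the leg from the centre of the gadget x to its head.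
  module Count (x : Extra) where

    -- All outer cycles not at the gadget `x` share the vertex `b1`, which is adjacent to both `b0`
    -- and `b2`, so the rest of the graph forms the long way round from head to tail.
    outerPos : Outer → Bouquet
    outerPos o with o ≟ᴼ headEnd x | o ≟ᴼ tailEnd x
    ... | yes _ | _     = b0
    ... | no  _ | yes _ = b2
    ... | no  _ | no  _ = b1

    outerPos-head : outerPos (headEnd x) ≡ b0
    outerPos-head with headEnd x ≟ᴼ headEnd x
    ... | yes _ = ≡.refl
    ... | no ¬p = ⊥-elim (¬p ≡.refl)

    outerPos-tail : outerPos (tailEnd x) ≡ b2
    outerPos-tail with tailEnd x ≟ᴼ headEnd x | tailEnd x ≟ᴼ tailEnd x
    ... | yes p | _     = ⊥-elim (tail≢head x p)
    ... | no  _ | yes _ = ≡.refl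
    ... | no  _ | no ¬p = ⊥-elim (¬p ≡.refl)

    b1-outer : ∀ o → b1 ⌢ outerPos o
    b1-outer o with o ≟ᴼ headEnd x | o ≟ᴼ tailEnd x
    ... | yes _ | _     = e10
    ... | no  _ | yes _ = e12
    ... | no  _ | no  _ = ⌢-refl

    extraPos : Extra → Bouquet
    extraPos y with y ≟ˣ x
    ... | yes _ = b3 1ℤ
    ... | no  _ = b1

    innerPos : GadgetId → Bouquet
    innerPos (idS v)   = b1
    innerPos (idP v p) = extraPos (inj₁ (v , p))
    innerPos (idE d i) = extraPos (inj₂ (d , i))

    extraPos-tail : ∀ y → extraPos y ⌢ outerPos (tailEnd y)
    extraPos-tail y with y ≟ˣ x
    ... | yes ≡.refl = ≡.subst (b3 1ℤ ⌢_) (≡.sym outerPos-tail) e32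
    ... | no _       = b1-outer (tailEnd y)

    extraPos-head : ∀ y → extraPos y ⌢ outerPos (headEnd y)
    extraPos-head y with y ≟ˣ x
    ... | yes ≡.refl = ≡.subst (b3 1ℤ ⌢_) (≡.sym outerPos-head) e30
    ... | no _       = b1-outer (headEnd y)

    innerPos-end : ∀ k i → innerPos k ⌢ outerPos (endOf k i)
    innerPos-end (idS v)   i            = b1-outer (v , i)
    innerPos-end (idP v p) fzero        = extraPos-tail (inj₁ (v , p))
    innerPos-end (idP v p) (fsuc fzero) = extraPos-head (inj₁ (v , p))
    innerPos-end (idE d i) fzero        = extraPos-tail (inj₂ (d , i))
    innerPos-end (idE d i) (fsuc fzero) = extraPos-head (inj₂ (d , i))

    -- Constant on slices and rims, so that every gadget-cycle has count zero.
    posᵏ : ∀ k → SRaw g (sOf k) (ℓOf k) → Bouquet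
    posᵏ k (cyl i (fsuc fzero) j) = outerPos (endOf k i)
    posᵏ k (cyl i fzero j)        = innerPos k
    posᵏ k (prod p b)             = innerPos k

    posᵏ-ident : ∀ k {r r′} → SIdent r r′ → posᵏ k r ≡ posᵏ k r′
    posᵏ-ident k {prod p b}      {prod p′ b′} _ = ≡.refl
    posᵏ-ident k {cyl i fzero j} {prod p′ b′} _ = ≡.refl

    posᵏ-edge : ∀ k {r r′} → SEdge r r′ → posᵏ k r ⌢ posᵏ k r′
    posᵏ-edge k {prod _ _}             {prod _ _}              _            = ⌢-refl
    posᵏ-edge k {cyl i fzero _}        {cyl .i fzero _}        (≡.refl , _) = ⌢-refl
    posᵏ-edge k {cyl i fzero _}        {cyl .i (fsuc fzero) _} (≡.refl , _) = innerPos-end k i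
    posᵏ-edge k {cyl i (fsuc fzero) _} {cyl .i fzero _}        (≡.refl , _) = ⌢-sym (innerPos-end k i)
    posᵏ-edge k {cyl i (fsuc fzero) _} {cyl .i (fsuc fzero) _} (≡.refl , _) = ⌢-refl

    posᵏ-Z : ∀ v {r j} → ZEnd r j → posᵏ (idS v) r ≡ b1
    posᵏ-Z v {prod _ _} _ = ≡.refl

    module PosFold = Fold (λ o _ → outerPos o) (λ _ → b1) posᵏ
    module PosResp = PosFold.Resp {S = _≡_} ≡.refl ≡.sym ≡.trans posᵏ-ident (λ _ _ _ → ≡.refl) posᵏ-Z
    module PosHom = PosResp.Morphism {T = _⌢_} ⌢-refl ⌢-sym (resp₂-≡ _⌢_) posᵏ-edge

    pos : V# → Bouquet
    pos = PosFold.fold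

    count : Cocycle G# ℤᴳ
    count = pull {_~ᴮ_ = _⌢_} pos PosResp.fold-resp PosHom.fold-hom wind wind-cocycle

    open Cocycle count
    open Arcs {G#} ≈-refl {ℤᴳ} count

    pos-centre : ∀ k → pos (centre k) ≡ innerPos k
    pos-centre k = PosFold.fold-embed k _

    count-A : ∀ o → arc (A-at o) g ≡ 0ℤ
    count-A o = arc-ε (A-at o) g (λ _ _ → wind-self (outerPos o))

    count-Z : arc Z-at g ≡ 0ℤ
    count-Z = arc-ε Z-at g (λ _ _ → ≡.refl)

    -- Edges at `b1` are never counted, so the stretches of a loop along the spines of the copies of
    -- `S_3` drop out.
    through : ∀ {as} → All (λ a → pos a ≡ b1) as → ∀ a c cs → pos a ≡ b1 →
      along ℤᴳ ⟨_,_⟩ (a ∷ as ++ c ∷ cs) ≡ along ℤᴳ ⟨_,_⟩ (c ∷ cs)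
    through []       a c cs p = ≡.trans
      (cong (ℤ._+ along ℤᴳ ⟨_,_⟩ (c ∷ cs)) (≡.trans (cong (λ q → wind q (pos c)) p) (wind-b1ˡ (pos c)))) (ℤₚ.+-identityˡ _)
    through {as = b ∷ as} (q ∷ qs) a c cs p = ≡.trans
      (cong₂ ℤ._+_ (≡.trans (cong (λ r → wind r (pos b)) p) (wind-b1ˡ (pos b))) (through qs b c cs q)) (ℤₚ.+-identityˡ _)

    count-loop : ∀ y → along ℤᴳ ⟨_,_⟩ (loop y) ≡
      wind (extraPos y) (outerPos (headEnd y)) ℤ.+ wind (outerPos (tailEnd y)) (extraPos y)
    count-loop y = begin
      wind (pos (centre k)) H ℤ.+ (wind H (pos (f₁ 0)) ℤ.+ along ℤᴳ ⟨_,_⟩ (applyUpTo f₁ (suc ℓ₃) ++ f₀ ℓ₃ ∷ down))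
        ≡⟨ cong₂ (λ c r → wind c H ℤ.+ (wind H b1 ℤ.+ r)) c≡
             (through (Allₚ.applyUpTo⁺₂ (λ j → f₁ (suc j)) ℓ₃ (λ _ → ≡.refl)) (f₁ 0) (f₀ ℓ₃) down ≡.refl) ⟩
      wind C H ℤ.+ (wind H b1 ℤ.+ along ℤᴳ ⟨_,_⟩ (f₀ ℓ₃ ∷ down))
        ≡⟨ cong₂ (λ z r → wind C H ℤ.+ (z ℤ.+ r)) (wind-b1ʳ H)
             (through (Allₚ.applyDownFrom⁺₂ f₀ ℓ₃ (λ _ → ≡.refl)) (f₀ ℓ₃) _ _ ≡.refl) ⟩
      wind C H ℤ.+ (0ℤ ℤ.+ (wind T′ (pos (centre k)) ℤ.+ 0ℤ))
        ≡⟨ cong (λ c → wind C H ℤ.+ (0ℤ ℤ.+ (wind T′ c ℤ.+ 0ℤ))) c≡ ⟩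
      wind C H ℤ.+ (0ℤ ℤ.+ (wind T′ C ℤ.+ 0ℤ))
        ≡⟨ solve 2 (λ a b → a :+ (con 0ℤ :+ (b :+ con 0ℤ)) := a :+ b) ≡.refl (wind C H) (wind T′ C) ⟩
      wind C H ℤ.+ wind T′ C ∎
      where
      open ≡.≡-Reasoning
      k = extra y
      C = extraPos y
      H = outerPos (headEnd y)
      T′ = outerPos (tailEnd y)
      f₁ = K.spine (idS (proj₁ (headEnd y)))
      f₀ = K.spine (idS (proj₁ (tailEnd y)))
      down = applyDownFrom f₀ ℓ₃ ++ A-at (tailEnd y) 0 ∷ centre k ∷ []
      inner≡ : ∀ y → innerPos (extra y) ≡ extraPos y
      inner≡ (inj₁ _) = ≡.refl
      inner≡ (inj₂ _) = ≡.refl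
      c≡ : pos (centre k) ≡ C
      c≡ = ≡.trans (pos-centre k) (inner≡ y)

    extraPos-self : extraPos x ≡ b3 1ℤ
    extraPos-self with x ≟ˣ x
    ... | yes _ = ≡.refl
    ... | no ¬p = ⊥-elim (¬p ≡.refl)

    extraPos-other : ∀ {y} → y ≢ x → extraPos y ≡ b1
    extraPos-other {y} y≢x with y ≟ˣ x
    ... | yes p = ⊥-elim (y≢x p)
    ... | no  _ = ≡.refl

    count-self : along ℤᴳ ⟨_,_⟩ (loop x) ≡ 1ℤ
    count-self = ≡.trans (count-loop x) (≡.trans
      (cong₂ (λ h t → wind (extraPos x) h ℤ.+ wind t (extraPos x)) outerPos-head outerPos-tail)
      (cong (λ c → wind c b0 ℤ.+ wind b2 c) extraPos-self))

    count-other : ∀ y → y ≢ x → along ℤᴳ ⟨_,_⟩ (loop y) ≡ 0ℤ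
    count-other y y≢x = ≡.trans (count-loop y) (≡.trans
      (cong (λ c → wind c (outerPos (headEnd y)) ℤ.+ wind (outerPos (tailEnd y)) c) (extraPos-other y≢x))
      (cong₂ ℤ._+_ (wind-b1ˡ (outerPos (headEnd y))) (wind-b1ʳ (outerPos (tailEnd y)))))

  -- `balanced` makes the top ends of all copies of `S_3` agree on `Z*`. The top end of a copy of
  -- `S_2` is glued to nothing outside the copy, so its total weight is free, and reversed
  -- attachments only change a sign in it.
  module Weighted (4≤g : 4 ≤ g) (2≤ℓ₂ : 2 ≤ ℓ₂) (2≤ℓ₃ : 2 ≤ ℓ₃) (x : Outer → ℤ) (ζ : ℤ)
    (balanced : ∀ v → x (v , fzero) ℤ.+ x (v , fsuc fzero) ℤ.+ x (v , fsuc (fsuc fzero)) ≡ ζ) where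
    open Label g 4≤g

    2≤ℓ : ∀ k → 2 ≤ ℓOf k
    2≤ℓ (idS _)   = 2≤ℓ₃
    2≤ℓ (idP _ _) = 2≤ℓ₂
    2≤ℓ (idE _ _) = 2≤ℓ₂

    weight : GadgetId → ℕ → ℤ
    weight (idS v)   0             = x (v , fzero)
    weight (idS v)   1             = x (v , fsuc fzero)
    -- The clause also provides a default for the block number 3, which is reached only at offset 0.
    weight (idS v)   (suc (suc _)) = x (v , fsuc (fsuc fzero))
    weight (idP v p) 0             = x (v , fst# p)
    weight (idP v p) (suc _)       = x (v , snd# p)
    weight (idE d i) 0             = x (eu d , i)
    weight (idE d i) (suc _)       = x (ev d , i)

    flips : GadgetId → ℕ → Bool
    flips (idP v p) (suc _) = true
    flips _         _       = false

    weight-end : ∀ k i → weight k (toℕ i) ≡ x (endOf k i)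
    weight-end (idS v)   fzero               = ≡.refl
    weight-end (idS v)   (fsuc fzero)        = ≡.refl
    weight-end (idS v)   (fsuc (fsuc fzero)) = ≡.refl
    weight-end (idP v p) fzero               = ≡.refl
    weight-end (idP v p) (fsuc fzero)        = ≡.refl
    weight-end (idE d i) fzero               = ≡.refl
    weight-end (idE d i) (fsuc fzero)        = ≡.refl

    flips-end : ∀ k i → flips k (toℕ i) ≡ flipped k i
    flips-end (idS v)   i            = ≡.refl
    flips-end (idP v p) fzero        = ≡.refl
    flips-end (idP v p) (fsuc fzero) = ≡.refl
    flips-end (idE d _) i            = ≡.refl

    module C (k : GadgetId) = Cut g (sOf k) (ℓOf k) {{s≢0 = s≢0 k}} 4≤g (2≤ℓ k) (weight k) (flips k)

    lab-mod : ∀ w j → j ≤ g → lab w j ≡ lab w (toℕ (j mod g))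
    lab-mod w j j≤g with ℕₚ.m≤n⇒m<n∨m≡n j≤g
    ... | inj₁ j<g    = cong (lab w) (≡.sym (toℕ-mod-< j<g))
    ... | inj₂ ≡.refl = ≡.trans (lab-g w ≡.refl)
      (cong (lab w) (≡.sym (≡.trans (cong toℕ (n-mod-n j)) (toℕ-mod-< (ℕ.>-nonZero⁻¹ j)))))

    relabel-≤ : ∀ b {j} → j ≤ g → relabel g b j ≤ g
    relabel-≤ false j≤g = j≤g
    relabel-≤ true  {j} _ = ℕₚ.m∸n≤m g j

    cut-A : ∀ k i j → C.cut k (cyl i (fsuc fzero) j) ≡ P (lab (x (endOf k i)) (toℕ (relabel g (flipped k i) (toℕ j) mod g)))
    cut-A k i j = cong P (≡.trans
      (cong₂ (λ f w → lab w (relabel g f (toℕ j))) (flips-end k i) (weight-end k i))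
      (lab-mod _ _ (relabel-≤ (flipped k i) (ℕₚ.<⇒≤ (Finₚ.toℕ<n j)))))

    X≡ζ : ∀ v → C.X (idS v) ≡ ζ
    X≡ζ v = ≡.trans (cong₂ ℤ._+_ (cong₂ ℤ._+_ (≡.trans (ℤₚ.+-identityˡ _) (lap-g _)) (lap-g _)) (lap-g _)) (balanced v)

    cut-Z : ∀ v {r j} → ZEnd r j → C.cut (idS v) r ≡ T ζ (lab 1ℤ (toℕ j))
    cut-Z v {prod p b} {j} (pℓ , i , i<3 , eq) =
      ≡.trans (C.cut-top (idS v) {p} {b} (toℕ j) i pℓ i<3 eq) (cong (λ X → T X _) (X≡ζ v))

    module CutFold = Fold (λ o j → P (lab (x o) (toℕ j))) (λ j → T ζ (lab 1ℤ (toℕ j))) C.cut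
    module CutResp = CutFold.Resp {S = _≡_} ≡.refl ≡.sym ≡.trans C.cut-ident cut-A cut-Z
    module CutHom = CutResp.Morphism {T = _⇌_} ⇌-refl ⇌-sym (resp₂-≡ _⇌_) C.cut-edge

    at : V# → Target
    at = CutFold.fold

    winding : Cocycle G# ℤᴳ
    winding = pull {_~ᴮ_ = _⇌_} at CutResp.fold-resp CutHom.fold-hom flow flow-cocycle

    open Cocycle winding
    open Arcs {G#} ≈-refl {ℤᴳ} winding

    telescope : ∀ f (h : ℕ → ℤ) m → (∀ j → j < m → ⟨ f j , f (suc j) ⟩ ≡ h (suc j) ℤ.- h j) → arc f m ≡ h m ℤ.- h 0
    telescope f h zero    p = ≡.sym (ℤₚ.+-inverseʳ (h 0))
    telescope f h (suc m) p = ≡.trans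
      (cong₂ ℤ._+_ (telescope f h m (λ j j<m → p j (ℕₚ.m≤n⇒m≤1+n j<m))) (p m ℕₚ.≤-refl))
      (solve 3 (λ a b c → (b :- a) :+ (c :- b) := c :- a) ≡.refl (h 0) (h m) (h (suc m)))

    lab-wind : ∀ w j → j < g → wind (lab w (toℕ (j mod g))) (lab w (toℕ (suc j mod g))) ≡ lap w (suc j) ℤ.- lap w j
    lab-wind w j j<g = ≡.trans (≡.sym (cong₂ wind (lab-mod w j (ℕₚ.<⇒≤ j<g)) (lab-mod w (suc j) j<g)))
      (≡.trans (proj₂ (lab-step w j j<g)) (≡.sym (≡.trans (cong (λ z → lap w (suc j) ℤ.- z) (lap-< w j<g)) (ℤₚ.+-identityʳ _))))

    lap-total : ∀ w → lap w g ℤ.- lap w 0 ≡ w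
    lap-total w = ≡.trans (cong₂ ℤ._-_ (lap-g w) (lap-< w (ℕ.>-nonZero⁻¹ g))) (ℤₚ.+-identityʳ w)

    winding-A : ∀ o → arc (A-at o) g ≡ x o
    winding-A o = ≡.trans (telescope (A-at o) (lap (x o)) g (lab-wind (x o))) (lap-total (x o))

    winding-Z : arc Z-at g ≡ ζ
    winding-Z = ≡.trans (telescope Z-at (λ j → ζ ℤ.* lap 1ℤ j) g
        (λ j j<g → ≡.trans (cong (ζ ℤ.*_) (lab-wind 1ℤ j j<g))
          (solve 3 (λ z a b → z :* (a :- b) := z :* a :- z :* b) ≡.refl ζ (lap 1ℤ (suc j)) (lap 1ℤ j))))
      (≡.trans (solve 3 (λ z a b → z :* a :- z :* b := z :* (a :- b)) ≡.refl ζ (lap 1ℤ g) (lap 1ℤ 0))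
        (≡.trans (cong (ζ ℤ.*_) (lap-total 1ℤ)) (ℤₚ.*-identityʳ ζ)))

    private
      Base : V# → Set
      Base a = Basepoint (at a)

      spine-base : ∀ k q → Base (K.spine k q)
      spine-base k q = ≡.subst Basepoint (≡.sym (CutFold.fold-embed k _))
        (C.cut-basepoint k (K.clamp k q) _ (toℕ-mod-< {{sg≢0 k}} (ℕ.>-nonZero⁻¹ _ {{sg≢0 k}})))

      outer-base : ∀ o → Base (A-at o 0)
      outer-base o = ≡.subst (λ j → Basepoint (P (lab (x o) j))) (≡.sym (toℕ-mod-< (ℕ.>-nonZero⁻¹ g))) at-P

    winding-loop : ∀ y → along ℤᴳ ⟨_,_⟩ (loop y) ≡ 0ℤ
    winding-loop y = along-ε {A = ℤᴳ} {e = ⟨_,_⟩} {Q = Base} flow-basepoint {loop y}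
      (spine-base (extra y) 0 ∷ outer-base (headEnd y) ∷
       Allₚ.++⁺ (Allₚ.applyUpTo⁺₂ (K.spine (idS v)) (suc ℓ₃) (spine-base (idS v)))
         (Allₚ.++⁺ (Allₚ.applyDownFrom⁺₂ (K.spine (idS u)) (suc ℓ₃) (spine-base (idS u)))
           (outer-base (tailEnd y) ∷ spine-base (extra y) 0 ∷ [])))
      where
      v = proj₁ (headEnd y)
      u = proj₁ (tailEnd y)

-- Finiteness of the index sets

Finite : Set → Set
Finite X = ∃ λ k → Fin k ↔ X

finite-⊎ : ∀ {X Y} → Finite X → Finite Y → Finite (X ⊎ Y)
finite-⊎ (j , f) (k , h) = j + k , (f ⊎-↔ h) ↔-∘ Finₚ.+↔⊎

finite-× : ∀ {X Y} → Finite X → Finite Y → Finite (X × Y)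
finite-× (j , f) (k , h) = j * k , (f ×-↔ h) ↔-∘ Finₚ.*↔×

finite-Dec : ∀ {X} → Irrelevant X → Dec X → Finite X
finite-Dec irr (yes x) = 1 , mk↔ₛ′ (λ _ → x) (λ _ → fzero) (irr x) (λ { fzero → ≡.refl ; (fsuc ()) })
finite-Dec irr (no ¬x) = 0 , mk↔ₛ′ (λ ()) (λ x → ⊥-elim (¬x x)) (λ x → ⊥-elim (¬x x)) (λ ())

finite-Σ : ∀ k {X : Fin k → Set} → (∀ i → Finite (X i)) → Finite (Σ (Fin k) X)
finite-Σ zero    f = 0 , mk↔ₛ′ (λ ()) (λ ()) (λ ()) (λ ())
finite-Σ (suc k) {X} f = let (m , h) = finite-⊎ (f fzero) (finite-Σ k (λ i → f (fsuc i))) in m , uncons ↔-∘ h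
  where
  uncons : (X fzero ⊎ Σ (Fin k) (λ i → X (fsuc i))) ↔ Σ (Fin (suc k)) X
  uncons = mk↔ₛ′ (λ { (inj₁ x) → fzero , x ; (inj₂ (i , x)) → fsuc i , x })
    (λ { (fzero , x) → inj₁ x ; (fsuc i , x) → inj₂ (i , x) })
    (λ { (fzero , x) → ≡.refl ; (fsuc i , x) → ≡.refl })
    (λ { (inj₁ x) → ≡.refl ; (inj₂ (i , x)) → ≡.refl })

finite-P3 : Finite P3
finite-P3 = 3 , mk↔ₛ′
  (λ { fzero → p01 ; (fsuc fzero) → p02 ; (fsuc (fsuc fzero)) → p12 })
  (λ { p01 → fzero ; p02 → fsuc fzero ; p12 → fsuc (fsuc fzero) })
  (λ { p01 → ≡.refl ; p02 → ≡.refl ; p12 → ≡.refl })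
  (λ { fzero → ≡.refl ; (fsuc fzero) → ≡.refl ; (fsuc (fsuc fzero)) → ≡.refl })

finite-EdgeIx : ∀ G → Finite (EdgeIx G)
finite-EdgeIx G = let (k , f) = pairs in k , as-record ↔-∘ f
  where
  open IGraph G
  Q : Fin n → Fin n → Set
  Q u v = toℕ u < toℕ v × adj u v ≡ true
  pairs : Finite (Σ (Fin n) λ u → Σ (Fin n) λ v → Q u v)
  pairs = finite-Σ n λ u → finite-Σ n λ v → finite-Dec
    (λ { (p , q) (p′ , q′) → cong₂ _,_ (ℕₚ.<-irrelevant p p′) (Decidable⇒UIP.≡-irrelevant Boolₚ._≟_ q q′) })
    ((toℕ u ℕₚ.<? toℕ v) ×-dec (adj u v Boolₚ.≟ true))
  as-record : (Σ (Fin n) λ u → Σ (Fin n) λ v → Q u v) ↔ EdgeIx G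
  as-record = mk↔ₛ′
    (λ { (u , v , p , q) → record { eu = u ; ev = v ; e-lt = p ; e-adj = q } })
    (λ e → EdgeIx.eu e , EdgeIx.ev e , EdgeIx.e-lt e , EdgeIx.e-adj e)
    (λ _ → ≡.refl) (λ _ → ≡.refl)

atMostOne : ℕ → ℕ
atMostOne zero    = 0
atMostOne (suc _) = 1

atMostOne-irrelevant : ∀ n → Irrelevant (Fin (atMostOne n))
atMostOne-irrelevant (suc _) fzero fzero = ≡.refl

to-vertex : ∀ n → Fin (atMostOne n) → Fin n
to-vertex (suc _) _ = fzero

from-vertex : ∀ n → Fin n → Fin (atMostOne n)
from-vertex (suc _) _ = fzero

lastOr-map : ∀ {A B : Set} (f : A → B) a xs → lastOr (f a) (map f xs) ≡ f (lastOr a xs)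
lastOr-map f a []       = ≡.refl
lastOr-map f a (x ∷ xs) = lastOr-map f x xs

-- Assembly of the two bases

module SharpBasis (G : IGraph) (g ℓ₂ ℓ₃ : ℕ) .{{_ : NonZero g}}
    (4≤g : 4 ≤ g) (2≤ℓ₂ : 2 ≤ ℓ₂) (2≤ℓ₃ : 2 ≤ ℓ₃) where
  open IGraph G using (n)
  open SharpGraph G g ℓ₂ ℓ₃
  open SharpCycles G g ℓ₂ ℓ₃

  -- Lets the crossing cocycles of `G#` serve as dual cocycles on `T*` too.
  restrict : ∀ {A} → Cocycle G# A → Cocycle T* A
  restrict e = record
    { ⟨_,_⟩ = λ a b → ⟨ proj₁ a , proj₁ b ⟩ ; resp = resp ; cocyc = cocyc }
    where open Cocycle e

  along-restrict : ∀ {A} (e : Cocycle G# A) xs →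
    along A (Cocycle.⟨_,_⟩ (restrict e)) xs ≡ along A (Cocycle.⟨_,_⟩ e) (map proj₁ xs)
  along-restrict e []           = ≡.refl
  along-restrict e (a ∷ [])     = ≡.refl
  along-restrict {A} e (a ∷ b ∷ xs) = cong (AbelianGroup._∙_ A _) (along-restrict e (b ∷ xs))

  closed-map : ∀ xs → Hom.ClosedWalk T* xs → Hom.ClosedWalk G# (map proj₁ xs)
  closed-map xs (a , ys , ≡.refl , l , q) = proj₁ a , map proj₁ ys , ≡.refl , Linkedₚ.map⁺ l ,
    ≡.subst (_≈# proj₁ a) (≡.sym (lastOr-map proj₁ a ys)) q

  extras : Finite Extra
  extras = finite-⊎ (finite-× (n , ↔-id _) finite-P3) (finite-× (finite-EdgeIx G) (3 , ↔-id _))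

  kT : ℕ
  kT = proj₁ extras

  module Ex = Inverse (proj₂ extras)

  loopBasis : Fin kT → List TV
  loopBasis i = loopT (Ex.to i)

  along-loopT : ∀ {A} (e : Cocycle G# A) x →
    along A (Cocycle.⟨_,_⟩ (restrict e)) (loopT x) ≡ along A (Cocycle.⟨_,_⟩ e) (loop x)
  along-loopT {A} e x = ≡.trans (along-restrict e (loopT x)) (cong (along A (Cocycle.⟨_,_⟩ e)) (map-loopT x))

  T*-basis : Hom.IsNTBasis T* kT loopBasis
  T*-basis = Criterion.isNTBasis T* ≈-refl loopBasis (λ i → loopT-closed (Ex.to i))
    (λ A e h → exact-T* e λ x → ≡.subst
      (λ y → AbelianGroup._≈_ A (along A (Cocycle.⟨_,_⟩ e) (loopT y)) (AbelianGroup.ε A))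
      (Ex.strictlyInverseˡ x) (h (Ex.from x)))
    (λ i → restrict (Count.count (Ex.to i)) ,
      ≡.trans (along-loopT (Count.count (Ex.to i)) (Ex.to i)) (Count.count-self (Ex.to i)) ,
      λ j j≢i → ≡.trans (along-loopT (Count.count (Ex.to i)) (Ex.to j))
        (Count.count-other (Ex.to i) (Ex.to j) λ eq → j≢i
          (≡.trans (≡.sym (Ex.strictlyInverseʳ j)) (≡.trans (cong Ex.from eq) (Ex.strictlyInverseʳ i)))))

  -- Z* is a cycle of G# only if G has a vertex.
  Generator : Set
  Generator = Fin (atMostOne n) ⊎ (Fin n × Fin 2)

  generators : Finite Generator
  generators = finite-⊎ (atMostOne n , ↔-id _) (finite-× (n , ↔-id _) (2 , ↔-id _))

  kG : ℕ
  kG = proj₁ generators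

  module Gen = Inverse (proj₂ generators)

  -- `Z*` is represented by the top slice of the copy of `S_3` at the first vertex: it goes once
  -- around `Z*` and stays three positions at each vertex.
  generator : Generator → GadgetCycle
  generator (inj₁ o)       = idS (to-vertex n o) , slice (K.top (idS (to-vertex n o)))
  generator (inj₂ (v , i)) = idS v , acyc (inject₁ i)

  gadgetBasis : Fin kG → GadgetCycle
  gadgetBasis i = generator (Gen.to i)

  Index : Set
  Index = Generator ⊎ Extra

  index : Fin (kG + kT) → Index
  index i = Sum.map Gen.to Ex.to (splitAt kG i)

  position : Index → Fin (kG + kT)
  position a = join kG kT (Sum.map Gen.from Ex.from a)

  index-position : ∀ a → index (position a) ≡ a
  index-position (inj₁ a) = ≡.trans (cong (Sum.map Gen.to Ex.to) (Finₚ.splitAt-join kG kT (inj₁ (Gen.from a))))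
    (cong inj₁ (Gen.strictlyInverseˡ a))
  index-position (inj₂ a) = ≡.trans (cong (Sum.map Gen.to Ex.to) (Finₚ.splitAt-join kG kT (inj₂ (Ex.from a))))
    (cong inj₂ (Ex.strictlyInverseˡ a))

  position-index : ∀ i → position (index i) ≡ i
  position-index i = ≡.trans (cong (join kG kT) (cancel (splitAt kG i))) (Finₚ.join-splitAt kG kT i)
    where
    cancel : ∀ s → Sum.map Gen.from Ex.from (Sum.map Gen.to Ex.to s) ≡ s
    cancel (inj₁ a) = cong inj₁ (Gen.strictlyInverseʳ a)
    cancel (inj₂ a) = cong inj₂ (Ex.strictlyInverseʳ a)

  walk : Index → List V#
  walk (inj₁ a) = gcWalk (generator a)
  walk (inj₂ x) = map proj₁ (loopT x)

  combine-walk : ∀ i → combine gadgetBasis loopBasis i ≡ walk (index i)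
  combine-walk i with splitAt kG i
  ... | inj₁ _ = ≡.refl
  ... | inj₂ _ = ≡.refl

  walk-closed : ∀ a → Hom.ClosedWalk G# (walk a)
  walk-closed (inj₁ a) = gcWalk-closed (generator a)
  walk-closed (inj₂ x) = closed-map (loopT x) (loopT-closed x)

  module _ {A : AbelianGroup 0ℓ 0ℓ} (e : Cocycle G# A) where
    open AbelianGroup A
    open Cocycle e
    open Arcs {G#} ≈-refl {A} e
    open Periods e

    exact : (∀ a → along A ⟨_,_⟩ (walk a) ≈ ε) → Exact e
    exact h = exact-G# e outer
        (λ x → trans (reflexive (cong (along A ⟨_,_⟩) (≡.sym (map-loopT x)))) (h (inj₂ x)))
      where
      Z-closed : Fin n → arc Z-at g ≈ ε
      Z-closed v = trans (sym (along-top (to-vertex n (from-vertex n v)))) (h (inj₁ (inj₁ (from-vertex n v))))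
      first : ∀ v i → arc (A-at (v , inject₁ i)) g ≈ ε
      first v i = trans (sym (along-acyc v (inject₁ i))) (h (inj₁ (inj₂ (v , i))))
      outer : ∀ o → arc (A-at o) g ≈ ε
      outer (v , fzero)             = first v fzero
      outer (v , fsuc fzero)        = first v (fsuc fzero)
      outer (v , fsuc (fsuc fzero)) = third-outer v (Z-closed v) (first v fzero) (first v (fsuc fzero))

  DualAt : Index → Set
  DualAt a = ∃ λ (φ : Cocycle G# ℤᴳ) → let open Cocycle φ in
    along ℤᴳ ⟨_,_⟩ (walk a) ≡ 1ℤ × (∀ b → b ≢ a → along ℤᴳ ⟨_,_⟩ (walk b) ≡ 0ℤ)

  along-walk : ∀ (φ : Cocycle G# ℤᴳ) x → along ℤᴳ (Cocycle.⟨_,_⟩ φ) (walk (inj₂ x)) ≡ along ℤᴳ (Cocycle.⟨_,_⟩ φ) (loop x)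
  along-walk φ x = cong (along ℤᴳ (Cocycle.⟨_,_⟩ φ)) (map-loopT x)

  -- The weights `(0, 0, 1)` at every vertex are balanced with total 1 and vanish on the chosen
  -- cycles `A^v_0` and `A^v_1`: the dual of the class of `Z*`.
  third : Outer → ℤ
  third (_ , fzero)             = 0ℤ
  third (_ , fsuc fzero)        = 0ℤ
  third (_ , fsuc (fsuc fzero)) = 1ℤ

  module _ (v : Fin n) where

    -- The entry -1 at the cycle outside the basis restores the balance with total 0, as a cocycle
    -- that vanishes on `Z*` requires.
    table : Fin 2 → Fin 3 → ℤ
    table fzero        fzero               = 1ℤ
    table fzero        (fsuc fzero)        = 0ℤ
    table (fsuc fzero) fzero               = 0ℤ
    table (fsuc fzero) (fsuc fzero)        = 1ℤ
    table _            (fsuc (fsuc fzero)) = -1ℤ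

    difference : Fin 2 → Outer → ℤ
    difference i (w , j) with w Finₚ.≟ v
    ... | yes _ = table i j
    ... | no  _ = 0ℤ

    difference-balanced : ∀ i w → difference i (w , fzero) ℤ.+ difference i (w , fsuc fzero)
      ℤ.+ difference i (w , fsuc (fsuc fzero)) ≡ 0ℤ
    difference-balanced i            w with w Finₚ.≟ v
    difference-balanced fzero        w | yes _ = ≡.refl
    difference-balanced (fsuc fzero) w | yes _ = ≡.refl
    difference-balanced i            w | no  _ = ≡.refl

    difference-self : ∀ i → difference i (v , inject₁ i) ≡ 1ℤ
    difference-self i            with v Finₚ.≟ v
    difference-self fzero        | yes _ = ≡.refl
    difference-self (fsuc fzero) | yes _ = ≡.refl
    difference-self i            | no ¬p = ⊥-elim (¬p ≡.refl)

    difference-other : ∀ i w j → (w , j) ≢ (v , i) → difference i (w , inject₁ j) ≡ 0ℤ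
    difference-other i            w j            neq with w Finₚ.≟ v
    difference-other i            w j            neq | no _       = ≡.refl
    difference-other fzero        w fzero        neq | yes ≡.refl = ⊥-elim (neq ≡.refl)
    difference-other fzero        w (fsuc fzero) neq | yes ≡.refl = ≡.refl
    difference-other (fsuc fzero) w fzero        neq | yes ≡.refl = ≡.refl
    difference-other (fsuc fzero) w (fsuc fzero) neq | yes ≡.refl = ⊥-elim (neq ≡.refl)

  dualAt : ∀ a → DualAt a
  dualAt (inj₁ (inj₁ o)) = W.winding , ≡.trans (Q.along-top _) W.winding-Z , other
    where
    module W = Weighted 4≤g 2≤ℓ₂ 2≤ℓ₃ third 1ℤ (λ _ → ≡.refl)
    module Q = Periods W.winding
    other : ∀ b → b ≢ inj₁ (inj₁ o) → along ℤᴳ (Cocycle.⟨_,_⟩ W.winding) (walk b) ≡ 0ℤ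
    other (inj₁ (inj₁ o′))              neq = ⊥-elim (neq (cong (λ p → inj₁ (inj₁ p)) (atMostOne-irrelevant n o′ o)))
    other (inj₁ (inj₂ (v , fzero)))      _  = ≡.trans (Q.along-acyc v fzero) (W.winding-A _)
    other (inj₁ (inj₂ (v , fsuc fzero))) _  = ≡.trans (Q.along-acyc v (fsuc fzero)) (W.winding-A _)
    other (inj₂ x)                       _  = ≡.trans (along-walk W.winding x) (W.winding-loop x)
  dualAt (inj₁ (inj₂ (v , i))) =
    W.winding , ≡.trans (Q.along-acyc v (inject₁ i)) (≡.trans (W.winding-A _) (difference-self v i)) , other
    where
    module W = Weighted 4≤g 2≤ℓ₂ 2≤ℓ₃ (difference v i) 0ℤ (difference-balanced v i)
    module Q = Periods W.winding
    other : ∀ b → b ≢ inj₁ (inj₂ (v , i)) → along ℤᴳ (Cocycle.⟨_,_⟩ W.winding) (walk b) ≡ 0ℤ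
    other (inj₁ (inj₁ o))       _   = ≡.trans (Q.along-top _) W.winding-Z
    other (inj₁ (inj₂ (w , j))) neq = ≡.trans (Q.along-acyc w (inject₁ j)) (≡.trans (W.winding-A _)
      (difference-other v i w j λ eq → neq (cong (λ p → inj₁ (inj₂ p)) eq)))
    other (inj₂ x)              _   = ≡.trans (along-walk W.winding x) (W.winding-loop x)
  dualAt (inj₂ x) = count , ≡.trans (along-walk count x) count-self , other
    where
    open Count x
    module Q = Periods count
    other : ∀ b → b ≢ inj₂ x → along ℤᴳ (Cocycle.⟨_,_⟩ count) (walk b) ≡ 0ℤ
    other (inj₁ (inj₁ o))       _   = ≡.trans (Q.along-top _) count-Z
    other (inj₁ (inj₂ (w , j))) _   = ≡.trans (Q.along-acyc w (inject₁ j)) (count-A _)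
    other (inj₂ y)              neq = ≡.trans (along-walk count y) (count-other y λ eq → neq (cong inj₂ eq))

  G#-basis : Hom.IsNTBasis G# (kG + kT) (combine gadgetBasis loopBasis)
  G#-basis = Criterion.isNTBasis G# ≈-refl (combine gadgetBasis loopBasis)
    (λ i → ≡.subst (Hom.ClosedWalk G#) (≡.sym (combine-walk i)) (walk-closed (index i)))
    (λ A e h → exact e λ a → ≡.subst
      (λ w → AbelianGroup._≈_ A (along A (Cocycle.⟨_,_⟩ e) w) (AbelianGroup.ε A))
      (≡.trans (combine-walk (position a)) (cong walk (index-position a))) (h (position a)))
    λ i → let (φ , p , q) = dualAt (index i) in φ ,
      ≡.trans (cong (along ℤᴳ (Cocycle.⟨_,_⟩ φ)) (combine-walk i)) p ,
      λ j j≢i → ≡.trans (cong (along ℤᴳ (Cocycle.⟨_,_⟩ φ)) (combine-walk j))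
        (q (index j) λ eq → j≢i (≡.trans (≡.sym (position-index j)) (≡.trans (cong position eq) (position-index i))))

theorem7p1 : (m : ℕ) (adjH : Fin m → Fin m → Set) →
    IsConnTriFreeReflNontriv m adjH →
    (g : ℕ) → 4 ≤ g → (zf : Fin g → Fin m) → IsShortestNT m adjH g zf →
    (ℓ₂ ℓ₃ : ℕ) → LCond g 2 ℓ₂ → LCond g 3 ℓ₃ →
    (G : IGraph) →
    ∃ λ (kT : ℕ) → ∃ λ (tb : Fin kT → List (Sharp.TV G g ℓ₂ ℓ₃)) →
    Hom.IsNTBasis (Sharp.T* G g ℓ₂ ℓ₃) kT tb ×
    (∃ λ (kG : ℕ) → ∃ λ (gc : Fin kG → Sharp.GadgetCycle G g ℓ₂ ℓ₃) →
    Hom.IsNTBasis (Sharp.G# G g ℓ₂ ℓ₃) (kG + kT) (Sharp.combine G g ℓ₂ ℓ₃ gc tb))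
theorem7p1 _ _ _ g 4≤g _ _ ℓ₂ ℓ₃ (2≤ℓ₂ , _) (2≤ℓ₃ , _) G =
  B.kT , B.loopBasis , B.T*-basis , B.kG , B.gadgetBasis , B.G#-basis
  where
  module B = SharpBasis G g ℓ₂ ℓ₃ {{ℕ.>-nonZero (ℕₚ.≤-trans (s≤s z≤n) 4≤g)}} 4≤g 2≤ℓ₂ 2≤ℓ₃
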